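{- Let $\mathcal{P}$ be a local, probabilistic (bilateral) parking procedure, and $r\geq 1$. Then the sum of the parking probabilities $\mathrm{Park}_{\mathcal{P}}(W)$ over all words $W\in\mathbb{Z}^r$ of length $r$ is $(r+1)^{r-1}$.
   Context: $\mathrm{Fin}(\mathbb{Z})$ is the set of finite subsets of $\mathbb{Z}$; words have letters in $\mathbb{Z}$; $\epsilon$ is the empty word. A block of $S\subset\mathbb{Z}$ is a maximal nonempty interval of consecutive integers contained in $S$. A bilateral probabilistic parking procedure $\mathcal{P}$ is the data of real numbers $\mathrm{Dir}_{\mathcal{P}}(W,S,a)\in[0,1]$ (the probability to go right) for all $S\in\mathrm{Fin}(\mathbb{Z})$, all words $W$ with exactly $\#S$ letters all of which belong to $S$, and all $a\in S$. Let $G(\mathcal{P})$ be the weighted directed graph whose vertices are all such pairs $(W,S)$, with the following edges for each vertex $(W,S)$ and each $a\in\mathbb{Z}$: if $a\notin S$, an edge $(W,S)\to(Wa,S\sqcup\{a\})$ of weight $1$; if $a\in S$ and $\{s,\ldots,t\}$ is the block of $S$ containing $a$, an edge $(W,S)\to(Wa,S\cup\{t+1\})$ of weight $\mathrm{Dir}_{\mathcal{P}}(W,S,a)$ and an edge $(W,S)\to(Wa,S\cup\{s-1\})$ of weight $1-\mathrm{Dir}_{\mathcal{P}}(W,S,a)$. Then $\mathcal{P}_W(S)$ is the total weight (sum over paths of the product of edge weights) of all paths from $(\epsilon,\emptyset)$ to $(W,S)$ (it is $0$ if $(W,S)$ is not a vertex). For fixed $W$, $\mathcal{P}_W$ is a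 finitely supported probability measure on $\mathrm{Fin}(\mathbb{Z})$. The parking probability of a word $W$ of length $r$ is $\mathrm{Park}_{\mathcal{P}}(W)=\mathcal{P}_W(\{1,\ldots,r\})$. Let $\tau:i\mapsto i+1$ on $\mathbb{Z}$, extended to subsets and words. $\mathcal{P}$ is local if it is shift invariant, i.e. $\mathrm{Dir}_{\mathcal{P}}(\tau(W),\tau(S),\tau(a))=\mathrm{Dir}_{\mathcal{P}}(W,S,a)$ for all $(W,S,a)$, and locally decided, i.e. whenever $\mathcal{P}_W(S)>0$, $a\in S$, and $I$ is the block of $S$ containing $a$, one has $\mathrm{Dir}_{\mathcal{P}}(W,S,a)=\mathrm{Dir}_{\mathcal{P}}(W_{|I},I,a)$, where $W_{|I}$ is the subword of $W$ formed by the letters of the cars that parked in $I$ (equivalently, since the procedure is bilateral, by the letters of $W$ belonging to $I$; it has exactly $\#I$ letters). -}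

module Defs where

open import Data.Bool using (Bool; true; false)
open import Data.Empty using (⊥-elim; ⊥-elim-irr)
open import Data.Integer as ℤ using (ℤ; +_; -[1+_]; _≤_; _<_; pred) renaming (suc to sucℤ)
import Data.Integer.Properties as ℤₚ
open import Data.List using (List; []; _∷_; _∷ʳ_; _++_; map; foldr; length; filter; concatMap)
open import Data.List.Membership.DecPropositional ℤ._≟_ using (_∈?_)
import Data.List.Membership.Propositional as Mem
import Data.List.Membership.Propositional.Properties as Memₚ
import Data.List.Properties as Listₚ
open import Data.List.Relation.Unary.All as All using (All; []; _∷_)
import Data.List.Relation.Unary.All.Properties as Allₚ
open import Data.List.Relation.Unary.AllPairs as AllPairs using (AllPairs; []; _∷_)
import Data.List.Relation.Unary.AllPairs.Properties as AllPairsₚ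
open import Data.List.Relation.Unary.Any using (here; there)
open import Data.List.Relation.Unary.Unique.Propositional using (Unique)
import Data.List.Relation.Unary.Unique.Propositional.Properties as Uniqueₚ
open import Data.Maybe using (Maybe; just; nothing)
open import Data.Nat as ℕ using (ℕ; zero; suc)
import Data.Nat.Properties as ℕₚ
open import Data.Product using (∃; _×_; _,_; proj₁; proj₂; map₂)
open import Data.Rational as ℚ using (ℚ; 0ℚ; 1ℚ; ½)
import Data.Rational.Properties as ℚₚ
open import Algebra.Bundles using (CommutativeMonoid)
open import Algebra.Properties.CommutativeSemigroup
  (CommutativeMonoid.commutativeSemigroup ℚₚ.+-0-commutativeMonoid) using (interchange)
open import Data.Sum using (inj₁; inj₂)
open import Function using (_∘_)
open import Relation.Binary.Construct.Closure.ReflexiveTransitive using (Star; _◅_) renaming (ε to stay)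
open import Relation.Binary.Definitions using (tri<; tri≈; tri>)
open import Relation.Binary.PropositionalEquality
  using (_≡_; _≢_; refl; sym; trans; cong; cong₂; subst; subst₂; module ≡-Reasoning)
open import Relation.Nullary using (¬_; Dec; yes; no; recompute)
open import Relation.Nullary.Decidable using (_×-dec_; map′)

-- The real numbers, as Cauchy sequences of rationals; their equality is _≈ᴿ_.
record ℝ : Set where
  constructor mkℝ
  field
    seq    : ℕ → ℚ
    cauchy : ∀ ε → 0ℚ ℚ.< ε → ∃ λ N → ∀ m n → N ℕ.≤ m → N ℕ.≤ n →
             ℚ.∣ seq m ℚ.- seq n ∣ ℚ.< ε

open ℝ public

p≡[p-q]+q : ∀ p q → p ≡ (p ℚ.- q) ℚ.+ q
p≡[p-q]+q p q = sym (trans (ℚₚ.+-assoc p (ℚ.- q) q)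
  (trans (cong (p ℚ.+_) (ℚₚ.+-inverseˡ q)) (ℚₚ.+-identityʳ p)))

[p+q]-[r+s] : ∀ p q r s → (p ℚ.+ q) ℚ.- (r ℚ.+ s) ≡ (p ℚ.- r) ℚ.+ (q ℚ.- s)
[p+q]-[r+s] p q r s = trans (cong ((p ℚ.+ q) ℚ.+_) (ℚₚ.neg-distrib-+ r s))
  (interchange p q (ℚ.- r) (ℚ.- s))

pq-rs : ∀ p q r s → p ℚ.* q ℚ.- r ℚ.* s ≡ p ℚ.* (q ℚ.- s) ℚ.+ s ℚ.* (p ℚ.- r)
pq-rs p q r s = sym (begin
  p ℚ.* (q ℚ.- s) ℚ.+ s ℚ.* (p ℚ.- r)
    ≡⟨ cong₂ ℚ._+_ (distrib p q s) (distrib s p r) ⟩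
  (p ℚ.* q ℚ.- p ℚ.* s) ℚ.+ (s ℚ.* p ℚ.- s ℚ.* r)
    ≡⟨ cong₂ (λ u v → (p ℚ.* q ℚ.- p ℚ.* s) ℚ.+ (u ℚ.- v)) (ℚₚ.*-comm s p) (ℚₚ.*-comm s r) ⟩
  (p ℚ.* q ℚ.- p ℚ.* s) ℚ.+ (p ℚ.* s ℚ.- r ℚ.* s)
    ≡⟨ ℚₚ.+-assoc (p ℚ.* q ℚ.- p ℚ.* s) (p ℚ.* s) _ ⟨
  (p ℚ.* q ℚ.- p ℚ.* s) ℚ.+ p ℚ.* s ℚ.- r ℚ.* s
    ≡⟨ cong (ℚ._- r ℚ.* s) (p≡[p-q]+q (p ℚ.* q) (p ℚ.* s)) ⟨
  p ℚ.* q ℚ.- r ℚ.* s ∎)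
  where
  open ≡-Reasoning
  distrib : ∀ a b c → a ℚ.* (b ℚ.- c) ≡ a ℚ.* b ℚ.- a ℚ.* c
  distrib a b c = trans (ℚₚ.*-distribˡ-+ a b (ℚ.- c))
    (cong (a ℚ.* b ℚ.+_) (sym (ℚₚ.neg-distribʳ-* a c)))

½ε>0 : ∀ {ε} → 0ℚ ℚ.< ε → 0ℚ ℚ.< ½ ℚ.* ε
½ε>0 {ε} h = ℚₚ.positive⁻¹ (½ ℚ.* ε)
  where instance
    _ = ℚ.positive h
    _ = ℚₚ.pos*pos⇒pos ½ ε

½ε+½ε : ∀ ε → ½ ℚ.* ε ℚ.+ ½ ℚ.* ε ≡ ε
½ε+½ε ε = trans (sym (ℚₚ.*-distribʳ-+ ε ½ ½)) (ℚₚ.*-identityˡ ε)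

bounded : ∀ x → ∃ λ B → 0ℚ ℚ.< B × ∃ λ N → ∀ n → N ℕ.≤ n → ℚ.∣ seq x n ∣ ℚ.< B
bounded x with cauchy x 1ℚ (ℚₚ.positive⁻¹ 1ℚ)
... | N , h = B , B>0 , N , λ n N≤n → begin-strict
    ℚ.∣ f n ∣                         ≡⟨ cong ℚ.∣_∣ (p≡[p-q]+q (f n) (f N)) ⟩
    ℚ.∣ (f n ℚ.- f N) ℚ.+ f N ∣       ≤⟨ ℚₚ.∣p+q∣≤∣p∣+∣q∣ (f n ℚ.- f N) (f N) ⟩
    ℚ.∣ f n ℚ.- f N ∣ ℚ.+ ℚ.∣ f N ∣   <⟨ ℚₚ.+-monoˡ-< ℚ.∣ f N ∣ (h n N N≤n ℕₚ.≤-refl) ⟩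
    B                                 ∎
  where
  open ℚₚ.≤-Reasoning
  f = seq x
  B = 1ℚ ℚ.+ ℚ.∣ f N ∣
  B>0 : 0ℚ ℚ.< B
  B>0 = ℚₚ.<-≤-trans (ℚₚ.positive⁻¹ 1ℚ)
          (ℚₚ.≤-trans (ℚₚ.≤-reflexive (sym (ℚₚ.+-identityʳ 1ℚ)))
                      (ℚₚ.+-monoʳ-≤ 1ℚ (ℚₚ.0≤∣p∣ (f N))))

fromℚ : ℚ → ℝ
fromℚ q = mkℝ (λ _ → q) λ ε ε>0 → 0 , λ _ _ _ _ →
  subst (ℚ._< ε) (cong ℚ.∣_∣ (sym (ℚₚ.+-inverseʳ q))) ε>0

fromℕ : ℕ → ℝ
fromℕ n = fromℚ (+ n ℚ./ 1)

0ᴿ 1ᴿ : ℝ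
0ᴿ = fromℚ 0ℚ
1ᴿ = fromℚ 1ℚ

infixl 6 _+ᴿ_ _-ᴿ_
infixl 7 _*ᴿ_
infix  8 -ᴿ_
infix  4 _≈ᴿ_ _<ᴿ_ _≤ᴿ_

_+ᴿ_ : ℝ → ℝ → ℝ
x +ᴿ y = mkℝ (λ n → seq x n ℚ.+ seq y n) proof
  where
  proof : ∀ ε → 0ℚ ℚ.< ε → ∃ λ N → ∀ m n → N ℕ.≤ m → N ℕ.≤ n →
          ℚ.∣ (seq x m ℚ.+ seq y m) ℚ.- (seq x n ℚ.+ seq y n) ∣ ℚ.< ε
  proof ε ε>0 with cauchy x (½ ℚ.* ε) (½ε>0 ε>0) | cauchy y (½ ℚ.* ε) (½ε>0 ε>0)
  ... | M , hx | N , hy = M ℕ.⊔ N , λ m n ≤m ≤n → begin-strict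
      ℚ.∣ (seq x m ℚ.+ seq y m) ℚ.- (seq x n ℚ.+ seq y n) ∣
        ≡⟨ cong ℚ.∣_∣ ([p+q]-[r+s] (seq x m) (seq y m) (seq x n) (seq y n)) ⟩
      ℚ.∣ (seq x m ℚ.- seq x n) ℚ.+ (seq y m ℚ.- seq y n) ∣
        ≤⟨ ℚₚ.∣p+q∣≤∣p∣+∣q∣ (seq x m ℚ.- seq x n) (seq y m ℚ.- seq y n) ⟩
      ℚ.∣ seq x m ℚ.- seq x n ∣ ℚ.+ ℚ.∣ seq y m ℚ.- seq y n ∣
        <⟨ ℚₚ.+-mono-< (hx m n (ℕₚ.m⊔n≤o⇒m≤o M N ≤m) (ℕₚ.m⊔n≤o⇒m≤o M N ≤n))
                       (hy m n (ℕₚ.m⊔n≤o⇒n≤o M N ≤m) (ℕₚ.m⊔n≤o⇒n≤o M N ≤n)) ⟩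
      ½ ℚ.* ε ℚ.+ ½ ℚ.* ε
        ≡⟨ ½ε+½ε ε ⟩
      ε ∎
    where open ℚₚ.≤-Reasoning

-ᴿ_ : ℝ → ℝ
-ᴿ x = mkℝ (λ n → ℚ.- seq x n) λ ε ε>0 → map₂ (λ h m n ≤m ≤n →
    subst (ℚ._< ε)
      (trans (sym (ℚₚ.∣-p∣≡∣p∣ (seq x m ℚ.- seq x n)))
             (cong ℚ.∣_∣ (ℚₚ.neg-distrib-+ (seq x m) (ℚ.- seq x n))))
      (h m n ≤m ≤n))
    (cauchy x ε ε>0)

_-ᴿ_ : ℝ → ℝ → ℝ
x -ᴿ y = x +ᴿ (-ᴿ y)

_*ᴿ_ : ℝ → ℝ → ℝ
x *ᴿ y = mkℝ (λ n → seq x n ℚ.* seq y n) proof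
  where
  proof : ∀ ε → 0ℚ ℚ.< ε → ∃ λ N → ∀ m n → N ℕ.≤ m → N ℕ.≤ n →
          ℚ.∣ seq x m ℚ.* seq y m ℚ.- seq x n ℚ.* seq y n ∣ ℚ.< ε
  proof ε ε>0 with bounded x | bounded y
  ... | B , B>0 , N₁ , hB | C , C>0 , N₂ , hC = N , bound
    where
    instance
      _ = ℚ.positive B>0
      _ = ℚ.positive C>0
      _ = ℚ.positive ε>0
      _ = ℚₚ.pos+pos⇒pos B C
      _ = ℚₚ.pos⇒nonZero (B ℚ.+ C)
      _ = ℚₚ.1/pos⇒pos (B ℚ.+ C)
    1/K = ℚ.1/ (B ℚ.+ C)
    δ = 1/K ℚ.* ε
    instance _ = ℚₚ.pos*pos⇒pos 1/K ε
    δ>0 : 0ℚ ℚ.< δ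
    δ>0 = ℚₚ.positive⁻¹ δ
    hx = cauchy x δ δ>0
    hy = cauchy y δ δ>0
    N = (N₁ ℕ.⊔ N₂) ℕ.⊔ (proj₁ hx ℕ.⊔ proj₁ hy)
    i₁ : N₁ ℕ.≤ N
    i₁ = ℕₚ.≤-trans (ℕₚ.m≤m⊔n _ _) (ℕₚ.m≤m⊔n _ _)
    i₂ : N₂ ℕ.≤ N
    i₂ = ℕₚ.≤-trans (ℕₚ.m≤n⊔m N₁ N₂) (ℕₚ.m≤m⊔n _ _)
    i₃ : proj₁ hx ℕ.≤ N
    i₃ = ℕₚ.≤-trans (ℕₚ.m≤m⊔n _ _) (ℕₚ.m≤n⊔m (N₁ ℕ.⊔ N₂) _)
    i₄ : proj₁ hy ℕ.≤ N
    i₄ = ℕₚ.≤-trans (ℕₚ.m≤n⊔m (proj₁ hx) _) (ℕₚ.m≤n⊔m (N₁ ℕ.⊔ N₂) _)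

    product< : ∀ {E} → 0ℚ ℚ.< E → ∀ p q → ℚ.∣ p ∣ ℚ.< E → ℚ.∣ q ∣ ℚ.< δ →
               ℚ.∣ p ℚ.* q ∣ ℚ.< E ℚ.* δ
    product< {E} E>0 p q hp hq = begin-strict
        ℚ.∣ p ℚ.* q ∣          ≡⟨ ℚₚ.∣p*q∣≡∣p∣*∣q∣ p q ⟩
        ℚ.∣ p ∣ ℚ.* ℚ.∣ q ∣    ≤⟨ ℚₚ.*-monoʳ-≤-nonNeg ℚ.∣ q ∣ (ℚₚ.<⇒≤ hp) ⟩
        E ℚ.* ℚ.∣ q ∣          <⟨ ℚₚ.*-monoʳ-<-pos E hq ⟩
        E ℚ.* δ                ∎
      where
      open ℚₚ.≤-Reasoning
      instance
        _ = ℚ.positive E>0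
        _ = ℚₚ.∣-∣-nonNeg q

    total : B ℚ.* δ ℚ.+ C ℚ.* δ ≡ ε
    total = trans (sym (ℚₚ.*-distribʳ-+ δ B C))
           (trans (sym (ℚₚ.*-assoc (B ℚ.+ C) 1/K ε))
           (trans (cong (ℚ._* ε) (ℚₚ.*-inverseʳ (B ℚ.+ C)))
                  (ℚₚ.*-identityˡ ε)))

    bound : ∀ m n → N ℕ.≤ m → N ℕ.≤ n →
            ℚ.∣ seq x m ℚ.* seq y m ℚ.- seq x n ℚ.* seq y n ∣ ℚ.< ε
    bound m n ≤m ≤n = begin-strict
        ℚ.∣ seq x m ℚ.* seq y m ℚ.- seq x n ℚ.* seq y n ∣
          ≡⟨ cong ℚ.∣_∣ (pq-rs (seq x m) (seq y m) (seq x n) (seq y n)) ⟩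
        ℚ.∣ p ℚ.+ q ∣
          ≤⟨ ℚₚ.∣p+q∣≤∣p∣+∣q∣ p q ⟩
        ℚ.∣ p ∣ ℚ.+ ℚ.∣ q ∣
          <⟨ ℚₚ.+-mono-<
               (product< B>0 (seq x m) (seq y m ℚ.- seq y n)
                 (hB m (ℕₚ.≤-trans i₁ ≤m))
                 (proj₂ hy m n (ℕₚ.≤-trans i₄ ≤m) (ℕₚ.≤-trans i₄ ≤n)))
               (product< C>0 (seq y n) (seq x m ℚ.- seq x n)
                 (hC n (ℕₚ.≤-trans i₂ ≤n))
                 (proj₂ hx m n (ℕₚ.≤-trans i₃ ≤m) (ℕₚ.≤-trans i₃ ≤n))) ⟩
        B ℚ.* δ ℚ.+ C ℚ.* δ
          ≡⟨ total ⟩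
        ε ∎
      where
      open ℚₚ.≤-Reasoning
      p = seq x m ℚ.* (seq y m ℚ.- seq y n)
      q = seq y n ℚ.* (seq x m ℚ.- seq x n)

_≈ᴿ_ : ℝ → ℝ → Set
x ≈ᴿ y = ∀ ε → 0ℚ ℚ.< ε → ∃ λ N → ∀ n → N ℕ.≤ n → ℚ.∣ seq x n ℚ.- seq y n ∣ ℚ.< ε

_<ᴿ_ : ℝ → ℝ → Set
x <ᴿ y = ∃ λ ε → 0ℚ ℚ.< ε × ∃ λ N → ∀ n → N ℕ.≤ n → seq x n ℚ.+ ε ℚ.< seq y n

_≤ᴿ_ : ℝ → ℝ → Set
x ≤ᴿ y = ∀ ε → 0ℚ ℚ.< ε → ∃ λ N → ∀ n → N ℕ.≤ n → seq x n ℚ.< seq y n ℚ.+ ε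

sumᴿ : List ℝ → ℝ
sumᴿ = foldr _+ᴿ_ 0ᴿ

-- HasSum f x: the family f has finite support, and the sum of f over its
-- whole (possibly infinite) index type is x.
record HasSum {A : Set} (f : A → ℝ) (x : ℝ) : Set where
  field
    support : List A
    unique  : Unique support
    outside : ∀ a → ¬ (a Mem.∈ support) → f a ≈ᴿ 0ᴿ
    total   : sumᴿ (map f support) ≈ᴿ x

-- Finite subsets of ℤ, represented by their increasing enumeration.  As the
-- proof of monotonicity is irrelevant, _≡_ on FinSet is equality of sets.
record FinSet : Set where
  constructor finSet
  field
    elements    : List ℤ
    .increasing : AllPairs _<_ elements

open FinSet public using (elements)

infix 4 _∈_ _∉_

_∈_ _∉_ : ℤ → FinSet → Set
a ∈ S = a Mem.∈ elements S
a ∉ S = ¬ (a ∈ S)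

card : FinSet → ℕ
card S = length (elements S)

_≟ˢ_ : (S T : FinSet) → Dec (S ≡ T)
finSet xs _ ≟ˢ finSet ys _ = map′ (λ { refl → refl }) (cong elements) (Listₚ.≡-dec ℤ._≟_ xs ys)

∅ : FinSet
∅ = finSet [] []

insertᴸ : ℤ → List ℤ → List ℤ
insertᴸ a []       = a ∷ []
insertᴸ a (x ∷ xs) with ℤₚ.<-cmp a x
... | tri< _ _ _ = a ∷ x ∷ xs
... | tri≈ _ _ _ = x ∷ xs
... | tri> _ _ _ = x ∷ insertᴸ a xs

insertᴸ-All : ∀ {Q : ℤ → Set} {a xs} → Q a → All Q xs → All Q (insertᴸ a xs)
insertᴸ-All qa [] = qa ∷ []
insertᴸ-All {a = a} {x ∷ xs} qa (qx ∷ qxs) with ℤₚ.<-cmp a x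
... | tri< _ _ _ = qa ∷ qx ∷ qxs
... | tri≈ _ _ _ = qx ∷ qxs
... | tri> _ _ _ = qx ∷ insertᴸ-All qa qxs

insertᴸ-increasing : ∀ a {xs} → AllPairs _<_ xs → AllPairs _<_ (insertᴸ a xs)
insertᴸ-increasing a [] = [] ∷ []
insertᴸ-increasing a {x ∷ xs} (x< ∷ inc) with ℤₚ.<-cmp a x
... | tri< a<x _ _ = (a<x ∷ All.map (ℤₚ.<-trans a<x) x<) ∷ x< ∷ inc
... | tri≈ _ _ _   = x< ∷ inc
... | tri> _ _ x<a = insertᴸ-All x<a x< ∷ insertᴸ-increasing a inc

insertᴸ-new : ∀ a xs → a Mem.∈ insertᴸ a xs
insertᴸ-new a [] = here refl
insertᴸ-new a (x ∷ xs) with ℤₚ.<-cmp a x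
... | tri< _ _ _    = here refl
... | tri≈ _ refl _ = here refl
... | tri> _ _ _    = there (insertᴸ-new a xs)

insertᴸ-old : ∀ a {b xs} → b Mem.∈ xs → b Mem.∈ insertᴸ a xs
insertᴸ-old a {b} {x ∷ xs} b∈ with ℤₚ.<-cmp a x
... | tri< _ _ _ = there b∈
... | tri≈ _ _ _ = b∈
insertᴸ-old a {b} {x ∷ xs} (here e)   | tri> _ _ _ = here e
insertᴸ-old a {b} {x ∷ xs} (there b∈) | tri> _ _ _ = there (insertᴸ-old a b∈)

insertᴸ-length : ∀ a xs → ¬ (a Mem.∈ xs) → length (insertᴸ a xs) ≡ suc (length xs)
insertᴸ-length a [] _ = refl
insertᴸ-length a (x ∷ xs) a∉ with ℤₚ.<-cmp a x
... | tri< _ _ _   = refl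
... | tri≈ _ a≡x _ = ⊥-elim (a∉ (here a≡x))
... | tri> _ _ _   = cong suc (insertᴸ-length a xs (a∉ ∘ there))

insert : ℤ → FinSet → FinSet
insert a (finSet xs inc) = finSet (insertᴸ a xs) (insertᴸ-increasing a inc)

consecutive : ℤ → ℕ → List ℤ
consecutive s zero    = []
consecutive s (suc n) = s ∷ consecutive (sucℤ s) n

i<suc : ∀ i → i < sucℤ i
i<suc i = ℤₚ.suc[i]≤j⇒i<j ℤₚ.≤-refl

consecutive-≥ : ∀ s n → All (s ≤_) (consecutive s n)
consecutive-≥ s zero    = []
consecutive-≥ s (suc n) =
  ℤₚ.≤-refl ∷ All.map (ℤₚ.≤-trans (ℤₚ.i≤suc[i] s)) (consecutive-≥ (sucℤ s) n)

consecutive-increasing : ∀ s n → AllPairs _<_ (consecutive s n)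
consecutive-increasing s zero    = []
consecutive-increasing s (suc n) =
  All.map (ℤₚ.<-≤-trans (i<suc s)) (consecutive-≥ (sucℤ s) n) ∷ consecutive-increasing (sucℤ s) n

-- {s, s+1, …, t}; empty when t < s.
interval : ℤ → ℤ → FinSet
interval s t with sucℤ t ℤ.- s
... | + n      = finSet (consecutive s n) (consecutive-increasing s n)
... | -[1+ _ ] = ∅

Within : ℤ → ℤ → FinSet → Set
Within s t S = ∀ x → s ≤ x → x ≤ t → x ∈ S

record IsBlock (S : FinSet) (s t : ℤ) : Set where
  field
    nonempty : s ≤ t
    within   : Within s t S
    maximal  : ∀ s′ t′ → s′ ≤ s → t ≤ t′ → Within s′ t′ S → s′ ≡ s × t′ ≡ t

record IsBlockOf (S : FinSet) (a s t : ℤ) : Set where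
  field
    isBlock : IsBlock S s t
    lower   : s ≤ a
    upper   : a ≤ t
  open IsBlock isBlock public

  member : a ∈ S
  member = within a lower upper

  suc-t∉ : sucℤ t ∉ S
  suc-t∉ t+1∈ = ℤₚ.i≢suc[i] (sym (proj₂ (maximal s (sucℤ t) ℤₚ.≤-refl (ℤₚ.i≤suc[i] t) larger)))
    where
    larger : Within s (sucℤ t) S
    larger x s≤x x≤ with x ℤ.≟ sucℤ t
    ... | yes refl = t+1∈
    ... | no x≢    = within x s≤x
      (subst (x ≤_) (ℤₚ.pred-suc t) (ℤₚ.i<j⇒i≤pred[j] (ℤₚ.≤∧≢⇒< x≤ x≢)))

  pred-s∉ : pred s ∉ S
  pred-s∉ s-1∈ = ℤₚ.<⇒≢ (ℤₚ.i≤pred[j]⇒i<j ℤₚ.≤-refl)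
                   (proj₁ (maximal (pred s) t (ℤₚ.<⇒≤ (ℤₚ.i≤pred[j]⇒i<j ℤₚ.≤-refl)) ℤₚ.≤-refl larger))
    where
    larger : Within (pred s) t S
    larger x ≤x x≤t with x ℤ.≟ pred s
    ... | yes refl = s-1∈
    ... | no x≢    = within x
      (subst (_≤ x) (ℤₚ.suc-pred s) (ℤₚ.i<j⇒suc[i]≤j (ℤₚ.≤∧≢⇒< ≤x (x≢ ∘ sym)))) x≤t

block-unique : ∀ {S a s t s′ t′} → IsBlockOf S a s t → IsBlockOf S a s′ t′ → s ≡ s′ × t ≡ t′
block-unique {S} {a} {s} {t} {s′} {t′} b b′ = s≡ , t≡
  where
  module B = IsBlockOf b
  module B′ = IsBlockOf b′
  below : ∀ {u v w u′} → u′ < u → Within u′ w S → u ≤ v → v ≤ w → pred u ∈ S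
  below u′<u h u≤v v≤w = h _ (ℤₚ.i<j⇒i≤pred[j] u′<u)
    (ℤₚ.≤-trans (ℤₚ.<⇒≤ (ℤₚ.i≤pred[j]⇒i<j ℤₚ.≤-refl)) (ℤₚ.≤-trans u≤v v≤w))
  above : ∀ {u v w u′} → u < u′ → Within w u′ S → w ≤ v → v ≤ u → sucℤ u ∈ S
  above u<u′ h w≤v v≤u = h _ (ℤₚ.≤-trans w≤v (ℤₚ.≤-trans v≤u (ℤₚ.i≤suc[i] _))) (ℤₚ.i<j⇒suc[i]≤j u<u′)
  s≡ : s ≡ s′
  s≡ with ℤₚ.<-cmp s s′
  ... | tri< s<s′ _ _ = ⊥-elim (B′.pred-s∉ (below s<s′ B.within B′.lower B.upper))
  ... | tri≈ _ e _    = e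
  ... | tri> _ _ s′<s = ⊥-elim (B.pred-s∉ (below s′<s B′.within B.lower B′.upper))
  t≡ : t ≡ t′
  t≡ with ℤₚ.<-cmp t t′
  ... | tri< t<t′ _ _ = ⊥-elim (B.suc-t∉ (above t<t′ B′.within B′.lower B.upper))
  ... | tri≈ _ e _    = e
  ... | tri> _ _ t′<t = ⊥-elim (B′.suc-t∉ (above t′<t B.within B.lower B′.upper))

searchUp : ∀ S n a → a ∈ S → a ℤ.+ + n ∉ S →
           ∃ λ t → a ≤ t × Within a t S × sucℤ t ∉ S
searchUp S zero a a∈ ∉ = ⊥-elim (∉ (subst (_∈ S) (sym (ℤₚ.+-identityʳ a)) a∈))
searchUp S (suc n) a a∈ ∉ with sucℤ a ∈? elements S
... | no a+1∉  = a , ℤₚ.≤-refl , (λ x ≤x x≤ → subst (_∈ S) (ℤₚ.≤-antisym ≤x x≤) a∈) , a+1∉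
... | yes a+1∈ with searchUp S n (sucℤ a) a+1∈
                     (∉ ∘ subst (_∈ S) (trans (cong (ℤ._+ + n) (ℤₚ.+-comm (+ 1) a))
                                              (ℤₚ.+-assoc a (+ 1) (+ n))))
...   | t , ≤t , h , t+1∉ = t , ℤₚ.≤-trans (ℤₚ.i≤suc[i] a) ≤t , h′ , t+1∉
  where
  h′ : Within a t S
  h′ x a≤x x≤t with a ℤ.≟ x
  ... | yes refl = a∈
  ... | no a≢x   = h x (ℤₚ.i<j⇒suc[i]≤j (ℤₚ.≤∧≢⇒< a≤x a≢x)) x≤t

searchDown : ∀ S n a → a ∈ S → a ℤ.- + n ∉ S →
             ∃ λ s → s ≤ a × Within s a S × pred s ∉ S
searchDown S zero a a∈ ∉ = ⊥-elim (∉ (subst (_∈ S) (sym (ℤₚ.+-identityʳ a)) a∈))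
searchDown S (suc n) a a∈ ∉ with pred a ∈? elements S
... | no a-1∉  = a , ℤₚ.≤-refl , (λ x ≤x x≤ → subst (_∈ S) (ℤₚ.≤-antisym ≤x x≤) a∈) , a-1∉
... | yes a-1∈ with searchDown S n (pred a) a-1∈ (∉ ∘ subst (_∈ S) eq)
  where
  eq : pred a ℤ.- + n ≡ a ℤ.- + suc n
  eq = trans (cong (ℤ._- + n) (ℤₚ.+-comm -[1+ 0 ] a))
      (trans (ℤₚ.+-assoc a -[1+ 0 ] (ℤ.- + n))
             (cong (λ z → a ℤ.+ z) (sym (ℤₚ.neg-distrib-+ (+ 1) (+ n)))))
...   | s , s≤ , h , s-1∉ = s , ℤₚ.≤-trans s≤ (ℤₚ.<⇒≤ (ℤₚ.i≤pred[j]⇒i<j ℤₚ.≤-refl)) , h′ , s-1∉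
  where
  h′ : Within s a S
  h′ x s≤x x≤a with x ℤ.≟ a
  ... | yes refl = a∈
  ... | no x≢a   = h x s≤x (ℤₚ.i<j⇒i≤pred[j] (ℤₚ.≤∧≢⇒< x≤a x≢a))

radius : List ℤ → ℕ
radius []       = 0
radius (x ∷ xs) = ℤ.∣ x ∣ ℕ.+ radius xs

∈⇒≤radius : ∀ {x xs} → x Mem.∈ xs → ℤ.∣ x ∣ ℕ.≤ radius xs
∈⇒≤radius (here refl)           = ℕₚ.m≤m+n _ _
∈⇒≤radius {xs = y ∷ _} (there i) = ℕₚ.≤-trans (∈⇒≤radius i) (ℕₚ.m≤n+m _ ℤ.∣ y ∣)

far : FinSet → ℤ → ℕ
far S a = suc (ℤ.∣ a ∣ ℕ.+ radius (elements S))

far-up : ∀ S a → a ℤ.+ + far S a ∉ S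
far-up S a i = ℕₚ.<-irrefl refl (ℕₚ.<-≤-trans lt (ℕₚ.+-monoʳ-≤ ℤ.∣ a ∣ (∈⇒≤radius i)))
  where
  z = a ℤ.+ + far S a
  lt : ℤ.∣ a ∣ ℕ.+ radius (elements S) ℕ.< ℤ.∣ a ∣ ℕ.+ ℤ.∣ z ∣
  lt = subst₂ (λ y n → ℤ.∣ y ∣ ℕ.≤ n)
         (trans (cong (ℤ._- a) (ℤₚ.+-comm a (+ far S a)))
         (trans (ℤₚ.+-assoc (+ far S a) a (ℤ.- a))
         (trans (cong (λ y → + far S a ℤ.+ y) (ℤₚ.+-inverseʳ a)) (ℤₚ.+-identityʳ (+ far S a)))))
         (ℕₚ.+-comm ℤ.∣ z ∣ ℤ.∣ a ∣)
         (ℤₚ.∣i-j∣≤∣i∣+∣j∣ z a)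

far-down : ∀ S a → a ℤ.- + far S a ∉ S
far-down S a i = ℕₚ.<-irrefl refl (ℕₚ.<-≤-trans lt (ℕₚ.+-monoʳ-≤ ℤ.∣ a ∣ (∈⇒≤radius i)))
  where
  z = a ℤ.- + far S a
  lt : ℤ.∣ a ∣ ℕ.+ radius (elements S) ℕ.< ℤ.∣ a ∣ ℕ.+ ℤ.∣ z ∣
  lt = subst (λ y → ℤ.∣ y ∣ ℕ.≤ ℤ.∣ a ∣ ℕ.+ ℤ.∣ z ∣)
         (trans (cong (λ y → a ℤ.+ y) (ℤₚ.neg-distrib-+ a (ℤ.- + far S a)))
         (trans (sym (ℤₚ.+-assoc a (ℤ.- a) _))
         (trans (cong (ℤ._+ (ℤ.- (ℤ.- + far S a))) (ℤₚ.+-inverseʳ a))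
         (trans (ℤₚ.+-identityˡ _) (ℤₚ.neg-involutive (+ far S a))))))
         (ℤₚ.∣i-j∣≤∣i∣+∣j∣ a z)

blockOf : ∀ S a → a ∈ S → ∃ λ s → ∃ λ t → IsBlockOf S a s t
blockOf S a a∈ with searchDown S (far S a) a a∈ (far-down S a) | searchUp S (far S a) a a∈ (far-up S a)
... | s , s≤a , low , s-1∉ | t , a≤t , high , t+1∉ = s , t , record
  { isBlock = record
    { nonempty = ℤₚ.≤-trans s≤a a≤t
    ; within   = within
    ; maximal  = λ s′ t′ s′≤s t≤t′ h → left-end s′≤s t≤t′ h , right-end s′≤s t≤t′ h
    }
  ; lower = s≤a
  ; upper = a≤t
  }
  where
  within : Within s t S
  within x s≤x x≤t with ℤₚ.≤-total x a
  ... | inj₁ x≤a = low x s≤x x≤a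
  ... | inj₂ a≤x = high x a≤x x≤t
  left-end : ∀ {s′ t′} → s′ ≤ s → t ≤ t′ → Within s′ t′ S → s′ ≡ s
  left-end {s′} {t′} s′≤s t≤t′ h with s′ ℤ.≟ s
  ... | yes e = e
  ... | no ≢  = ⊥-elim (s-1∉ (h (pred s) (ℤₚ.i<j⇒i≤pred[j] (ℤₚ.≤∧≢⇒< s′≤s ≢))
                  (ℤₚ.≤-trans (ℤₚ.<⇒≤ (ℤₚ.i≤pred[j]⇒i<j ℤₚ.≤-refl))
                    (ℤₚ.≤-trans s≤a (ℤₚ.≤-trans a≤t t≤t′)))))
  right-end : ∀ {s′ t′} → s′ ≤ s → t ≤ t′ → Within s′ t′ S → t′ ≡ t
  right-end {s′} {t′} s′≤s t≤t′ h with t ℤ.≟ t′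
  ... | yes e = sym e
  ... | no ≢  = ⊥-elim (t+1∉ (h (sucℤ t)
                  (ℤₚ.≤-trans s′≤s (ℤₚ.≤-trans s≤a (ℤₚ.≤-trans a≤t (ℤₚ.i≤suc[i] t))))
                  (ℤₚ.i<j⇒suc[i]≤j (ℤₚ.≤∧≢⇒< t≤t′ ≢))))

Word : Set
Word = List ℤ

IsVertex : Word → FinSet → Set
IsVertex W S = length W ≡ card S × All (_∈ S) W

isVertex? : ∀ W S → Dec (IsVertex W S)
isVertex? W S = (length W ℕ.≟ card S) ×-dec All.all? (_∈? elements S) W

record Vertex : Set where
  constructor vertex
  field
    word   : Word
    set    : FinSet
    .valid : IsVertex word set

open Vertex public using (word; set)

_≟ᵛ_ : (v w : Vertex) → Dec (v ≡ w)
vertex W S _ ≟ᵛ vertex W′ S′ _ =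
  map′ (λ { (refl , refl) → refl }) (λ { refl → refl , refl })
    (Listₚ.≡-dec ℤ._≟_ W W′ ×-dec S ≟ˢ S′)

origin : Vertex
origin = vertex [] ∅ (refl , [])

-- (W , S) ↦ (W a , S ⊔ {b})
park : (v : Vertex) (a b : ℤ) → .(b ∉ set v) → .(a ∈ insert b (set v)) → Vertex
park (vertex W S p) a b b∉ a∈ = vertex (W ∷ʳ a) (insert b S) (valid′ p b∉ a∈)
  where
  valid′ : IsVertex W S → b ∉ S → a ∈ insert b S → IsVertex (W ∷ʳ a) (insert b S)
  valid′ (size , inside) b∉ a∈ =
    trans (Listₚ.length-++ W) (trans (ℕₚ.+-comm (length W) 1) (trans (cong suc size) (sym (insertᴸ-length b (elements S) b∉)))) ,
    Allₚ.∷ʳ⁺ (All.map (insertᴸ-old b) inside) a∈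

data Edge (v : Vertex) : Vertex → Set where
  free  : ∀ a .(a∉ : a ∉ set v) →
          Edge v (park v a a a∉ (insertᴸ-new a (elements (set v))))
  right : ∀ a s t .(b : IsBlockOf (set v) a s t) →
          Edge v (park v a (sucℤ t) (IsBlockOf.suc-t∉ b) (insertᴸ-old (sucℤ t) (IsBlockOf.member b)))
  left  : ∀ a s t .(b : IsBlockOf (set v) a s t) →
          Edge v (park v a (pred s) (IsBlockOf.pred-s∉ b) (insertᴸ-old (pred s) (IsBlockOf.member b)))

Path : Vertex → Vertex → Set
Path = Star Edge

record ParkingProcedure : Set where
  field
    Dir   : (v : Vertex) (a : ℤ) → .(a ∈ set v) → ℝ
    Dir≥0 : ∀ v a .(a∈ : a ∈ set v) → 0ᴿ ≤ᴿ Dir v a a∈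
    Dir≤1 : ∀ v a .(a∈ : a ∈ set v) → Dir v a a∈ ≤ᴿ 1ᴿ

open ParkingProcedure public

turns : ∀ v a → (∃ λ s → ∃ λ t → IsBlockOf (set v) a s t) → List (∃ (Edge v))
turns v a (s , t , b) = (_ , right a s t b) ∷ (_ , left a s t b) ∷ []

-- The edges out of v that read the letter a.
edges : (v : Vertex) → ℤ → List (∃ (Edge v))
edges v a with a ∈? elements (set v)
... | no a∉  = (_ , free a a∉) ∷ []
... | yes a∈ = turns v a (blockOf (set v) a a∈)

-- The paths from v to w that read the word U.
paths : (v : Vertex) → Word → (w : Vertex) → List (Path v w)
paths v [] w with v ≟ᵛ w
... | yes refl = stay ∷ []
... | no _     = []
paths v (a ∷ U) w = concatMap (λ (v′ , e) → map (e ◅_) (paths v′ U w)) (edges v a)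

module _ (P : ParkingProcedure) where

  edgeWeight : ∀ {v w} → Edge v w → ℝ
  edgeWeight     (free _ _)      = 1ᴿ
  edgeWeight {v} (right a _ _ b) = Dir P v a (IsBlockOf.member b)
  edgeWeight {v} (left a _ _ b)  = 1ᴿ -ᴿ Dir P v a (IsBlockOf.member b)

  pathWeight : ∀ {v w} → Path v w → ℝ
  pathWeight stay     = 1ᴿ
  pathWeight (e ◅ p) = edgeWeight e *ᴿ pathWeight p

  -- 𝒫_W(S).  By paths-complete and paths-unique below, the list summed over
  -- contains every path from (ε, ∅) to (W, S) exactly once.
  𝒫 : Word → FinSet → ℝ
  𝒫 W S with isVertex? W S
  ... | yes p = sumᴿ (map pathWeight (paths origin W (vertex W S p)))
  ... | no _  = 0ᴿ

  Park : Word → ℝ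
  Park W = 𝒫 W (interval (+ 1) (+ length W))

letter : ∀ {v w} → Edge v w → ℤ
letter (free a _)      = a
letter (right a _ _ _) = a
letter (left a _ _ _)  = a

letters : ∀ {v w} → Path v w → Word
letters stay     = []
letters (e ◅ p) = letter e ∷ letters p

edge-word : ∀ {v w} (e : Edge v w) → word w ≡ word v ∷ʳ letter e
edge-word (free _ _)      = refl
edge-word (right _ _ _ _) = refl
edge-word (left _ _ _ _)  = refl

path-word : ∀ {v w} (p : Path v w) → word w ≡ word v ++ letters p
path-word {v} stay = sym (Listₚ.++-identityʳ (word v))
path-word {v} (e ◅ p) = trans (path-word p)
  (trans (cong (_++ letters p) (edge-word e)) (Listₚ.∷ʳ-++ (word v) (letter e) (letters p)))

right∈turns : ∀ v a s t .(b : IsBlockOf (set v) a s t) c → (_ , right a s t b) Mem.∈ turns v a c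
right∈turns v a s t b (s′ , t′ , b′)
  with recompute (s ℤ.≟ s′) (proj₁ (block-unique b b′)) | recompute (t ℤ.≟ t′) (proj₂ (block-unique b b′))
... | refl | refl = here refl

left∈turns : ∀ v a s t .(b : IsBlockOf (set v) a s t) c → (_ , left a s t b) Mem.∈ turns v a c
left∈turns v a s t b (s′ , t′ , b′)
  with recompute (s ℤ.≟ s′) (proj₁ (block-unique b b′)) | recompute (t ℤ.≟ t′) (proj₂ (block-unique b b′))
... | refl | refl = there (here refl)

edges-complete : ∀ {v w} (e : Edge v w) → (w , e) Mem.∈ edges v (letter e)
edges-complete {v} (free a a∉) with a ∈? elements (set v)
... | no _   = here refl
... | yes a∈ = ⊥-elim-irr (a∉ a∈)
edges-complete {v} (right a s t b) with a ∈? elements (set v)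
... | no a∉  = ⊥-elim-irr (a∉ (IsBlockOf.member b))
... | yes a∈ = right∈turns v a s t b (blockOf (set v) a a∈)
edges-complete {v} (left a s t b) with a ∈? elements (set v)
... | no a∉  = ⊥-elim-irr (a∉ (IsBlockOf.member b))
... | yes a∈ = left∈turns v a s t b (blockOf (set v) a a∈)

isRight : ∀ {v} → ∃ (Edge v) → Bool
isRight (_ , right _ _ _ _) = true
isRight (_ , free _ _)      = false
isRight (_ , left _ _ _ _)  = false

edges-unique : ∀ v a → Unique (edges v a)
edges-unique v a with a ∈? elements (set v)
... | no _   = [] ∷ []
... | yes a∈ = ((λ eq → true≢false (cong isRight eq)) ∷ []) ∷ [] ∷ []
  where
  true≢false : true ≢ false
  true≢false ()

paths-complete′ : ∀ {v w} (p : Path v w) → p Mem.∈ paths v (letters p) w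
paths-complete′ {v} stay with v ≟ᵛ v
... | yes refl = here refl
... | no v≢v   = ⊥-elim (v≢v refl)
paths-complete′ (e ◅ p) =
  Memₚ.∈-concatMap⁺ _ (Mem.lose (edges-complete e) (Memₚ.∈-map⁺ (e ◅_) (paths-complete′ p)))

first : ∀ {v w} → Path v w → Maybe (∃ (Edge v))
first stay     = nothing
first (e ◅ _) = just (_ , e)

◅-injective : ∀ {u v w} {e : Edge u v} {p q : Path v w} → _≡_ {A = Path u w} (e ◅ p) (e ◅ q) → p ≡ q
◅-injective refl = refl

just-injective : ∀ {A : Set} {x y : A} → just x ≡ just y → x ≡ y
just-injective refl = refl

first-map : ∀ {u v w} (e : Edge u v) {ps : List (Path v w)} {q} →
            q Mem.∈ map (e ◅_) ps → first q ≡ just (v , e)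
first-map e i with Memₚ.∈-map⁻ (e ◅_) i
... | _ , _ , refl = refl

paths-complete : ∀ {w} (p : Path origin w) → p Mem.∈ paths origin (word w) w
paths-complete {w} p = subst (λ U → p Mem.∈ paths origin U w) (sym (path-word p)) (paths-complete′ p)

paths-unique : ∀ v U w → Unique (paths v U w)
paths-unique v [] w with v ≟ᵛ w
... | yes refl = [] ∷ []
... | no _     = []
paths-unique v (a ∷ U) w = go (edges v a) (edges-unique v a)
  where
  extend : ∃ (Edge v) → List (Path v w)
  extend (v′ , e) = map (e ◅_) (paths v′ U w)

  fresh : ∀ {x xs q} → All (x ≢_) xs → q Mem.∈ extend x → ¬ (q Mem.∈ concatMap extend xs)
  fresh {x} {y ∷ ys} (x≢y ∷ x≢) i j with Memₚ.∈-++⁻ (extend y) j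
  ... | inj₁ k = x≢y (just-injective (trans (sym (first-map (proj₂ x) i)) (first-map (proj₂ y) k)))
  ... | inj₂ k = fresh x≢ i k

  go : ∀ xs → Unique xs → Unique (concatMap extend xs)
  go []             _         = []
  go ((v′ , e) ∷ xs) (x≢ ∷ u) =
    Uniqueₚ.++⁺ (Uniqueₚ.map⁺ ◅-injective (paths-unique v′ U w)) (go xs u)
      (λ (i , j) → fresh x≢ i j)

τˢ : FinSet → FinSet
τˢ (finSet xs inc) =
  finSet (map sucℤ xs) (AllPairsₚ.map⁺ (AllPairs.map (ℤₚ.+-monoʳ-< (+ 1)) inc))

τᵛ : Vertex → Vertex
τᵛ (vertex W S p) = vertex (map sucℤ W) (τˢ S) (valid′ p)
  where
  valid′ : IsVertex W S → IsVertex (map sucℤ W) (τˢ S)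
  valid′ (size , inside) =
    trans (Listₚ.length-map sucℤ W) (trans size (sym (Listₚ.length-map sucℤ (elements S)))) ,
    Allₚ.map⁺ (All.map (Memₚ.∈-map⁺ sucℤ) inside)

-- W|I.  A car parks at its preferred spot or next to the block containing it, so
-- the cars that parked in a block I of S are those whose letter lies in I.
restrict : Word → FinSet → Word
restrict W I = filter (_∈? elements I) W

ShiftInvariant : ParkingProcedure → Set
ShiftInvariant P = ∀ v a .(a∈ : a ∈ set v) →
  Dir P (τᵛ v) (sucℤ a) (Memₚ.∈-map⁺ sucℤ a∈) ≈ᴿ Dir P v a a∈

-- When 𝒫_W(S) > 0, the pair (W|I, I) is always a vertex, with a ∈ I; the
-- hypotheses to that effect only serve to make the right-hand side well typed.
LocallyDecided : ParkingProcedure → Set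
LocallyDecided P = ∀ v a s t .(b : IsBlockOf (set v) a s t) →
  0ᴿ <ᴿ 𝒫 P (word v) (set v) →
  let I = interval s t in
  .(p : IsVertex (restrict (word v) I) I) .(a∈I : a ∈ I) →
  Dir P v a (IsBlockOf.member b) ≈ᴿ Dir P (vertex (restrict (word v) I) I p) a a∈I

record Local (P : ParkingProcedure) : Set where
  field
    shiftInvariant : ShiftInvariant P
    locallyDecided : LocallyDecided P

{-# OPTIONS --safe #-}
module Submission where

-- Let A(n) be the sum for words of length n.  Look at the last car of a word parking on
-- {1, …, n+1} and at the spot k+1 that it takes.  The other n cars have parked on
-- {1, …, k} ∪ {k+2, …, n+1}; for a local procedure the probability of this is the product of the
-- probabilities for the two subwords, so that summing over words yields a binomial convolution.
-- The last car prefers the spot k+1, or a spot of the left block and goes right, or a spot of the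
-- right block and goes left.  Shift invariance allows the two blocks to be exchanged in the last
-- case; then the probabilities of going right and left from a given spot of a block of size k add
-- up to 1, whatever Dir is, whence A(n+1) = Σₖ C(n,k) (k+1) A(k) A(n-k).  By Abel's binomial
-- identity, (n+1)ⁿ⁻¹ solves this recurrence.
--
-- Local decision only applies where 𝒫_W(S) > 0, which is not decidable.  But equality of real
-- numbers is stable under double negation, so it can be proved by cases on 𝒫_W(S) ≈ 0.

open import Algebra.Bundles using (CommutativeRing; CommutativeSemiring)
import Algebra.Properties.CommutativeSemigroup as CommutativeSemigroupProperties
import Algebra.Properties.Ring as RingProperties
open import Algebra.Structures using (IsCommutativeRing)
open import Data.Bool using (Bool; true; false; not; if_then_else_)
open import Data.Bool.Properties as Boolₚ using (not-¬; ¬-not; not-involutive)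
open import Data.Empty using (⊥-elim; ⊥-elim-irr)
open import Data.Integer as ℤ using (ℤ) renaming (suc to sucℤ)
import Data.Integer.Properties as ℤₚ
open import Data.List
  using (List; []; _∷_; _∷ʳ_; _++_; map; foldr; length; filter; concatMap; upTo; applyUpTo;
         cartesianProductWith)
open import Data.List.Membership.DecPropositional ℤ._≟_ using (_∈?_)
import Data.List.Membership.Propositional as Mem
import Data.List.Membership.Propositional.Properties as Memₚ
import Data.List.Properties as Listₚ
open import Data.List.Relation.Unary.All as All using (All; []; _∷_)
import Data.List.Relation.Unary.All.Properties as Allₚ
open import Data.List.Relation.Unary.AllPairs as AllPairs using (AllPairs; []; _∷_)
import Data.List.Relation.Unary.AllPairs.Properties as AllPairsₚ
open import Data.List.Relation.Unary.Any using (here; there)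
open import Data.List.Relation.Unary.Unique.Propositional using (Unique)
import Data.List.Relation.Unary.Unique.Propositional.Properties as Uniqueₚ
open import Data.List.Reverse using (Reverse; []; _∶_∶ʳ_; reverseView)
open import Data.Nat as ℕ using (ℕ; zero; suc)
import Data.Nat.Coprimality as Coprimality
import Data.Nat.Properties as ℕₚ
open import Data.Product using (∃; _×_; _,_; proj₁; proj₂; swap)
open import Data.Rational as ℚ using (ℚ; 0ℚ; 1ℚ; ½)
import Data.Rational.Properties as ℚₚ
open import Data.Sum using (_⊎_; inj₁; inj₂)
open import Data.Vec using (Vec; toList; initLast) renaming ([] to []ᵥ; _∷ʳ_ to _∷ʳᵥ_)
import Data.Vec.Properties as Vecₚ
open import Function using (_∘_; case_of_)
open import Level using (0ℓ)
open import Relation.Binary.Construct.Closure.ReflexiveTransitive using (_◅_)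
open import Relation.Binary.PropositionalEquality as ≡ using (_≡_; _≢_; module ≡-Reasoning)
import Relation.Binary.Reasoning.Setoid as SetoidReasoning
open import Relation.Nullary using (¬_; Dec; yes; no; does; recompute)
open import Relation.Nullary.Decidable using (¬?; dec-true; dec-false; decidable-stable)

-- The product formula for the probabilities is the delicate point. Locality constrains only `Dir`,
-- only at pairs (W, S) of positive probability, and only by comparison with (W|I, I), which must be
-- known to be a vertex. That it is a vertex, and that the parts of (W, S) have nonzero probability
-- too, follows from the product formula for W itself. So both are handled in one induction on the
-- word: `Factors W` determines the directions after W, and these give `Factors (W ∷ʳ a)`. The
-- formula is stated for every Boolean labelling of ℤ that is constant on adjacent elements of S,
-- because two kinds are needed: the cut at the last free spot, and the indicator of a block. The
-- induction compares directions after multiplication by `ℙ P W S`, so that pairs of probability 0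
-- do no harm. Binomial coefficients never occur explicitly: the convolution is defined by Leibniz's
-- rule, which describes how the last letter of a word belongs to one of two subwords.

module Sums where
  open Mem using (_∈_)

  side : {A : Set} → (A → Bool) → Bool → List A → List A
  side σ β = filter (λ x → σ x Boolₚ.≟ β)

  side-∷ʳ-≡ : ∀ {A : Set} (σ : A → Bool) {β} W a → σ a ≡ β → side σ β (W ∷ʳ a) ≡ side σ β W ∷ʳ a
  side-∷ʳ-≡ σ {β} W a e = ≡.trans (Listₚ.filter-++ _ W (a ∷ []))
    (≡.cong (side σ β W ++_) (Listₚ.filter-accept (λ x → σ x Boolₚ.≟ β) e))

  side-∷ʳ-≢ : ∀ {A : Set} (σ : A → Bool) {β} W a → σ a ≢ β → side σ β (W ∷ʳ a) ≡ side σ β W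
  side-∷ʳ-≢ σ {β} W a e = ≡.trans (Listₚ.filter-++ _ W (a ∷ []))
    (≡.trans (≡.cong (side σ β W ++_) (Listₚ.filter-reject (λ x → σ x Boolₚ.≟ β) e))
             (Listₚ.++-identityʳ _))

  -- Finite sums, binomial convolutions and sums over words in a commutative semiring.

  module Summation (R : CommutativeSemiring 0ℓ 0ℓ) where
    open CommutativeSemiring R
    open CommutativeSemigroupProperties +-commutativeSemigroup using (interchange)
    open SetoidReasoning setoid

    private variable
      A B : Set

    ∑ : List A → (A → Carrier) → Carrier
    ∑ xs f = foldr _+_ 0# (map f xs)

    ∑-cong : ∀ (xs : List A) {f g} → (∀ x → x ∈ xs → f x ≈ g x) → ∑ xs f ≈ ∑ xs g
    ∑-cong []       _  = refl
    ∑-cong (x ∷ xs) eq = +-cong (eq x (here ≡.refl)) (∑-cong xs (λ y → eq y ∘ there))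

    ∑-zero : ∀ (xs : List A) {f} → (∀ x → x ∈ xs → f x ≈ 0#) → ∑ xs f ≈ 0#
    ∑-zero []       _  = refl
    ∑-zero (x ∷ xs) eq =
      trans (+-cong (eq x (here ≡.refl)) (∑-zero xs (λ y → eq y ∘ there))) (+-identityˡ 0#)

    ∑-+ : ∀ (xs : List A) f g → ∑ xs (λ x → f x + g x) ≈ ∑ xs f + ∑ xs g
    ∑-+ []       f g = sym (+-identityˡ 0#)
    ∑-+ (x ∷ xs) f g = trans (+-congˡ (∑-+ xs f g)) (interchange (f x) (g x) _ _)

    *-∑ : ∀ c (xs : List A) f → c * ∑ xs f ≈ ∑ xs (λ x → c * f x)
    *-∑ c []       f = zeroʳ c
    *-∑ c (x ∷ xs) f = trans (distribˡ c (f x) _) (+-congˡ (*-∑ c xs f))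

    ∑-* : ∀ c (xs : List A) f → ∑ xs f * c ≈ ∑ xs (λ x → f x * c)
    ∑-* c xs f = trans (*-comm _ c)
      (trans (*-∑ c xs f) (∑-cong xs (λ x _ → *-comm c (f x))))

    ∑-++ : ∀ (xs ys : List A) f → ∑ (xs ++ ys) f ≈ ∑ xs f + ∑ ys f
    ∑-++ []       ys f = sym (+-identityˡ _)
    ∑-++ (x ∷ xs) ys f = trans (+-congˡ (∑-++ xs ys f)) (sym (+-assoc (f x) _ _))

    ∑-map : ∀ (h : A → B) xs f → ∑ (map h xs) f ≡ ∑ xs (f ∘ h)
    ∑-map h xs f = ≡.cong (foldr _+_ 0#) (≡.sym (Listₚ.map-∘ xs))

    ∑-concatMap : ∀ (h : A → List B) xs f → ∑ (concatMap h xs) f ≈ ∑ xs (λ x → ∑ (h x) f)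
    ∑-concatMap h []       f = refl
    ∑-concatMap h (x ∷ xs) f = trans (∑-++ (h x) _ f) (+-congˡ (∑-concatMap h xs f))

    ∑-swap : ∀ (xs : List A) (ys : List B) (f : A → B → Carrier) →
             ∑ xs (λ x → ∑ ys (f x)) ≈ ∑ ys (λ y → ∑ xs (λ x → f x y))
    ∑-swap []       ys f = sym (∑-zero ys (λ _ _ → refl))
    ∑-swap (x ∷ xs) ys f = trans (+-congˡ (∑-swap xs ys f)) (sym (∑-+ ys (f x) _))

    opaque
      -- Iverson's bracket, handled through `[]-yes` and `[]-no`; opacity keeps the decision
      -- procedures from unfolding.
      [_] : ∀ {P : Set} → Dec P → Carrier
      [ d ] = if does d then 1# else 0#

      []-yes : ∀ {P : Set} (d : Dec P) → P → [ d ] ≈ 1#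
      []-yes (yes _) _ = refl
      []-yes (no ¬p) p = ⊥-elim (¬p p)

      []-no : ∀ {P : Set} (d : Dec P) → ¬ P → [ d ] ≈ 0#
      []-no (yes p) ¬p = ⊥-elim (¬p p)
      []-no (no _)  _  = refl

    []-⇔ : ∀ {P Q : Set} (d : Dec P) (e : Dec Q) → (P → Q) → (Q → P) → [ d ] ≈ [ e ]
    []-⇔ d@(yes p) e f g = trans ([]-yes d p) (sym ([]-yes e (f p)))
    []-⇔ d@(no ¬p) e f g = trans ([]-no d ¬p) (sym ([]-no e (¬p ∘ g)))

    ∑-single : ∀ {xs : List A} → Unique xs → ∀ {f} x → x ∈ xs →
               (∀ y → y ∈ xs → y ≢ x → f y ≈ 0#) → ∑ xs f ≈ f x
    ∑-single (y∉ ∷ u) x (here ≡.refl) z =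
      trans (+-congˡ (∑-zero _ (λ w w∈ → z w (there w∈) (All.lookup y∉ w∈ ∘ ≡.sym)))) (+-identityʳ _)
    ∑-single (y∉ ∷ u) x (there x∈) z =
      trans (+-cong (z _ (here ≡.refl) (All.lookup y∉ x∈)) (∑-single u x x∈ (λ w → z w ∘ there)))
            (+-identityˡ _)

    -- Σₖ C(n,k) f(k) g(n-k), as the n-th derivative of a product.
    conv : ℕ → (ℕ → Carrier) → (ℕ → Carrier) → Carrier
    conv zero    f g = f 0 * g 0
    conv (suc n) f g = conv n (f ∘ suc) g + conv n f (g ∘ suc)

    conv-cong : ∀ n {f f′ g g′} → (∀ i j → i ℕ.+ j ≡ n → f i * g j ≈ f′ i * g′ j) →
                conv n f g ≈ conv n f′ g′
    conv-cong zero    eq = eq 0 0 ≡.refl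
    conv-cong (suc n) eq = +-cong
      (conv-cong n (λ i j e → eq (suc i) j (≡.cong suc e)))
      (conv-cong n (λ i j e → eq i (suc j) (≡.trans (ℕₚ.+-suc i j) (≡.cong suc e))))

    conv-congˡ : ∀ n {f f′ g} → (∀ i → i ℕ.≤ n → f i ≈ f′ i) → conv n f g ≈ conv n f′ g
    conv-congˡ n eq = conv-cong n (λ { i j ≡.refl → *-congʳ (eq i (ℕₚ.m≤m+n i j)) })

    conv-congʳ : ∀ n {f g g′} → (∀ j → j ℕ.≤ n → g j ≈ g′ j) → conv n f g ≈ conv n f g′
    conv-congʳ n eq = conv-cong n (λ { i j ≡.refl → *-congˡ (eq j (ℕₚ.m≤n+m j i)) })

    conv-comm : ∀ n f g → conv n f g ≈ conv n g f
    conv-comm zero    f g = *-comm (f 0) (g 0)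
    conv-comm (suc n) f g = trans (+-comm _ _)
      (+-cong (conv-comm n f (g ∘ suc)) (conv-comm n (f ∘ suc) g))

    conv-+ˡ : ∀ n f f′ g → conv n (λ k → f k + f′ k) g ≈ conv n f g + conv n f′ g
    conv-+ˡ zero    f f′ g = distribʳ (g 0) (f 0) (f′ 0)
    conv-+ˡ (suc n) f f′ g =
      trans (+-cong (conv-+ˡ n (f ∘ suc) (f′ ∘ suc) g) (conv-+ˡ n f f′ (g ∘ suc)))
            (interchange _ _ _ _)

    conv-*ˡ : ∀ n c f g → conv n (λ k → c * f k) g ≈ c * conv n f g
    conv-*ˡ zero    c f g = *-assoc c (f 0) (g 0)
    conv-*ˡ (suc n) c f g =
      trans (+-cong (conv-*ˡ n c (f ∘ suc) g) (conv-*ˡ n c f (g ∘ suc))) (sym (distribˡ c _ _))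

    conv-zeroˡ : ∀ n g → conv n (λ _ → 0#) g ≈ 0#
    conv-zeroˡ zero    g = zeroˡ (g 0)
    conv-zeroˡ (suc n) g =
      trans (+-cong (conv-zeroˡ n g) (conv-zeroˡ n (g ∘ suc))) (+-identityˡ 0#)

    conv-∑ˡ : ∀ n (xs : List A) (f : A → ℕ → Carrier) g →
              conv n (λ k → ∑ xs (λ x → f x k)) g ≈ ∑ xs (λ x → conv n (f x) g)
    conv-∑ˡ n []       f g = conv-zeroˡ n g
    conv-∑ˡ n (x ∷ xs) f g = trans (conv-+ˡ n (f x) _ g) (+-congˡ (conv-∑ˡ n xs f g))

    conv-∑ʳ : ∀ n (xs : List A) f (g : A → ℕ → Carrier) →
              conv n f (λ k → ∑ xs (λ x → g x k)) ≈ ∑ xs (λ x → conv n f (g x))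
    conv-∑ʳ n xs f g = trans (conv-comm n f _)
      (trans (conv-∑ˡ n xs g f) (∑-cong xs (λ x _ → conv-comm n (g x) f)))

    ∑-side : ∀ (σ : A → Bool) xs f → ∑ xs f ≈ ∑ (side σ true xs) f + ∑ (side σ false xs) f
    ∑-side σ []       f = sym (+-identityˡ 0#)
    ∑-side σ (x ∷ xs) f with σ x
    ... | true  = trans (+-congˡ (∑-side σ xs f)) (sym (+-assoc (f x) _ _))
    ... | false = trans (+-congˡ (∑-side σ xs f))
      (trans (sym (+-assoc (f x) _ _)) (trans (+-congʳ (+-comm (f x) _)) (+-assoc _ (f x) _)))

    -- The outermost sum runs over the last letter, to match the recursion `ℙ-∷ʳ` on the last car.
    ∑ʷ : List A → ℕ → (List A → Carrier) → Carrier
    ∑ʷ xs zero    f = f []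
    ∑ʷ xs (suc n) f = ∑ xs (λ a → ∑ʷ xs n (λ W → f (W ∷ʳ a)))

    ∑ʷ-cong : ∀ (xs : List A) n {f g} → (∀ W → length W ≡ n → All (_∈ xs) W → f W ≈ g W) →
              ∑ʷ xs n f ≈ ∑ʷ xs n g
    ∑ʷ-cong xs zero    eq = eq [] ≡.refl []
    ∑ʷ-cong xs (suc n) eq = ∑-cong xs (λ a a∈ → ∑ʷ-cong xs n (λ W len all →
      eq (W ∷ʳ a)
         (≡.trans (Listₚ.length-++ W) (≡.trans (ℕₚ.+-comm (length W) 1) (≡.cong suc len)))
         (Allₚ.∷ʳ⁺ all a∈)))

    ∑ʷ-zero : ∀ (xs : List A) n {f} → (∀ W → length W ≡ n → f W ≈ 0#) → ∑ʷ xs n f ≈ 0#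
    ∑ʷ-zero xs n {f} eq = trans (∑ʷ-cong xs n (λ W len _ → eq W len)) (const n)
      where
      const : ∀ n → ∑ʷ xs n (λ _ → 0#) ≈ 0#
      const zero    = refl
      const (suc n) = ∑-zero xs (λ _ _ → const n)

    ∑ʷ-+ : ∀ (xs : List A) n f g → ∑ʷ xs n (λ W → f W + g W) ≈ ∑ʷ xs n f + ∑ʷ xs n g
    ∑ʷ-+ xs zero    f g = refl
    ∑ʷ-+ xs (suc n) f g = trans (∑-cong xs (λ a _ → ∑ʷ-+ xs n _ _)) (∑-+ xs _ _)

    ∑ʷ-* : ∀ (xs : List A) n c f → ∑ʷ xs n (λ W → c * f W) ≈ c * ∑ʷ xs n f
    ∑ʷ-* xs zero    c f = refl
    ∑ʷ-* xs (suc n) c f = trans (∑-cong xs (λ a _ → ∑ʷ-* xs n c _)) (sym (*-∑ c xs _))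

    ∑ʷ-∑ : ∀ (xs : List A) n (ys : List B) (f : B → List A → Carrier) →
           ∑ʷ xs n (λ W → ∑ ys (λ y → f y W)) ≈ ∑ ys (λ y → ∑ʷ xs n (f y))
    ∑ʷ-∑ xs n []       f = ∑ʷ-zero xs n (λ _ _ → refl)
    ∑ʷ-∑ xs n (y ∷ ys) f = trans (∑ʷ-+ xs n (f y) _) (+-congˡ (∑ʷ-∑ xs n ys f))

    ∑ʷ-map : ∀ (h : A → B) xs n f → ∑ʷ (map h xs) n f ≈ ∑ʷ xs n (f ∘ map h)
    ∑ʷ-map h xs zero    f = refl
    ∑ʷ-map h xs (suc n) f = trans (reflexive (∑-map h xs _)) (∑-cong xs (λ a _ →
      trans (∑ʷ-map h xs n _) (∑ʷ-cong xs n (λ W _ _ →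
        reflexive (≡.cong f (≡.sym (Listₚ.map-++ h W (a ∷ []))))))))

    ∑ʷ-drop : ∀ (x : A) xs n {f} → (∀ W → x ∈ W → f W ≈ 0#) → ∑ʷ (x ∷ xs) n f ≈ ∑ʷ xs n f
    ∑ʷ-drop x xs zero        z = refl
    ∑ʷ-drop x xs (suc n) {f} z = trans
      (+-cong (∑ʷ-zero (x ∷ xs) n (λ W _ → z (W ∷ʳ x) (Memₚ.∈-++⁺ʳ W (here ≡.refl))))
              (∑-cong xs (λ a _ → ∑ʷ-drop x xs n (λ W x∈ → z (W ∷ʳ a) (Memₚ.∈-++⁺ˡ x∈)))))
      (+-identityˡ _)

    -- The last letter lengthens exactly one of the two subwords, and the two cases are the two
    -- terms of the Leibniz rule that defines `conv`. The binomial coefficient thus counts the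
    -- interleavings of two subwords.
    ∑ʷ-shuffle : ∀ (σ : A → Bool) xs n F G →
      ∑ʷ xs n (λ W → F (side σ true W) * G (side σ false W)) ≈
      conv n (λ i → ∑ʷ (side σ true xs) i F) (λ j → ∑ʷ (side σ false xs) j G)
    ∑ʷ-shuffle σ xs zero    F G = refl
    ∑ʷ-shuffle {A = A} σ xs (suc n) F G = begin
      ∑ xs φ                                 ≈⟨ ∑-side σ xs φ ⟩
      ∑ (side σ true xs) φ + ∑ (side σ false xs) φ
        ≈⟨ +-cong (∑-cong (side σ true xs) (λ a a∈ → left a (σ≡ true a∈)))
                  (∑-cong (side σ false xs) (λ a a∈ → right a (σ≡ false a∈))) ⟩
      ∑ (side σ true xs) (λ a → conv n (λ i → ∑ʷ (side σ true xs) i (F ∘ (_∷ʳ a))) g)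
        + ∑ (side σ false xs) (λ a → conv n f (λ j → ∑ʷ (side σ false xs) j (G ∘ (_∷ʳ a))))
        ≈⟨ +-cong (conv-∑ˡ n (side σ true xs) _ g) (conv-∑ʳ n (side σ false xs) f _) ⟨
      conv (suc n) f g                       ∎
      where
      f g : ℕ → Carrier
      f i = ∑ʷ (side σ true xs) i F
      g j = ∑ʷ (side σ false xs) j G

      φ : A → Carrier
      φ a = ∑ʷ xs n (λ W → F (side σ true (W ∷ʳ a)) * G (side σ false (W ∷ʳ a)))

      σ≡ : ∀ β {a} → a ∈ side σ β xs → σ a ≡ β
      σ≡ β a∈ = proj₂ (Memₚ.∈-filter⁻ (λ x → σ x Boolₚ.≟ β) {xs = xs} a∈)

      left : ∀ a → σ a ≡ true → φ a ≈ conv n (λ i → ∑ʷ (side σ true xs) i (F ∘ (_∷ʳ a))) g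
      left a e = trans
        (∑ʷ-cong xs n (λ W _ _ → reflexive (≡.cong₂ (λ U V → F U * G V)
          (side-∷ʳ-≡ σ W a e) (side-∷ʳ-≢ σ W a (λ e′ → not-¬ e′ e)))))
        (∑ʷ-shuffle σ xs n (F ∘ (_∷ʳ a)) G)

      right : ∀ a → σ a ≡ false → φ a ≈ conv n f (λ j → ∑ʷ (side σ false xs) j (G ∘ (_∷ʳ a)))
      right a e = trans
        (∑ʷ-cong xs n (λ W _ _ → reflexive (≡.cong₂ (λ U V → F U * G V)
          (side-∷ʳ-≢ σ W a (λ e′ → not-¬ e e′)) (side-∷ʳ-≡ σ W a e))))
        (∑ʷ-shuffle σ xs n F (G ∘ (_∷ʳ a)))

open ≡ using (refl; sym; trans; cong; cong₂; subst; subst₂)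

-- Abel's binomial identity over the natural numbers.

module Abel where
  open import Data.Nat
  open import Data.Nat.Properties
  open import Data.Nat.Tactic.RingSolver using (solve-∀)
  open ≡-Reasoning
  open Sums
  open Summation +-*-commutativeSemiring

  -- In the term with index k the two weights add up to (x + k) + (y + n - k), which does not depend
  -- on k. The induction raises x or y by one, according to the factor that Leibniz's rule
  -- differentiates.
  conv-weight : ∀ n x y f g →
    conv n (λ k → (x + k) * f k) g + conv n f (λ k → (y + k) * g k) ≡ (x + y + n) * conv n f g
  conv-weight zero x y f g = lemma x y (f 0) (g 0)
    where
    lemma : ∀ x y a b → (x + 0) * a * b + a * ((y + 0) * b) ≡ (x + y + 0) * (a * b)
    lemma = solve-∀
  conv-weight (suc n) x y f g = begin
    (conv n (λ k → (x + suc k) * f (suc k)) g + conv n (λ k → (x + k) * f k) (g ∘ suc))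
      + (conv n (f ∘ suc) (λ k → (y + k) * g k) + conv n f (λ k → (y + suc k) * g (suc k)))
      ≡⟨ cong₂ (λ u v → u + conv n (λ k → (x + k) * f k) (g ∘ suc) + (conv n (f ∘ suc) (λ k → (y + k) * g k) + v))
           (conv-cong n (λ i j _ → cong (λ u → u * f (suc i) * g j) (+-suc x i)))
           (conv-cong n (λ i j _ → cong (λ u → f i * (u * g (suc j))) (+-suc y j))) ⟩
    (A + B) + (C + D)                 ≡⟨ lemma₁ A B C D ⟩
    (A + C) + (B + D)
      ≡⟨ cong₂ _+_ (conv-weight n (suc x) y (f ∘ suc) g) (conv-weight n x (suc y) f (g ∘ suc)) ⟩
    (suc x + y + n) * conv n (f ∘ suc) g + (x + suc y + n) * conv n f (g ∘ suc)
      ≡⟨ lemma₂ x y n (conv n (f ∘ suc) g) _ ⟩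
    (x + y + suc n) * conv (suc n) f g ∎
    where
    A = conv n (λ k → (suc x + k) * f (suc k)) g
    B = conv n (λ k → (x + k) * f k) (g ∘ suc)
    C = conv n (f ∘ suc) (λ k → (y + k) * g k)
    D = conv n f (λ k → (suc y + k) * g (suc k))
    lemma₁ : ∀ a b c d → (a + b) + (c + d) ≡ (a + c) + (b + d)
    lemma₁ = solve-∀
    lemma₂ : ∀ x y n u v → (suc x + y + n) * u + (x + suc y + n) * v ≡ (x + y + suc n) * (u + v)
    lemma₂ = solve-∀

  -- With exponential generating functions, `k * u (pred k)` is the k-th coefficient of t U(t), and
  -- the coefficient of t U G of order n + 1 is n + 1 times that of U G of order n.
  conv-derivative : ∀ n u g → conv (suc n) (λ k → k * u (pred k)) g ≡ suc n * conv n u g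
  conv-derivative zero    u g = lemma (u 0) (g 0) (g 1)
    where
    lemma : ∀ a b c → (a + 0) * b + 0 ≡ a * b + 0
    lemma = solve-∀
  conv-derivative (suc n) u g = begin
    conv (suc n) (λ k → suc k * u k) g + conv (suc n) (λ k → k * u (pred k)) (g ∘ suc)
      ≡⟨ cong₂ _+_ (trans (conv-+ˡ (suc n) u (λ k → k * u k) g)
           (cong (conv (suc n) u g +_)
             (trans (conv-congˡ (suc n) {g = g} (λ { zero _ → refl ; (suc k) _ → refl }))
                    (conv-derivative n (u ∘ suc) g))))
           (conv-derivative n u (g ∘ suc)) ⟩
    (conv (suc n) u g + suc n * conv n (u ∘ suc) g) + suc n * conv n u (g ∘ suc)
      ≡⟨ trans (+-assoc (conv (suc n) u g) _ _) (cong (conv (suc n) u g +_)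
           (sym (*-distribˡ-+ (suc n) (conv n (u ∘ suc) g) _))) ⟩
    suc (suc n) * conv (suc n) u g ∎

  -- α x k = x (x + k)ᵏ⁻¹, so that abel is Abel's binomial identity.  It is proved together with the
  -- fact that the convolution of β x and β y only depends on x + y.
  α β : ℕ → ℕ → ℕ
  α x zero    = 1
  α x (suc k) = x * (suc x + k) ^ k
  β y k = (y + k) ^ k

  α-β : ∀ x k → (x + k) * α x k ≡ x * β x k
  α-β x zero = cong (_* 1) (+-identityʳ x)
  α-β x (suc k) rewrite +-suc x k = lemma x k ((suc (x + k)) ^ k)
    where
    lemma : ∀ x k p → suc (x + k) * (x * p) ≡ x * (suc (x + k) * p)
    lemma = solve-∀

  β-suc : ∀ y k → β y (suc k) ≡ (suc y + k) * β (suc y) k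
  β-suc y k rewrite +-suc y k = refl

  -- One factor x + k of (x + k)^k is split into x and k. For k > 0, the remaining power (x +
  -- k)^(k-1) is `β (suc x) (pred k)`, the form to which `conv-derivative` applies.
  β-α : ∀ x k → β x k ≡ α x k + k * β (suc x) (pred k)
  β-α x zero    = refl
  β-α x (suc k) rewrite +-suc x k = lemma x k (suc (x + k) ^ k)
    where
    lemma : ∀ x k p → suc (x + k) * p ≡ x * p + suc k * p
    lemma = solve-∀

  -- Granted Abel's identity in degree n + 1, the convolution of two `β` is reduced to degree n, up
  -- to a term in which x and y occur only through their sum. This is how `conv-β` passes from one
  -- degree to the next.
  β-expand : ∀ n x y → conv (suc n) (α x) (β y) ≡ (x + y + suc n) ^ suc n →
    conv (suc n) (β x) (β y) ≡ (x + y + suc n) ^ suc n + suc n * conv n (β (suc x)) (β y)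
  β-expand n x y eq = trans (conv-congˡ (suc n) {g = β y} (λ k _ → β-α x k))
    (trans (conv-+ˡ (suc n) (α x) (λ k → k * β (suc x) (pred k)) (β y))
           (cong₂ _+_ eq (conv-derivative n (β (suc x)) (β y))))

  abel : ∀ n x y → conv n (α x) (β y) ≡ (x + y + n) ^ n
  conv-β : ∀ n x y → conv n (β (suc x)) (β y) ≡ conv n (β x) (β (suc y))

  abel zero x y = refl
  -- Since `α x (suc k)` is `x * β (suc x) k`, the first half of the convolution is X by `conv-β`.
  -- By `α-β`, X also equals U, and U and V together are what `conv-weight` evaluates. The X added
  -- to both sides is the copy that becomes U; the original one is cancelled.
  abel (suc n) x y = +-cancelʳ-≡ (x * conv n (β x) (β (suc y))) _ _ (begin
    conv n (λ k → x * β (suc x) k) (β y) + conv n (α x) (β y ∘ suc) + X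
      ≡⟨ cong (λ u → u + conv n (α x) (β y ∘ suc) + X)
          (trans (conv-*ˡ n x (β (suc x)) (β y)) (cong (x *_) (conv-β n x y))) ⟩
    X + conv n (α x) (β y ∘ suc) + X
      ≡⟨ cong₂ (λ u v → X + u + v) (conv-congʳ n {α x} (λ j _ → β-suc y j))
           (trans (sym (conv-*ˡ n x (β x) (β (suc y))))
                  (conv-congˡ n (λ k _ → sym (α-β x k)))) ⟩
    X + V + U
      ≡⟨ trans (+-assoc X V U) (trans (+-comm X (V + U)) (cong (_+ X) (+-comm V U))) ⟩
    U + V + X
      ≡⟨ cong (_+ X) (conv-weight n x (suc y) (α x) (β (suc y))) ⟩
    (x + suc y + n) * conv n (α x) (β (suc y)) + X
      ≡⟨ cong (λ u → (x + suc y + n) * u + X) (abel n x (suc y)) ⟩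
    (x + suc y + n) ^ suc n + X
      ≡⟨ cong (λ u → u ^ suc n + X) (lemma x y n) ⟩
    (x + y + suc n) ^ suc n + X ∎)
    where
    X = x * conv n (β x) (β (suc y))
    U = conv n (λ k → (x + k) * α x k) (β (suc y))
    V = conv n (α x) (λ k → (suc y + k) * β (suc y) k)
    lemma : ∀ x y n → x + suc y + n ≡ x + y + suc n
    lemma = solve-∀

  conv-β zero x y = refl
  -- The recursion is well-founded: `abel` at `suc n` calls only `abel` and `conv-β` at `n`.
  conv-β (suc n) x y = begin
    conv (suc n) (β (suc x)) (β y)                        ≡⟨ β-expand n (suc x) y (abel (suc n) (suc x) y) ⟩
    (suc x + y + suc n) ^ suc n + suc n * conv n (β (suc (suc x))) (β y)
      ≡⟨ cong₂ (λ u v → u ^ suc n + suc n * v) (lemma x y n)  (conv-β n (suc x) y) ⟩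
    (x + suc y + suc n) ^ suc n + suc n * conv n (β (suc x)) (β (suc y))
      ≡⟨ β-expand n x (suc y) (abel (suc n) x (suc y)) ⟨
    conv (suc n) (β x) (β (suc y)) ∎
    where
    lemma : ∀ x y n → suc x + y + suc n ≡ x + suc y + suc n
    lemma = solve-∀

open import Data.Integer using (+_; -[1+_])
open import Defs

-- The ring of Cauchy reals, stability of its equality, and signs.

module Reals where

  -- _≈ᴿ_ unfolds to a function type, from which Agda cannot recover the two reals.
  infix 4 _≃_
  record _≃_ (x y : ℝ) : Set where
    constructor mk≃
    field approx : x ≈ᴿ y

  open _≃_ public

  ∣p-p∣≡0 : ∀ p → ℚ.∣ p ℚ.- p ∣ ≡ 0ℚ
  ∣p-p∣≡0 p = cong ℚ.∣_∣ (ℚₚ.+-inverseʳ p)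

  ∣p-q∣≡∣q-p∣ : ∀ p q → ℚ.∣ p ℚ.- q ∣ ≡ ℚ.∣ q ℚ.- p ∣
  ∣p-q∣≡∣q-p∣ p q = trans (sym (ℚₚ.∣-p∣≡∣p∣ (p ℚ.- q)))
    (cong ℚ.∣_∣ (trans (ℚₚ.neg-distrib-+ p (ℚ.- q))
      (trans (cong (ℚ.- p ℚ.+_) (neg-involutive q)) (ℚₚ.+-comm (ℚ.- p) q))))
    where
    neg-involutive : ∀ q → ℚ.- (ℚ.- q) ≡ q
    neg-involutive (ℚ.mkℚ (+ zero)      _ _) = refl
    neg-involutive (ℚ.mkℚ (+ suc _)     _ _) = refl
    neg-involutive (ℚ.mkℚ ℤ.-[1+ _ ]    _ _) = refl

  ℚ-+-cancelʳ-< : ∀ r p q → p ℚ.+ r ℚ.< q ℚ.+ r → p ℚ.< q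
  ℚ-+-cancelʳ-< r p q p+r<q+r = ℚₚ.≰⇒> λ q≤p → ℚₚ.<-irrefl refl (ℚₚ.<-≤-trans p+r<q+r (ℚₚ.+-monoˡ-≤ r q≤p))

  0+½ε+½ε : ∀ ε → 0ℚ ℚ.+ ½ ℚ.* ε ℚ.+ ½ ℚ.* ε ≡ ε
  0+½ε+½ε ε = trans (cong (ℚ._+ ½ ℚ.* ε) (ℚₚ.+-identityˡ (½ ℚ.* ε))) (½ε+½ε ε)

  ½ε<ε : ∀ {ε} → 0ℚ ℚ.< ε → ½ ℚ.* ε ℚ.< ε
  ½ε<ε {ε} ε>0 = begin-strict
    ½ ℚ.* ε                ≡⟨ ℚₚ.+-identityˡ (½ ℚ.* ε) ⟨
    0ℚ ℚ.+ ½ ℚ.* ε         <⟨ ℚₚ.+-monoˡ-< (½ ℚ.* ε) (½ε>0 ε>0) ⟩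
    ½ ℚ.* ε ℚ.+ ½ ℚ.* ε    ≡⟨ ½ε+½ε ε ⟩
    ε                      ∎
    where open ℚₚ.≤-Reasoning

  triangle : ∀ p q r → ℚ.∣ p ℚ.- r ∣ ℚ.≤ ℚ.∣ p ℚ.- q ∣ ℚ.+ ℚ.∣ q ℚ.- r ∣
  triangle p q r = ℚₚ.≤-trans (ℚₚ.≤-reflexive (cong ℚ.∣_∣ eq)) (ℚₚ.∣p+q∣≤∣p∣+∣q∣ (p ℚ.- q) (q ℚ.- r))
    where
    eq : p ℚ.- r ≡ (p ℚ.- q) ℚ.+ (q ℚ.- r)
    eq = trans (cong (ℚ._- r) (p≡[p-q]+q p q)) (ℚₚ.+-assoc (p ℚ.- q) q (ℚ.- r))

  ≡⇒≃ : ∀ {x y} → (∀ n → seq x n ≡ seq y n) → x ≃ y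
  ≡⇒≃ {x} {y} eq = mk≃ λ ε ε>0 → 0 , λ n _ →
    subst (λ q → ℚ.∣ q ℚ.- seq y n ∣ ℚ.< ε) (sym (eq n)) (subst (ℚ._< ε) (sym (∣p-p∣≡0 (seq y n))) ε>0)

  ≃-refl : ∀ {x} → x ≃ x
  ≃-refl = ≡⇒≃ (λ _ → refl)

  ≃-sym : ∀ {x y} → x ≃ y → y ≃ x
  ≃-sym {x} {y} (mk≃ h) = mk≃ λ ε ε>0 → let N , f = h ε ε>0 in
    N , λ n N≤n → subst (ℚ._< ε) (∣p-q∣≡∣q-p∣ (seq x n) (seq y n)) (f n N≤n)

  ≃-trans : ∀ {x y z} → x ≃ y → y ≃ z → x ≃ z
  ≃-trans {x} {y} {z} (mk≃ h) (mk≃ k) = mk≃ λ ε ε>0 →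
    let M , f = h (½ ℚ.* ε) (½ε>0 ε>0) ; N , g = k (½ ℚ.* ε) (½ε>0 ε>0) in
    M ℕ.⊔ N , λ n ≤n → ℚₚ.≤-<-trans (triangle (seq x n) (seq y n) (seq z n))
      (subst (_ ℚ.<_) (½ε+½ε ε)
        (ℚₚ.+-mono-< (f n (ℕₚ.m⊔n≤o⇒m≤o M N ≤n)) (g n (ℕₚ.m⊔n≤o⇒n≤o M N ≤n))))

  +-cong : ∀ {x y u v} → x ≃ y → u ≃ v → x +ᴿ u ≃ y +ᴿ v
  +-cong {x} {y} {u} {v} (mk≃ h) (mk≃ k) = mk≃ λ ε ε>0 →
    let M , f = h (½ ℚ.* ε) (½ε>0 ε>0) ; N , g = k (½ ℚ.* ε) (½ε>0 ε>0) in
    M ℕ.⊔ N , λ n ≤n →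
      subst (λ q → ℚ.∣ q ∣ ℚ.< ε) (sym ([p+q]-[r+s] (seq x n) (seq u n) (seq y n) (seq v n)))
        (ℚₚ.≤-<-trans (ℚₚ.∣p+q∣≤∣p∣+∣q∣ (seq x n ℚ.- seq y n) (seq u n ℚ.- seq v n))
          (subst (_ ℚ.<_) (½ε+½ε ε)
            (ℚₚ.+-mono-< (f n (ℕₚ.m⊔n≤o⇒m≤o M N ≤n)) (g n (ℕₚ.m⊔n≤o⇒n≤o M N ≤n)))))

  neg-cong : ∀ {x y} → x ≃ y → -ᴿ x ≃ -ᴿ y
  neg-cong {x} {y} (mk≃ h) = mk≃ λ ε ε>0 → let N , f = h ε ε>0 in
    N , λ n N≤n → subst (ℚ._< ε)
      (trans (sym (ℚₚ.∣-p∣≡∣p∣ (seq x n ℚ.- seq y n)))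
             (cong ℚ.∣_∣ (ℚₚ.neg-distrib-+ (seq x n) (ℚ.- seq y n))))
      (f n N≤n)

  *-congˡ : ∀ x {y z} → y ≃ z → x *ᴿ y ≃ x *ᴿ z
  *-congˡ x {y} {z} (mk≃ h) = mk≃ approximate
    where
    open ℚₚ.≤-Reasoning
    approximate : (x *ᴿ y) ≈ᴿ (x *ᴿ z)
    approximate ε ε>0 with bounded x
    ... | B , B>0 , N₁ , hB = N₁ ℕ.⊔ proj₁ (h δ δ>0) , λ n ≤n → bound n
            (hB n (ℕₚ.m⊔n≤o⇒m≤o N₁ _ ≤n)) (proj₂ (h δ δ>0) n (ℕₚ.m⊔n≤o⇒n≤o N₁ _ ≤n))
      where
      instance
        _ = ℚ.positive B>0
        _ = ℚ.positive ε>0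
        _ = ℚₚ.pos⇒nonZero B
        _ = ℚₚ.1/pos⇒pos B
      1/B = ℚ.1/ B
      δ = 1/B ℚ.* ε
      instance _ = ℚₚ.pos*pos⇒pos 1/B ε
      δ>0 : 0ℚ ℚ.< δ
      δ>0 = ℚₚ.positive⁻¹ δ

      B*δ≡ε : B ℚ.* δ ≡ ε
      B*δ≡ε = trans (sym (ℚₚ.*-assoc B 1/B ε))
             (trans (cong (ℚ._* ε) (ℚₚ.*-inverseʳ B)) (ℚₚ.*-identityˡ ε))

      distrib : ∀ p q r → p ℚ.* q ℚ.- p ℚ.* r ≡ p ℚ.* (q ℚ.- r)
      distrib p q r = trans (cong (p ℚ.* q ℚ.+_) (ℚₚ.neg-distribʳ-* p r))
                            (sym (ℚₚ.*-distribˡ-+ p q (ℚ.- r)))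

      product< : ∀ p q → ℚ.∣ p ∣ ℚ.< B → ℚ.∣ q ∣ ℚ.< δ → ℚ.∣ p ℚ.* q ∣ ℚ.< ε
      product< p q hp hq = begin-strict
          ℚ.∣ p ℚ.* q ∣          ≡⟨ ℚₚ.∣p*q∣≡∣p∣*∣q∣ p q ⟩
          ℚ.∣ p ∣ ℚ.* ℚ.∣ q ∣    ≤⟨ ℚₚ.*-monoʳ-≤-nonNeg ℚ.∣ q ∣ (ℚₚ.<⇒≤ hp) ⟩
          B ℚ.* ℚ.∣ q ∣          <⟨ ℚₚ.*-monoʳ-<-pos B hq ⟩
          B ℚ.* δ                ≡⟨ B*δ≡ε ⟩
          ε                      ∎
        where instance _ = ℚₚ.∣-∣-nonNeg q

      bound : ∀ n → ℚ.∣ seq x n ∣ ℚ.< B → ℚ.∣ seq y n ℚ.- seq z n ∣ ℚ.< δ →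
              ℚ.∣ seq x n ℚ.* seq y n ℚ.- seq x n ℚ.* seq z n ∣ ℚ.< ε
      bound n hx hyz = subst (λ q → ℚ.∣ q ∣ ℚ.< ε) (sym (distrib (seq x n) (seq y n) (seq z n)))
        (product< (seq x n) (seq y n ℚ.- seq z n) hx hyz)

  *-comm : ∀ x y → x *ᴿ y ≃ y *ᴿ x
  *-comm x y = ≡⇒≃ (λ n → ℚₚ.*-comm (seq x n) (seq y n))

  *-cong : ∀ {x y u v} → x ≃ y → u ≃ v → x *ᴿ u ≃ y *ᴿ v
  *-cong {x} {y} {u} {v} x≃y u≃v =
    ≃-trans {y = x *ᴿ v} (*-congˡ x {u} {v} u≃v) (≃-trans {y = v *ᴿ x} (*-comm x v)
      (≃-trans {y = v *ᴿ y} (*-congˡ v {x} {y} x≃y) (*-comm v y)))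

  infixl 6 _⊕_
  infixl 7 _⊗_
  infix  8 ⊖_

  -- Opaque copies of the operations: the originals unfold to pairs of a sequence and a
  -- Cauchy proof, which makes conversion checking prohibitively slow.
  opaque
    _⊕_ _⊗_ : ℝ → ℝ → ℝ
    _⊕_ = _+ᴿ_
    _⊗_ = _*ᴿ_

    ⊖_ : ℝ → ℝ
    ⊖_ = -ᴿ_

    ⊕-def : ∀ x y → x ⊕ y ≡ x +ᴿ y
    ⊕-def x y = refl

    ⊗-def : ∀ x y → x ⊗ y ≡ x *ᴿ y
    ⊗-def x y = refl

    ⊖-def : ∀ x → ⊖ x ≡ -ᴿ x
    ⊖-def x = refl

    isCommutativeRing : IsCommutativeRing _≃_ _⊕_ _⊗_ ⊖_ 0ᴿ 1ᴿ
    isCommutativeRing = record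
      { isRing = record
        { +-isAbelianGroup = record
          { isGroup = record
            { isMonoid = record
              { isSemigroup = record
                { isMagma = record
                  { isEquivalence = record { refl = ≃-refl ; sym = ≃-sym ; trans = ≃-trans }
                  ; ∙-cong = +-cong }
                ; assoc = λ x y z → ≡⇒≃ (λ n → ℚₚ.+-assoc (seq x n) (seq y n) (seq z n)) }
              ; identity = (λ x → ≡⇒≃ (λ n → ℚₚ.+-identityˡ (seq x n)))
                         , (λ x → ≡⇒≃ (λ n → ℚₚ.+-identityʳ (seq x n))) }
            ; inverse = (λ x → ≡⇒≃ (λ n → ℚₚ.+-inverseˡ (seq x n)))
                      , (λ x → ≡⇒≃ (λ n → ℚₚ.+-inverseʳ (seq x n)))
            ; ⁻¹-cong = neg-cong }
          ; comm = λ x y → ≡⇒≃ (λ n → ℚₚ.+-comm (seq x n) (seq y n)) }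
        ; *-cong = *-cong
        ; *-assoc = λ x y z → ≡⇒≃ (λ n → ℚₚ.*-assoc (seq x n) (seq y n) (seq z n))
        ; *-identity = (λ x → ≡⇒≃ (λ n → ℚₚ.*-identityˡ (seq x n)))
                     , (λ x → ≡⇒≃ (λ n → ℚₚ.*-identityʳ (seq x n)))
        ; distrib = (λ x y z → ≡⇒≃ (λ n → ℚₚ.*-distribˡ-+ (seq x n) (seq y n) (seq z n)))
                  , (λ x y z → ≡⇒≃ (λ n → ℚₚ.*-distribʳ-+ (seq x n) (seq y n) (seq z n))) }
      ; *-comm = *-comm }

  ℝ-ring : CommutativeRing 0ℓ 0ℓ
  ℝ-ring = record { isCommutativeRing = isCommutativeRing }

  module R = CommutativeRing ℝ-ring

  -- The normal form of n / 1. Sums and products of such fractions compute, whereas `+ n ℚ./ 1` is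
  -- stuck on a gcd.
  integer : ℕ → ℚ
  integer n = ℚ.mkℚ (+ n) 0 (Coprimality.sym (Coprimality.1-coprimeTo n))

  n/1≡integer : ∀ n → + n ℚ./ 1 ≡ integer n
  n/1≡integer n = ℚₚ.normalize-coprime {n} {0} _

  opaque
    unfolding _⊕_

    fromℕ-+ : ∀ m n → fromℕ (m ℕ.+ n) ≃ fromℕ m ⊕ fromℕ n
    fromℕ-+ m n = ≡⇒≃ λ _ → begin
      + (m ℕ.+ n) ℚ./ 1
        ≡⟨ cong (ℚ._/ 1) (cong₂ ℤ._+_ (ℤₚ.*-identityʳ (+ m)) (ℤₚ.*-identityʳ (+ n))) ⟨
      (+ m ℤ.* + 1 ℤ.+ + n ℤ.* + 1) ℚ./ 1  ≡⟨⟩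
      integer m ℚ.+ integer n              ≡⟨ cong₂ ℚ._+_ (n/1≡integer m) (n/1≡integer n) ⟨
      (+ m ℚ./ 1) ℚ.+ (+ n ℚ./ 1)          ∎
      where open ≡-Reasoning

    fromℕ-* : ∀ m n → fromℕ (m ℕ.* n) ≃ fromℕ m ⊗ fromℕ n
    fromℕ-* m n = ≡⇒≃ λ _ → begin
      + (m ℕ.* n) ℚ./ 1          ≡⟨ cong (ℚ._/ 1) (ℤₚ.pos-* m n) ⟩
      (+ m ℤ.* + n) ℚ./ 1        ≡⟨⟩
      integer m ℚ.* integer n    ≡⟨ cong₂ ℚ._*_ (n/1≡integer m) (n/1≡integer n) ⟨
      (+ m ℚ./ 1) ℚ.* (+ n ℚ./ 1)∎
      where open ≡-Reasoning

  ∣p-q∣<ε⇒p<q+ε : ∀ {p q ε} → ℚ.∣ p ℚ.- q ∣ ℚ.< ε → p ℚ.< q ℚ.+ ε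
  ∣p-q∣<ε⇒p<q+ε {p} {q} {ε} h = begin-strict
    p                             ≡⟨ p≡[p-q]+q p q ⟩
    (p ℚ.- q) ℚ.+ q               ≤⟨ ℚₚ.+-monoˡ-≤ q (p≤∣p∣ (p ℚ.- q)) ⟩
    ℚ.∣ p ℚ.- q ∣ ℚ.+ q           <⟨ ℚₚ.+-monoˡ-< q h ⟩
    ε ℚ.+ q                       ≡⟨ ℚₚ.+-comm ε q ⟩
    q ℚ.+ ε                       ∎
    where
    open ℚₚ.≤-Reasoning
    p≤∣p∣ : ∀ p → p ℚ.≤ ℚ.∣ p ∣
    p≤∣p∣ p with ℚₚ.≤-total 0ℚ p
    ... | inj₁ 0≤p = ℚₚ.≤-reflexive (sym (ℚₚ.0≤p⇒∣p∣≡p 0≤p))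
    ... | inj₂ p≤0 = ℚₚ.≤-trans p≤0 (ℚₚ.0≤∣p∣ p)

  >0-resp-≃ : ∀ {x y} → x ≃ y → 0ᴿ <ᴿ x → 0ᴿ <ᴿ y
  >0-resp-≃ {x} {y} (mk≃ h) (ε , ε>0 , M , f) with h (½ ℚ.* ε) (½ε>0 ε>0)
  ... | N , g = ½ ℚ.* ε , ½ε>0 ε>0 , M ℕ.⊔ N , λ n ≤n →
    ℚ-+-cancelʳ-< (½ ℚ.* ε) (0ℚ ℚ.+ ½ ℚ.* ε) (seq y n) (begin-strict
      0ℚ ℚ.+ ½ ℚ.* ε ℚ.+ ½ ℚ.* ε        ≡⟨ 0+½ε+½ε ε ⟩
      ε                                 ≡⟨ ℚₚ.+-identityˡ ε ⟨
      0ℚ ℚ.+ ε                          <⟨ f n (ℕₚ.m⊔n≤o⇒m≤o M N ≤n) ⟩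
      seq x n                           <⟨ ∣p-q∣<ε⇒p<q+ε (g n (ℕₚ.m⊔n≤o⇒n≤o M N ≤n)) ⟩
      seq y n ℚ.+ ½ ℚ.* ε               ∎)
    where open ℚₚ.≤-Reasoning

  opaque
    unfolding _⊕_

    >0-⊕ : ∀ {x y} → 0ᴿ <ᴿ x → 0ᴿ <ᴿ y → 0ᴿ <ᴿ x ⊕ y
    >0-⊕ {x} {y} (ε , ε>0 , M , f) (δ , δ>0 , N , g) =
      ε ℚ.+ δ , ℚₚ.+-mono-< ε>0 δ>0 , M ℕ.⊔ N , λ n ≤n →
        subst (ℚ._< seq x n ℚ.+ seq y n)
          (trans (cong₂ ℚ._+_ (ℚₚ.+-identityˡ ε) (ℚₚ.+-identityˡ δ)) (sym (ℚₚ.+-identityˡ (ε ℚ.+ δ))))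
          (ℚₚ.+-mono-< (f n (ℕₚ.m⊔n≤o⇒m≤o M N ≤n)) (g n (ℕₚ.m⊔n≤o⇒n≤o M N ≤n)))

  >0-⊗ : ∀ {x y} → 0ᴿ <ᴿ x → 0ᴿ <ᴿ y → 0ᴿ <ᴿ x ⊗ y
  >0-⊗ {x} {y} (ε , ε>0 , M , f) (δ , δ>0 , N , g) = subst (0ᴿ <ᴿ_) (sym (⊗-def x y))
    (ε ℚ.* δ , ℚₚ.positive⁻¹ (ε ℚ.* δ) , M ℕ.⊔ N , λ n ≤n → bound (seq x n) (seq y n)
      (f n (ℕₚ.m⊔n≤o⇒m≤o M N ≤n)) (g n (ℕₚ.m⊔n≤o⇒n≤o M N ≤n)))
    where
    open ℚₚ.≤-Reasoning
    instance
      _ = ℚ.positive ε>0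
      _ = ℚ.positive δ>0
      _ = ℚₚ.pos*pos⇒pos ε δ
    bound : ∀ p q → 0ℚ ℚ.+ ε ℚ.< p → 0ℚ ℚ.+ δ ℚ.< q → 0ℚ ℚ.+ ε ℚ.* δ ℚ.< p ℚ.* q
    bound p q hp hq = begin-strict
        0ℚ ℚ.+ ε ℚ.* δ ≡⟨ ℚₚ.+-identityˡ (ε ℚ.* δ) ⟩
        ε ℚ.* δ        <⟨ ℚₚ.*-monoˡ-<-pos δ ε<p ⟩
        p ℚ.* δ        <⟨ ℚₚ.*-monoʳ-<-pos p (subst (ℚ._< q) (ℚₚ.+-identityˡ δ) hq) ⟩
        p ℚ.* q        ∎
      where
      ε<p : ε ℚ.< p
      ε<p = subst (ℚ._< p) (ℚₚ.+-identityˡ ε) hp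
      instance _ = ℚ.positive (ℚₚ.<-trans ε>0 ε<p)

  -- By definition, `x ≈ᴿ y` is `Null (x -ᴿ y)`.
  Null : ℝ → Set
  Null z = ∀ ε → 0ℚ ℚ.< ε → ∃ λ N → ∀ n → N ℕ.≤ n → ℚ.∣ seq z n ∣ ℚ.< ε

  -- A comparison of rationals at one index N decides, if the terms from N on differ by less than
  -- ε/4. If the term at N is below ε/2 in absolute value, all later ones are below ε. If not, no
  -- later term can be below ε/4, so that z is not null; here only a contradiction is wanted, and
  -- the doubly negated hypothesis is enough.
  null-stable : ∀ z → ¬ ¬ Null z → Null z
  null-stable z ¬¬null ε ε>0 with cauchy z (½ ℚ.* (½ ℚ.* ε)) (½ε>0 (½ε>0 ε>0))
  ... | N , h with ℚ.∣ seq z N ∣ ℚₚ.<? ½ ℚ.* ε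
  ...   | yes small = N , λ n N≤n → begin-strict
      ℚ.∣ seq z n ∣                                    ≡⟨ cong ℚ.∣_∣ (p≡[p-q]+q (seq z n) (seq z N)) ⟩
      ℚ.∣ (seq z n ℚ.- seq z N) ℚ.+ seq z N ∣          ≤⟨ ℚₚ.∣p+q∣≤∣p∣+∣q∣ (seq z n ℚ.- seq z N) (seq z N) ⟩
      ℚ.∣ seq z n ℚ.- seq z N ∣ ℚ.+ ℚ.∣ seq z N ∣
        <⟨ ℚₚ.+-mono-< (ℚₚ.<-trans (h n N N≤n ℕₚ.≤-refl) (½ε<ε (½ε>0 ε>0))) small ⟩
      ½ ℚ.* ε ℚ.+ ½ ℚ.* ε                              ≡⟨ ½ε+½ε ε ⟩
      ε                                                ∎
    where open ℚₚ.≤-Reasoning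
  ...   | no large = ⊥-elim (¬¬null λ null →
    let M , f = null (½ ℚ.* (½ ℚ.* ε)) (½ε>0 (½ε>0 ε>0))
        n = M ℕ.⊔ N in
    large (begin-strict
      ℚ.∣ seq z N ∣                                    ≡⟨ cong ℚ.∣_∣ (p≡[p-q]+q (seq z N) (seq z n)) ⟩
      ℚ.∣ (seq z N ℚ.- seq z n) ℚ.+ seq z n ∣          ≤⟨ ℚₚ.∣p+q∣≤∣p∣+∣q∣ (seq z N ℚ.- seq z n) (seq z n) ⟩
      ℚ.∣ seq z N ℚ.- seq z n ∣ ℚ.+ ℚ.∣ seq z n ∣
        <⟨ ℚₚ.+-mono-< (h N n ℕₚ.≤-refl (ℕₚ.m≤n⊔m M N)) (f n (ℕₚ.m≤m⊔n M N)) ⟩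
      ½ ℚ.* (½ ℚ.* ε) ℚ.+ ½ ℚ.* (½ ℚ.* ε)              ≡⟨ ½ε+½ε (½ ℚ.* ε) ⟩
      ½ ℚ.* ε                                          ∎))
    where open ℚₚ.≤-Reasoning

  ≃-stable : ∀ {x y} → ¬ ¬ (x ≃ y) → x ≃ y
  ≃-stable {x} {y} ¬¬x≃y =
    mk≃ (null-stable (x -ᴿ y) (λ ¬null → ¬¬x≃y (λ x≃y → ¬null (approx x≃y))))

  -- As in `null-stable`, one late term is compared with ε/2. If it is smaller, the later terms lie
  -- below ε, and above -ε because x ≥ 0. If not, all later terms exceed ε/4, which would make x
  -- positive.
  ≥0∧≯0⇒≃0 : ∀ {x} → 0ᴿ ≤ᴿ x → ¬ (0ᴿ <ᴿ x) → x ≃ 0ᴿ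
  ≥0∧≯0⇒≃0 {x} x≥0 x≯0 = mk≃ approximate
    where
    approximate : x ≈ᴿ 0ᴿ
    approximate ε ε>0 with cauchy x (½ ℚ.* (½ ℚ.* ε)) (½ε>0 (½ε>0 ε>0)) | x≥0 ε ε>0
    ... | M , h | N , f with seq x M ℚₚ.<? ½ ℚ.* ε
    ...   | yes small = M ℕ.⊔ N , λ n ≤n → subst (λ p → ℚ.∣ p ∣ ℚ.< ε) (sym (ℚₚ.+-identityʳ (seq x n)))
      (∣p∣<ε {seq x n} (f n (ℕₚ.m⊔n≤o⇒n≤o M N ≤n)) (begin-strict
        seq x n                            <⟨ ∣p-q∣<ε⇒p<q+ε (h n M (ℕₚ.m⊔n≤o⇒m≤o M N ≤n) ℕₚ.≤-refl) ⟩
        seq x M ℚ.+ ½ ℚ.* (½ ℚ.* ε)        <⟨ ℚₚ.+-mono-< small (½ε<ε (½ε>0 ε>0)) ⟩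
        ½ ℚ.* ε ℚ.+ ½ ℚ.* ε                ≡⟨ ½ε+½ε ε ⟩
        ε                                  ∎))
      where
      open ℚₚ.≤-Reasoning
      ∣p∣<ε : ∀ {p} → 0ℚ ℚ.< p ℚ.+ ε → p ℚ.< ε → ℚ.∣ p ∣ ℚ.< ε
      ∣p∣<ε {p} 0<p+ε p<ε with ℚₚ.∣p∣≡p∨∣p∣≡-p p
      ... | inj₁ e = subst (ℚ._< ε) (sym e) p<ε
      ... | inj₂ e = subst (ℚ._< ε) (sym e) (begin-strict
        ℚ.- p                  ≡⟨ ℚₚ.+-identityʳ (ℚ.- p) ⟨
        ℚ.- p ℚ.+ 0ℚ           <⟨ ℚₚ.+-monoʳ-< (ℚ.- p) 0<p+ε ⟩
        ℚ.- p ℚ.+ (p ℚ.+ ε)    ≡⟨ ℚₚ.+-assoc (ℚ.- p) p ε ⟨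
        ℚ.- p ℚ.+ p ℚ.+ ε      ≡⟨ cong (ℚ._+ ε) (ℚₚ.+-inverseˡ p) ⟩
        0ℚ ℚ.+ ε               ≡⟨ ℚₚ.+-identityˡ ε ⟩
        ε                      ∎)
    ...   | no large = ⊥-elim (x≯0 (½ ℚ.* (½ ℚ.* ε) , ½ε>0 (½ε>0 ε>0) , M , λ n M≤n →
      ℚ-+-cancelʳ-< (½ ℚ.* (½ ℚ.* ε)) (0ℚ ℚ.+ ½ ℚ.* (½ ℚ.* ε)) (seq x n) (begin-strict
        0ℚ ℚ.+ ½ ℚ.* (½ ℚ.* ε) ℚ.+ ½ ℚ.* (½ ℚ.* ε)
          ≡⟨ 0+½ε+½ε (½ ℚ.* ε) ⟩
        ½ ℚ.* ε                          ≤⟨ ℚₚ.≮⇒≥ large ⟩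
        seq x M                          <⟨ ∣p-q∣<ε⇒p<q+ε (h M n ℕₚ.≤-refl M≤n) ⟩
        seq x n ℚ.+ ½ ℚ.* (½ ℚ.* ε)      ∎)))
      where open ℚₚ.≤-Reasoning

  ≤1⇒1-≥0 : ∀ {x} → x ≤ᴿ 1ᴿ → 0ᴿ ≤ᴿ 1ᴿ -ᴿ x
  ≤1⇒1-≥0 {x} x≤1 ε ε>0 with x≤1 ε ε>0
  ... | N , f = N , λ n N≤n → begin-strict
      0ℚ                               ≡⟨ ℚₚ.+-inverseʳ (seq x n) ⟨
      seq x n ℚ.- seq x n              <⟨ ℚₚ.+-monoˡ-< (ℚ.- seq x n) (f n N≤n) ⟩
      1ℚ ℚ.+ ε ℚ.- seq x n             ≡⟨ ℚₚ.+-assoc 1ℚ ε (ℚ.- seq x n) ⟩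
      1ℚ ℚ.+ (ε ℚ.- seq x n)           ≡⟨ cong (1ℚ ℚ.+_) (ℚₚ.+-comm ε (ℚ.- seq x n)) ⟩
      1ℚ ℚ.+ (ℚ.- seq x n ℚ.+ ε)       ≡⟨ ℚₚ.+-assoc 1ℚ (ℚ.- seq x n) ε ⟨
      1ℚ ℚ.- seq x n ℚ.+ ε             ∎
    where open ℚₚ.≤-Reasoning

  -- Classically, x ≥ 0.  Unlike _≤ᴿ_, this form is closed under products for trivial reasons.
  NonNegative : ℝ → Set
  NonNegative x = ¬ ¬ (x ≃ 0ᴿ ⊎ 0ᴿ <ᴿ x)

  ≥0⇒nonNegative : ∀ x → 0ᴿ ≤ᴿ x → NonNegative x
  ≥0⇒nonNegative x x≥0 k = k (inj₁ (≥0∧≯0⇒≃0 {x} x≥0 (k ∘ inj₂)))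

  nonNegative-resp-≃ : ∀ {x y} → x ≃ y → NonNegative x → NonNegative y
  nonNegative-resp-≃ x≃y nx k = nx λ where
    (inj₁ x≃0) → k (inj₁ (≃-trans (≃-sym x≃y) x≃0))
    (inj₂ x>0) → k (inj₂ (>0-resp-≃ x≃y x>0))

  0-nonNegative : NonNegative 0ᴿ
  0-nonNegative k = k (inj₁ ≃-refl)

  1-nonNegative : NonNegative 1ᴿ
  1-nonNegative k = k (inj₂ (½ , ℚₚ.positive⁻¹ ½ , 0 , λ _ _ → ℚ.*<* (ℤ.+<+ (ℕ.s≤s (ℕ.s≤s ℕ.z≤n)))))

  +-nonNegative : ∀ {x y} → NonNegative x → NonNegative y → NonNegative (x ⊕ y)
  +-nonNegative {x} {y} nx ny k = nx λ where
    (inj₁ x≃0) → nonNegative-resp-≃ (≃-trans (≃-sym (R.+-identityˡ y)) (R.+-congʳ (≃-sym x≃0))) ny k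
    (inj₂ x>0) → ny λ where
      (inj₁ y≃0) → k (inj₂ (>0-resp-≃ (≃-trans (≃-sym (R.+-identityʳ x)) (R.+-congˡ (≃-sym y≃0))) x>0))
      (inj₂ y>0) → k (inj₂ (>0-⊕ {x} {y} x>0 y>0))

  *-nonNegative : ∀ {x y} → NonNegative x → NonNegative y → NonNegative (x ⊗ y)
  *-nonNegative {x} {y} nx ny k = nx λ where
    (inj₁ x≃0) → k (inj₁ (≃-trans (R.*-congʳ x≃0) (R.zeroˡ y)))
    (inj₂ x>0) → ny λ where
      (inj₁ y≃0) → k (inj₁ (≃-trans (R.*-congˡ y≃0) (R.zeroʳ x)))
      (inj₂ y>0) → k (inj₂ (>0-⊗ {x} {y} x>0 y>0))

-- Finite sets of integers, their parts and their blocks.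

module Sets where
  open import Data.Integer using (pred; _≤_; _<_)
  open Sums

  -- The field of `finSet` is irrelevant, but monotonicity of a list of integers is decidable and
  -- can therefore be recomputed.
  increasing : ∀ S → AllPairs _<_ (elements S)
  increasing (finSet xs inc) = recompute (AllPairs.allPairs? ℤₚ._<?_ xs) inc

  unique : ∀ S → Unique (elements S)
  unique S = AllPairs.map ℤₚ.<⇒≢ (increasing S)

  elements-injective : ∀ {S T} → elements S ≡ elements T → S ≡ T
  elements-injective {finSet _ _} {finSet _ _} refl = refl

  increasing-ext : ∀ {xs ys} → AllPairs _<_ xs → AllPairs _<_ ys →
    (∀ x → x Mem.∈ xs → x Mem.∈ ys) → (∀ x → x Mem.∈ ys → x Mem.∈ xs) → xs ≡ ys
  increasing-ext {[]}     {[]}     _ _ _ _ = refl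
  increasing-ext {[]}     {y ∷ ys} _ _ _ g with g y (here refl)
  ... | ()
  increasing-ext {x ∷ xs} {[]}     _ _ f _ with f x (here refl)
  ... | ()
  increasing-ext {x ∷ xs} {y ∷ ys} (x< ∷ inc) (y< ∷ jnc) f g = cong₂ _∷_ x≡y
    (increasing-ext inc jnc (tail x< x≡y f) (tail y< (sym x≡y) g))
    where
    ≥head : ∀ {x y ys} → All (y <_) ys → x Mem.∈ (y ∷ ys) → y ≤ x
    ≥head y< (here refl) = ℤₚ.≤-refl
    ≥head y< (there x∈)  = ℤₚ.<⇒≤ (All.lookup y< x∈)

    x≡y : x ≡ y
    x≡y = ℤₚ.≤-antisym (≥head x< (g y (here refl))) (≥head y< (f x (here refl)))

    tail : ∀ {x y xs ys} → All (x <_) xs → x ≡ y → (∀ z → z Mem.∈ (x ∷ xs) → z Mem.∈ (y ∷ ys)) →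
           ∀ z → z Mem.∈ xs → z Mem.∈ ys
    tail x< refl f z z∈ with f z (there z∈)
    ... | here refl = ⊥-elim (ℤₚ.<-irrefl refl (All.lookup x< z∈))
    ... | there z∈′ = z∈′

  FinSet-ext : ∀ {S T} → (∀ x → x ∈ S → x ∈ T) → (∀ x → x ∈ T → x ∈ S) → S ≡ T
  FinSet-ext {S} {T} f g = elements-injective (increasing-ext (increasing S) (increasing T) f g)

  sideˢ : (ℤ → Bool) → Bool → FinSet → FinSet
  sideˢ σ β (finSet xs inc) = finSet (side σ β xs) (AllPairsₚ.filter⁺ (λ x → σ x Boolₚ.≟ β) inc)

  remove : ℤ → FinSet → FinSet
  remove b (finSet xs inc) = finSet (filter (λ x → ¬? (x ℤ.≟ b)) xs) (AllPairsₚ.filter⁺ (λ x → ¬? (x ℤ.≟ b)) inc)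

  ∈-sideˢ⁺ : ∀ σ {β x} S → x ∈ S → σ x ≡ β → x ∈ sideˢ σ β S
  ∈-sideˢ⁺ σ {β} S = Memₚ.∈-filter⁺ (λ x → σ x Boolₚ.≟ β)

  ∈-sideˢ⁻ : ∀ σ {β x} S → x ∈ sideˢ σ β S → x ∈ S × σ x ≡ β
  ∈-sideˢ⁻ σ {β} S = Memₚ.∈-filter⁻ (λ x → σ x Boolₚ.≟ β) {xs = elements S}

  ∈-remove⁺ : ∀ {b x} S → x ∈ S → x ≢ b → x ∈ remove b S
  ∈-remove⁺ {b} S = Memₚ.∈-filter⁺ (λ x → ¬? (x ℤ.≟ b))

  ∈-remove⁻ : ∀ {b x} S → x ∈ remove b S → x ∈ S × x ≢ b
  ∈-remove⁻ {b} S = Memₚ.∈-filter⁻ (λ x → ¬? (x ℤ.≟ b)) {xs = elements S}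

  ∉-remove : ∀ b S → b ∉ remove b S
  ∉-remove b S b∈ = proj₂ (∈-remove⁻ S b∈) refl

  ∈-insert⁻ : ∀ {b x} S → x ∈ insert b S → x ≡ b ⊎ x ∈ S
  ∈-insert⁻ {b} S x∈ =
    All.lookup (insertᴸ-All {λ x → x ≡ b ⊎ x ∈ S} (inj₁ refl) (All.tabulate {xs = elements S} inj₂)) x∈

  ∈-insert-new : ∀ b S → b ∈ insert b S
  ∈-insert-new b S = insertᴸ-new b (elements S)

  ∈-insert-old : ∀ b {x} S → x ∈ S → x ∈ insert b S
  ∈-insert-old b S = insertᴸ-old b

  insert-remove : ∀ {b} S → b ∈ S → insert b (remove b S) ≡ S
  insert-remove {b} S b∈ = FinSet-ext to from
    where
    to : ∀ x → x ∈ insert b (remove b S) → x ∈ S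
    to x x∈ with ∈-insert⁻ (remove b S) x∈
    ... | inj₁ refl = b∈
    ... | inj₂ x∈′  = proj₁ (∈-remove⁻ S x∈′)
    from : ∀ x → x ∈ S → x ∈ insert b (remove b S)
    from x x∈ with x ℤ.≟ b
    ... | yes refl = ∈-insert-new b (remove b S)
    ... | no x≢b   = ∈-insert-old b (remove b S) (∈-remove⁺ S x∈ x≢b)

  remove-insert : ∀ {b} S → b ∉ S → remove b (insert b S) ≡ S
  remove-insert {b} S b∉ = FinSet-ext to from
    where
    to : ∀ x → x ∈ remove b (insert b S) → x ∈ S
    to x x∈ with ∈-remove⁻ (insert b S) x∈
    ... | x∈′ , x≢b with ∈-insert⁻ S x∈′
    ...   | inj₁ x≡b = ⊥-elim (x≢b x≡b)
    ...   | inj₂ x∈S = x∈S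
    from : ∀ x → x ∈ S → x ∈ remove b (insert b S)
    from x x∈ = ∈-remove⁺ (insert b S) (∈-insert-old b S x∈) (λ { refl → b∉ x∈ })

  sideˢ-remove : ∀ σ {β} b S → sideˢ σ β (remove b S) ≡ remove b (sideˢ σ β S)
  sideˢ-remove σ {β} b S = FinSet-ext
    (λ x x∈ → let x∈′ , e = ∈-sideˢ⁻ σ (remove b S) x∈ ; x∈S , x≢b = ∈-remove⁻ S x∈′ in
              ∈-remove⁺ (sideˢ σ β S) (∈-sideˢ⁺ σ S x∈S e) x≢b)
    (λ x x∈ → let x∈′ , x≢b = ∈-remove⁻ (sideˢ σ β S) x∈ ; x∈S , e = ∈-sideˢ⁻ σ S x∈′ in
              ∈-sideˢ⁺ σ (remove b S) (∈-remove⁺ S x∈S x≢b) e)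

  sideˢ-remove-≢ : ∀ σ {β} b S → σ b ≢ β → sideˢ σ β (remove b S) ≡ sideˢ σ β S
  sideˢ-remove-≢ σ {β} b S σb≢ = FinSet-ext
    (λ x x∈ → let x∈′ , e = ∈-sideˢ⁻ σ (remove b S) x∈ in ∈-sideˢ⁺ σ S (proj₁ (∈-remove⁻ S x∈′)) e)
    (λ x x∈ → let x∈S , e = ∈-sideˢ⁻ σ S x∈ in
              ∈-sideˢ⁺ σ (remove b S) (∈-remove⁺ S x∈S (λ { refl → σb≢ e })) e)

  -- Maximality amounts to the two neighbouring spots being free, since a larger interval inside S
  -- would contain one of them.
  isBlockOf : ∀ {S a s t} → s ≤ a → a ≤ t → Within s t S → pred s ∉ S → sucℤ t ∉ S → IsBlockOf S a s t
  isBlockOf {S} {a} {s} {t} s≤a a≤t within s-1∉ t+1∉ = record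
    { isBlock = record
      { nonempty = ℤₚ.≤-trans s≤a a≤t
      ; within   = within
      ; maximal  = λ s′ t′ s′≤s t≤t′ h → left-end s′ t′ s′≤s t≤t′ h , right-end s′ t′ s′≤s t≤t′ h
      }
    ; lower = s≤a
    ; upper = a≤t
    }
    where
    left-end : ∀ s′ t′ → s′ ≤ s → t ≤ t′ → Within s′ t′ S → s′ ≡ s
    left-end s′ t′ s′≤s t≤t′ h with s′ ℤ.≟ s
    ... | yes e = e
    ... | no ≢  = ⊥-elim (s-1∉ (h (pred s) (ℤₚ.i<j⇒i≤pred[j] (ℤₚ.≤∧≢⇒< s′≤s ≢))
                    (ℤₚ.≤-trans (ℤₚ.<⇒≤ (ℤₚ.i≤pred[j]⇒i<j ℤₚ.≤-refl))
                      (ℤₚ.≤-trans s≤a (ℤₚ.≤-trans a≤t t≤t′)))))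
    right-end : ∀ s′ t′ → s′ ≤ s → t ≤ t′ → Within s′ t′ S → t′ ≡ t
    right-end s′ t′ s′≤s t≤t′ h with t ℤ.≟ t′
    ... | yes e = sym e
    ... | no ≢  = ⊥-elim (t+1∉ (h (sucℤ t)
                    (ℤₚ.≤-trans s′≤s (ℤₚ.≤-trans s≤a (ℤₚ.≤-trans a≤t (ℤₚ.i≤suc[i] t))))
                    (ℤₚ.i<j⇒suc[i]≤j (ℤₚ.≤∧≢⇒< t≤t′ ≢))))

  sucℤ-+ : ∀ s n → sucℤ s ℤ.+ + n ≡ s ℤ.+ + suc n
  sucℤ-+ s n = trans (cong (ℤ._+ + n) (ℤₚ.+-comm (+ 1) s)) (ℤₚ.+-assoc s (+ 1) (+ n))

  <sucℤ⇒≤ : ∀ {i j} → i < sucℤ j → i ≤ j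
  <sucℤ⇒≤ {i} {j} i<j+1 = subst (i ≤_) (ℤₚ.pred-suc j) (ℤₚ.i<j⇒i≤pred[j] i<j+1)

  pred< : ∀ i → pred i < i
  pred< i = ℤₚ.i≤pred[j]⇒i<j ℤₚ.≤-refl

  ∈-consecutive⁻ : ∀ s n {x} → x Mem.∈ consecutive s n → s ≤ x × x < s ℤ.+ + n
  ∈-consecutive⁻ s (suc n) (here refl) = ℤₚ.≤-refl ,
    ℤₚ.<-≤-trans (i<suc s) (subst (sucℤ s ≤_) (sucℤ-+ s n) (ℤₚ.i≤i+j (sucℤ s) (+ n)))
  ∈-consecutive⁻ s (suc n) {x} (there x∈) with ∈-consecutive⁻ (sucℤ s) n x∈
  ... | s< , x< = ℤₚ.≤-trans (ℤₚ.i≤suc[i] s) s< , subst (x <_) (sucℤ-+ s n) x<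

  ∈-consecutive⁺ : ∀ s n {x} → s ≤ x → x < s ℤ.+ + n → x Mem.∈ consecutive s n
  ∈-consecutive⁺ s zero {x} s≤x x< =
    ⊥-elim (ℤₚ.<-irrefl refl (ℤₚ.<-≤-trans (subst (x <_) (ℤₚ.+-identityʳ s) x<) s≤x))
  ∈-consecutive⁺ s (suc n) {x} s≤x x< with s ℤ.≟ x
  ... | yes refl = here refl
  ... | no s≢x   = there (∈-consecutive⁺ (sucℤ s) n (ℤₚ.i<j⇒suc[i]≤j (ℤₚ.≤∧≢⇒< s≤x s≢x))
                     (subst (x <_) (sym (sucℤ-+ s n)) x<))

  s+[t-s]≡t : ∀ s t → s ℤ.+ (t ℤ.- s) ≡ t
  s+[t-s]≡t s t = trans (ℤₚ.+-comm s (t ℤ.- s)) (trans (ℤₚ.+-assoc t (ℤ.- s) s)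
    (trans (cong (λ u → t ℤ.+ u) (ℤₚ.+-inverseˡ s)) (ℤₚ.+-identityʳ t)))

  ∈-interval⁻ : ∀ s t {x} → x ∈ interval s t → s ≤ x × x ≤ t
  ∈-interval⁻ s t {x} x∈ with sucℤ t ℤ.- s in eq
  ... | + n with ∈-consecutive⁻ s n x∈
  ...   | s≤x , x<s+n = s≤x , <sucℤ⇒≤ (subst (x <_)
    (trans (cong (λ u → s ℤ.+ u) (sym eq)) (s+[t-s]≡t s (sucℤ t))) x<s+n)

  ∈-interval⁺ : ∀ s t {x} → s ≤ x → x ≤ t → x ∈ interval s t
  ∈-interval⁺ s t {x} s≤x x≤t with sucℤ t ℤ.- s in eq
  ... | + n = ∈-consecutive⁺ s n s≤x (subst (x <_)
    (sym (trans (cong (λ u → s ℤ.+ u) (sym eq)) (s+[t-s]≡t s (sucℤ t)))) (ℤₚ.≤-<-trans x≤t (i<suc t)))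
  ... | -[1+ _ ] with subst (+ 0 ≤_) eq (ℤₚ.i≤j⇒0≤j-i (ℤₚ.≤-trans s≤x (ℤₚ.≤-trans x≤t (ℤₚ.i≤suc[i] t))))
  ...   | ()

-- Parking probabilities as expectations, and their recursion on the last car.

module Parking where
  open import Data.Integer using (pred)
  open Sums
  open Reals
  open Sets
  open Summation R.commutativeSemiring
  open SetoidReasoning R.setoid

  sumᴿ≃∑ : ∀ {A : Set} (xs : List A) f → sumᴿ (map f xs) ≃ ∑ xs f
  sumᴿ≃∑ []       f = R.refl
  sumᴿ≃∑ (x ∷ xs) f = R.trans (R.reflexive (sym (⊕-def (f x) _))) (R.+-congˡ (sumᴿ≃∑ xs f))

  ∑-nonNegative : ∀ {A : Set} (xs : List A) {f} → (∀ x → NonNegative (f x)) → NonNegative (∑ xs f)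
  ∑-nonNegative []       _  = 0-nonNegative
  ∑-nonNegative (x ∷ xs) nf = +-nonNegative (nf x) (∑-nonNegative xs nf)

  []-nonNegative : ∀ {A : Set} (d : Dec A) → NonNegative [ d ]
  []-nonNegative d@(yes x) = nonNegative-resp-≃ (R.sym ([]-yes d x)) 1-nonNegative
  []-nonNegative d@(no ¬x) = nonNegative-resp-≃ (R.sym ([]-no d ¬x)) 0-nonNegative

  module _ (P : ParkingProcedure) where

    -- The expected value of f at the vertex reached from v by reading U.
    𝔼 : Vertex → Word → (Vertex → ℝ) → ℝ
    𝔼 v []      f = f v
    𝔼 v (a ∷ U) f = ∑ (edges v a) (λ (v′ , e) → edgeWeight P e ⊗ 𝔼 v′ U f)

    𝔼-++ : ∀ v U V f → 𝔼 v (U ++ V) f ≃ 𝔼 v U (λ v′ → 𝔼 v′ V f)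
    𝔼-++ v []      V f = R.refl
    𝔼-++ v (a ∷ U) V f = ∑-cong (edges v a) (λ (v′ , e) _ → R.*-congˡ (𝔼-++ v′ U V f))

    -- Every vertex reached from v by reading U has the word `word v ++ U`, so only these vertices
    -- matter. This allows the word to be fixed, for instance when `_≟ᵛ_` is reduced to `_≟ˢ_`.
    𝔼-cong : ∀ v U {f g} → (∀ v′ → word v′ ≡ word v ++ U → f v′ ≃ g v′) → 𝔼 v U f ≃ 𝔼 v U g
    𝔼-cong v []      eq = eq v (sym (Listₚ.++-identityʳ (word v)))
    𝔼-cong v (a ∷ U) eq = ∑-cong (edges v a) (λ (v′ , e) e∈ → R.*-congˡ (𝔼-cong v′ U (λ v″ w≡ →
      eq v″ (trans w≡ (trans (cong (_++ U) (edges-word v a e∈)) (Listₚ.∷ʳ-++ (word v) a U))))))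
      where
      edges-word : ∀ v a {v′} {e : Edge v v′} → (v′ , e) Mem.∈ edges v a → word v′ ≡ word v ∷ʳ a
      edges-word v a {e = e} e∈ = trans (edge-word e) (cong (word v ∷ʳ_) (edges-letter v a e∈))
        where
        edges-letter : ∀ v a {v′} {e : Edge v v′} → (v′ , e) Mem.∈ edges v a → letter e ≡ a
        edges-letter v a e∈ with a ∈? elements (set v)
        edges-letter v a (here refl)         | no _  = refl
        edges-letter v a (here refl)         | yes _ = refl
        edges-letter v a (there (here refl)) | yes _ = refl

    𝔼-zero : ∀ v U {f} → (∀ v′ → word v′ ≡ word v ++ U → f v′ ≃ 0ᴿ) → 𝔼 v U f ≃ 0ᴿ
    𝔼-zero v U eq = R.trans (𝔼-cong v U eq) (zero′ v U)
      where
      zero′ : ∀ v U → 𝔼 v U (λ _ → 0ᴿ) ≃ 0ᴿ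
      zero′ v []      = R.refl
      zero′ v (a ∷ U) = ∑-zero (edges v a) (λ (v′ , e) _ → R.trans (R.*-congˡ (zero′ v′ U)) (R.zeroʳ _))

    𝔼-∑ : ∀ {A : Set} v U (xs : List A) (f : A → Vertex → ℝ) →
          𝔼 v U (λ v′ → ∑ xs (λ x → f x v′)) ≃ ∑ xs (λ x → 𝔼 v U (f x))
    𝔼-∑ v []      xs f = R.refl
    𝔼-∑ v (a ∷ U) xs f = R.trans
      (∑-cong (edges v a) (λ (v′ , e) _ → R.trans (R.*-congˡ (𝔼-∑ v′ U xs f)) (*-∑ _ xs _)))
      (∑-swap (edges v a) xs (λ (v′ , e) x → edgeWeight P e ⊗ 𝔼 v′ U (f x)))

    𝔼-* : ∀ v U f c → 𝔼 v U (λ v′ → f v′ ⊗ c) ≃ 𝔼 v U f ⊗ c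
    𝔼-* v []      f c = R.refl
    𝔼-* v (a ∷ U) f c = R.trans
      (∑-cong (edges v a) (λ (v′ , e) _ → R.trans (R.*-congˡ (𝔼-* v′ U f c)) (R.sym (R.*-assoc _ _ c))))
      (R.sym (∑-* c (edges v a) _))

    edgeWeight-nonNegative : ∀ {v w} (e : Edge v w) → NonNegative (edgeWeight P e)
    edgeWeight-nonNegative     (free _ _)      = 1-nonNegative
    edgeWeight-nonNegative {v} (right a _ _ b) = ≥0⇒nonNegative (Dir P v a _) (Dir≥0 P v a (IsBlockOf.member b))
    edgeWeight-nonNegative {v} (left a _ _ b)  =
      ≥0⇒nonNegative (1ᴿ -ᴿ Dir P v a _) (≤1⇒1-≥0 {Dir P v a _} (Dir≤1 P v a (IsBlockOf.member b)))

    𝔼-nonNegative : ∀ v U {f} → (∀ v′ → NonNegative (f v′)) → NonNegative (𝔼 v U f)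
    𝔼-nonNegative v []      nf = nf v
    𝔼-nonNegative v (a ∷ U) nf = ∑-nonNegative (edges v a) (λ (v′ , e) →
      *-nonNegative (edgeWeight-nonNegative e) (𝔼-nonNegative v′ U nf))

    -- Only the set is tested, as reading W from `origin` already fixes the word. In contrast to
    -- `𝒫`, no decision whether (W, S) is a vertex enters the definition; `ℙ-nonvertex` recovers the
    -- value 0.
    ℙ : Word → FinSet → ℝ
    ℙ W S = 𝔼 origin W (λ v → [ set v ≟ˢ S ])

    ℙ-nonNegative : ∀ W S → NonNegative (ℙ W S)
    ℙ-nonNegative W S = 𝔼-nonNegative origin W (λ v → []-nonNegative (set v ≟ˢ S))

    paths≃𝔼 : ∀ v U w → ∑ (paths v U w) (pathWeight P) ≃ 𝔼 v U (λ v′ → [ v′ ≟ᵛ w ])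
    paths≃𝔼 v [] w with v ≟ᵛ w
    ... | yes refl = R.trans (R.+-identityʳ 1ᴿ) (R.sym ([]-yes (yes refl) refl))
    ... | no v≢w   = R.sym ([]-no (no v≢w) v≢w)
    paths≃𝔼 v (a ∷ U) w = R.trans
      (∑-concatMap (λ (v′ , e) → map (e ◅_) (paths v′ U w)) (edges v a) (pathWeight P))
      (∑-cong (edges v a) (λ (v′ , e) _ → begin
        ∑ (map (e ◅_) (paths v′ U w)) (pathWeight P)
          ≡⟨ ∑-map (e ◅_) (paths v′ U w) (pathWeight P) ⟩
        ∑ (paths v′ U w) (λ q → edgeWeight P e *ᴿ pathWeight P q)
          ≈⟨ ∑-cong (paths v′ U w) (λ q _ → R.reflexive (sym (⊗-def (edgeWeight P e) (pathWeight P q)))) ⟩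
        ∑ (paths v′ U w) (λ q → edgeWeight P e ⊗ pathWeight P q)
          ≈⟨ *-∑ (edgeWeight P e) (paths v′ U w) (pathWeight P) ⟨
        edgeWeight P e ⊗ ∑ (paths v′ U w) (pathWeight P)
          ≈⟨ R.*-congˡ (paths≃𝔼 v′ U w) ⟩
        edgeWeight P e ⊗ 𝔼 v′ U (λ v″ → [ v″ ≟ᵛ w ]) ∎))

    isVertex : ∀ v → IsVertex (word v) (set v)
    isVertex (vertex W S q) = recompute (isVertex? W S) q

    ℙ-nonvertex : ∀ W S → ¬ IsVertex W S → ℙ W S ≃ 0ᴿ
    ℙ-nonvertex W S ¬q = 𝔼-zero origin W (λ v w≡ → []-no (set v ≟ˢ S)
      (λ s≡ → ¬q (subst (λ V → IsVertex V S) w≡ (subst (IsVertex (word v)) s≡ (isVertex v)))))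

    𝒫≃ℙ : ∀ W S → 𝒫 P W S ≃ ℙ W S
    𝒫≃ℙ W S with isVertex? W S
    ... | no ¬q = R.sym (ℙ-nonvertex W S ¬q)
    ... | yes q = R.trans (sumᴿ≃∑ (paths origin W (vertex W S q)) (pathWeight P))
      (R.trans (paths≃𝔼 origin W (vertex W S q)) (𝔼-cong origin W λ where
        (vertex _ S′ _) refl → []-⇔ (_ ≟ᵛ _) (S′ ≟ˢ S) (λ { refl → refl }) (λ { refl → refl })))

    opaque
      -- `Dir` made total, so that W and S can be rewritten without transporting proofs. The default
      -- 0 does no harm: `step` consults `dir` only when a lies in S, and `ℙ` vanishes at pairs that
      -- are not vertices.
      dir : Word → FinSet → ℤ → ℝ
      dir W S a with isVertex? W S | a ∈? elements S
      ... | yes q | yes a∈ = Dir P (vertex W S q) a a∈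
      ... | _     | _      = 0ᴿ

      Dir≃dir : ∀ v a .(a∈ : a ∈ set v) → Dir P v a a∈ ≡ dir (word v) (set v) a
      Dir≃dir (vertex W S q) a a∈ with isVertex? W S | a ∈? elements S
      ... | yes _ | yes _  = refl
      ... | yes _ | no a∉  = ⊥-elim-irr (a∉ a∈)
      ... | no ¬q | _      = ⊥-elim-irr (¬q q)

    -- The block is an argument, so that `turn-block` can replace the one found by `blockOf` with
    -- any block already at hand.
    turn : Word → (S : FinSet) (a : ℤ) → (∃ λ s → ∃ λ t → IsBlockOf S a s t) → ℤ → ℝ
    turn W S a (s , t , _) b =
      dir W S a ⊗ [ b ℤ.≟ sucℤ t ] ⊕ (1ᴿ ⊕ ⊖ dir W S a) ⊗ [ b ℤ.≟ pred s ]

    -- The probability that a car preferring a parks at b when W has parked on S.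
    step : Word → FinSet → ℤ → ℤ → ℝ
    step W S a b with a ∈? elements S
    ... | no _   = [ b ℤ.≟ a ]
    ... | yes a∈ = turn W S a (blockOf S a a∈) b

    step-free : ∀ W S {a} b → a ∉ S → step W S a b ≡ [ b ℤ.≟ a ]
    step-free W S {a} b a∉ with a ∈? elements S
    ... | no _   = refl
    ... | yes a∈ = ⊥-elim (a∉ a∈)

    turn-block : ∀ W S {a s t} b → IsBlockOf S a s t → ∀ c →
      turn W S a c b ≡ dir W S a ⊗ [ b ℤ.≟ sucℤ t ] ⊕ (1ᴿ ⊕ ⊖ dir W S a) ⊗ [ b ℤ.≟ pred s ]
    turn-block W S b bl (_ , _ , bl′) with block-unique bl bl′
    ... | refl , refl = refl

    step-block : ∀ W S {a s t} b → IsBlockOf S a s t →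
      step W S a b ≡ dir W S a ⊗ [ b ℤ.≟ sucℤ t ] ⊕ (1ᴿ ⊕ ⊖ dir W S a) ⊗ [ b ℤ.≟ pred s ]
    step-block W S {a} b bl with a ∈? elements S
    ... | no a∉  = ⊥-elim (a∉ (IsBlockOf.member bl))
    ... | yes a∈ = turn-block W S b bl (blockOf S a a∈)

    -- Reaching T by filling b₀ means that b₀ lies in T and that S is T without b₀, so at most this
    -- term of the sum is nonzero. It brings all three kinds of edges into one form, a sum over the
    -- spot filled last.
    insert-∑ : ∀ {b₀} S T → b₀ ∉ S →
      [ insert b₀ S ≟ˢ T ] ≃ ∑ (elements T) (λ b → [ S ≟ˢ remove b T ] ⊗ [ b ℤ.≟ b₀ ])
    insert-∑ {b₀} S T b₀∉ with b₀ ∈? elements T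
    ... | no b₀∉T = R.trans
        ([]-no (insert b₀ S ≟ˢ T) (λ { refl → b₀∉T (∈-insert-new b₀ S) }))
        (R.sym (∑-zero (elements T) (λ b b∈ →
          R.trans (R.*-congˡ ([]-no (b ℤ.≟ b₀) (λ { refl → b₀∉T b∈ }))) (R.zeroʳ _))))
    ... | yes b₀∈T = begin
        [ insert b₀ S ≟ˢ T ]
          ≈⟨ []-⇔ (insert b₀ S ≟ˢ T) (S ≟ˢ remove b₀ T)
               (λ { refl → sym (remove-insert S b₀∉) }) (λ { refl → insert-remove T b₀∈T }) ⟩
        [ S ≟ˢ remove b₀ T ]                         ≈⟨ R.*-identityʳ _ ⟨
        [ S ≟ˢ remove b₀ T ] ⊗ 1ᴿ                    ≈⟨ R.*-congˡ ([]-yes (b₀ ℤ.≟ b₀) refl) ⟨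
        [ S ≟ˢ remove b₀ T ] ⊗ [ b₀ ℤ.≟ b₀ ]
          ≈⟨ ∑-single (unique T) b₀ b₀∈T (λ b _ b≢ →
               R.trans (R.*-congˡ ([]-no (b ℤ.≟ b₀) b≢)) (R.zeroʳ _)) ⟨
        ∑ (elements T) (λ b → [ S ≟ˢ remove b T ] ⊗ [ b ℤ.≟ b₀ ]) ∎

    𝔼-turns : ∀ v a T c →
      ∑ (turns v a c) (λ (v′ , e) → edgeWeight P e ⊗ [ set v′ ≟ˢ T ]) ≃
      ∑ (elements T) (λ b → [ set v ≟ˢ remove b T ] ⊗ turn (word v) (set v) a c b)
    𝔼-turns v a T (s , t , bl) = begin
      Dir P v a _ ⊗ χ (sucℤ t) ⊕ ((1ᴿ -ᴿ Dir P v a _) ⊗ χ (pred s) ⊕ 0ᴿ)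
        ≈⟨ R.+-congˡ (R.trans (R.+-identityʳ _) (R.*-congʳ (R.reflexive minus))) ⟩
      Dir P v a _ ⊗ χ (sucℤ t) ⊕ (1ᴿ ⊕ ⊖ Dir P v a _) ⊗ χ (pred s)
        ≡⟨ cong (λ d → d ⊗ χ (sucℤ t) ⊕ (1ᴿ ⊕ ⊖ d) ⊗ χ (pred s)) (Dir≃dir v a (IsBlockOf.member bl)) ⟩
      d ⊗ χ (sucℤ t) ⊕ (1ᴿ ⊕ ⊖ d) ⊗ χ (pred s)
        ≈⟨ R.+-cong (R.*-congˡ (insert-∑ (set v) T (IsBlockOf.suc-t∉ bl)))
                    (R.*-congˡ (insert-∑ (set v) T (IsBlockOf.pred-s∉ bl))) ⟩
      d ⊗ ∑ (elements T) (λ b → ρ b ⊗ [ b ℤ.≟ sucℤ t ])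
        ⊕ (1ᴿ ⊕ ⊖ d) ⊗ ∑ (elements T) (λ b → ρ b ⊗ [ b ℤ.≟ pred s ])
        ≈⟨ R.+-cong (*-∑ d (elements T) _) (*-∑ (1ᴿ ⊕ ⊖ d) (elements T) _) ⟩
      ∑ (elements T) (λ b → d ⊗ (ρ b ⊗ [ b ℤ.≟ sucℤ t ]))
        ⊕ ∑ (elements T) (λ b → (1ᴿ ⊕ ⊖ d) ⊗ (ρ b ⊗ [ b ℤ.≟ pred s ]))
        ≈⟨ ∑-+ (elements T) _ _ ⟨
      ∑ (elements T) (λ b → d ⊗ (ρ b ⊗ [ b ℤ.≟ sucℤ t ]) ⊕ (1ᴿ ⊕ ⊖ d) ⊗ (ρ b ⊗ [ b ℤ.≟ pred s ]))
        ≈⟨ ∑-cong (elements T) (λ b _ → R.trans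
             (R.+-cong (x∙yz≈y∙xz d (ρ b) _) (x∙yz≈y∙xz (1ᴿ ⊕ ⊖ d) (ρ b) _))
             (R.sym (R.distribˡ (ρ b) _ _))) ⟩
      ∑ (elements T) (λ b → ρ b ⊗ turn (word v) (set v) a (s , t , bl) b) ∎
      where
      open CommutativeSemigroupProperties R.*-commutativeSemigroup using (x∙yz≈y∙xz)
      χ : ℤ → ℝ
      χ b = [ insert b (set v) ≟ˢ T ]
      ρ : ℤ → ℝ
      ρ b = [ set v ≟ˢ remove b T ]
      d = dir (word v) (set v) a
      minus : 1ᴿ -ᴿ Dir P v a (IsBlockOf.member bl) ≡ 1ᴿ ⊕ ⊖ Dir P v a (IsBlockOf.member bl)
      minus = sym (trans (⊕-def 1ᴿ _) (cong (1ᴿ +ᴿ_) (⊖-def (Dir P v a (IsBlockOf.member bl)))))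

    𝔼-edge : ∀ v a T → 𝔼 v (a ∷ []) (λ v′ → [ set v′ ≟ˢ T ]) ≃
             ∑ (elements T) (λ b → [ set v ≟ˢ remove b T ] ⊗ step (word v) (set v) a b)
    𝔼-edge v a T with a ∈? elements (set v)
    ... | no a∉  = R.trans (R.+-identityʳ _) (R.trans (R.*-identityˡ _) (insert-∑ (set v) T a∉))
    ... | yes a∈ = 𝔼-turns v a T (blockOf (set v) a a∈)

    -- `𝔼` consumes a word from the left, and `𝔼-++` exposes its last letter. If the last car takes
    -- b, the earlier ones occupy `remove b S`; the indicator of this event lets `set v` be replaced
    -- by that constant set, whereupon `step` leaves the expectation.
    ℙ-∷ʳ : ∀ W a S →
      ℙ (W ∷ʳ a) S ≃ ∑ (elements S) (λ b → ℙ W (remove b S) ⊗ step W (remove b S) a b)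
    ℙ-∷ʳ W a S = begin
      ℙ (W ∷ʳ a) S
        ≈⟨ 𝔼-++ origin W (a ∷ []) _ ⟩
      𝔼 origin W (λ v → 𝔼 v (a ∷ []) (λ v′ → [ set v′ ≟ˢ S ]))
        ≈⟨ 𝔼-cong origin W (λ { v refl → R.trans (𝔼-edge v a S) (∑-cong (elements S) (λ b _ → ρ-step v b)) }) ⟩
      𝔼 origin W (λ v → ∑ (elements S) (λ b → [ set v ≟ˢ remove b S ] ⊗ step W (remove b S) a b))
        ≈⟨ 𝔼-∑ origin W (elements S) _ ⟩
      ∑ (elements S) (λ b → 𝔼 origin W (λ v → [ set v ≟ˢ remove b S ] ⊗ step W (remove b S) a b))
        ≈⟨ ∑-cong (elements S) (λ b _ → 𝔼-* origin W _ _) ⟩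
      ∑ (elements S) (λ b → ℙ W (remove b S) ⊗ step W (remove b S) a b) ∎
      where
      ρ-step : ∀ v b → [ set v ≟ˢ remove b S ] ⊗ step (word v) (set v) a b ≃
                       [ set v ≟ˢ remove b S ] ⊗ step (word v) (remove b S) a b
      ρ-step v b = []-⊗-cong (set v ≟ˢ remove b S) (λ e → cong (λ T → step (word v) T a b) e)
        where
        []-⊗-cong : ∀ {A : Set} (d : Dec A) {x y} → (A → x ≡ y) → [ d ] ⊗ x ≃ [ d ] ⊗ y
        []-⊗-cong d@(yes z) eq = R.*-congˡ (R.reflexive (eq z))
        []-⊗-cong d@(no ¬z) eq = R.trans (vanish _) (R.sym (vanish _))
          where
          vanish : ∀ x → [ d ] ⊗ x ≃ 0ᴿ
          vanish x = R.trans (R.*-congʳ ([]-no d ¬z)) (R.zeroˡ x)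

-- The product formula for the probabilities of a local procedure.

module Factorization where
  open import Data.Integer using (pred; _≤_; _<_)
  open Sums
  open Reals
  open Sets
  open Parking
  open Summation R.commutativeSemiring
  open SetoidReasoning R.setoid

  sucℤ-injective : ∀ {i j} → sucℤ i ≡ sucℤ j → i ≡ j
  sucℤ-injective {i} {j} e = trans (sym (ℤₚ.pred-suc i)) (trans (cong pred e) (ℤₚ.pred-suc j))

  -- A labelling that is constant on adjacent elements is constant on every block, so it sorts the
  -- blocks of S into two classes without any reference to their number or position.
  Separated : (ℤ → Bool) → FinSet → Set
  Separated σ S = ∀ x → x ∈ S → sucℤ x ∈ S → σ x ≡ σ (sucℤ x)

  separated-remove : ∀ σ S b → Separated σ S → Separated σ (remove b S)
  separated-remove σ S b sep x x∈ x+1∈ =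
    sep x (proj₁ (∈-remove⁻ S x∈)) (proj₁ (∈-remove⁻ S x+1∈))

  separated-consecutive : ∀ σ S → Separated σ S → ∀ s n → (∀ y → y Mem.∈ consecutive s n → y ∈ S) →
                          ∀ {x} → x Mem.∈ consecutive s n → σ x ≡ σ s
  separated-consecutive σ S sep s (suc n)       sub (here refl) = refl
  separated-consecutive σ S sep s (suc (suc n)) sub (there x∈)  = trans
    (separated-consecutive σ S sep (sucℤ s) (suc n) (λ y → sub y ∘ there) x∈)
    (sym (sep s (sub s (here refl)) (sub (sucℤ s) (there (here refl)))))

  separated-within : ∀ σ S {s t} → Separated σ S → Within s t S →
                     ∀ {x} → s ≤ x → x ≤ t → σ x ≡ σ s
  separated-within σ S {s} {t} sep within {x} s≤x x≤t = go (∈-interval⁺ s t s≤x x≤t)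
    (λ y y∈ → let s≤y , y≤t = ∈-interval⁻ s t y∈ in within y s≤y y≤t)
    where
    go : x ∈ interval s t → (∀ y → y ∈ interval s t → y ∈ S) → σ x ≡ σ s
    go x∈ sub with sucℤ t ℤ.- s
    ... | + n = separated-consecutive σ S sep s n sub x∈

  -- The block lies wholly on the side of a, and it stays maximal there because passing to a subset
  -- of S cannot fill the neighbouring spots.
  block-side : ∀ {σ β S a s t} → Separated σ S → σ a ≡ β → IsBlockOf S a s t →
               IsBlockOf (sideˢ σ β S) a s t × (∀ x → x ∈ interval s t → σ x ≡ β)
  block-side {σ} {β} {S} {a} {s} {t} sep σa≡ bl =
    isBlockOf lower upper
      (λ x s≤x x≤t → ∈-sideˢ⁺ σ S (within x s≤x x≤t) (σ≡ s≤x x≤t))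
      (λ s-1∈ → pred-s∉ (proj₁ (∈-sideˢ⁻ σ S s-1∈)))
      (λ t+1∈ → suc-t∉ (proj₁ (∈-sideˢ⁻ σ S t+1∈))) ,
    (λ x x∈ → let s≤x , x≤t = ∈-interval⁻ s t x∈ in σ≡ s≤x x≤t)
    where
    open IsBlockOf bl
    σ≡ : ∀ {x} → s ≤ x → x ≤ t → σ x ≡ β
    σ≡ s≤x x≤t = trans (separated-within σ S sep within s≤x x≤t)
      (trans (sym (separated-within σ S sep within lower upper)) σa≡)

  restrict-side : ∀ σ {β} W I → (∀ x → x ∈ I → σ x ≡ β) → restrict (side σ β W) I ≡ restrict W I
  restrict-side σ     []      I σ≡ = refl
  restrict-side σ {β} (x ∷ W) I σ≡ with σ x Boolₚ.≟ β
  ... | no σx≢ = trans (restrict-side σ W I σ≡)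
    (sym (Listₚ.filter-reject (_∈? elements I) (λ x∈ → σx≢ (σ≡ x x∈))))
  ... | yes _ with x ∈? elements I
  ...   | yes _ = cong (x ∷_) (restrict-side σ W I σ≡)
  ...   | no _  = restrict-side σ W I σ≡

  -- The directions d and d′ are known to agree only after multiplication by a probability x, which
  -- may be 0; nothing may be cancelled.
  complement : ∀ x d {d′} → x ⊗ d ≃ x ⊗ d′ → x ⊗ (1ᴿ ⊕ ⊖ d) ≃ x ⊗ (1ᴿ ⊕ ⊖ d′)
  complement x d {d′} eq = R.trans (expand d) (R.trans (R.+-congˡ (R.-‿cong eq)) (R.sym (expand d′)))
    where
    open RingProperties R.ring using (-‿distribʳ-*)
    expand : ∀ d → x ⊗ (1ᴿ ⊕ ⊖ d) ≃ x ⊗ 1ᴿ ⊕ ⊖ (x ⊗ d)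
    expand d = R.trans (R.distribˡ x 1ᴿ _) (R.+-congˡ (R.sym (-‿distribʳ-* x d)))

  weighted : ∀ x d {d′} u v → x ⊗ d ≃ x ⊗ d′ →
             x ⊗ (d ⊗ u ⊕ (1ᴿ ⊕ ⊖ d) ⊗ v) ≃ x ⊗ (d′ ⊗ u ⊕ (1ᴿ ⊕ ⊖ d′) ⊗ v)
  weighted x d {d′} u v eq = R.trans (expand d) (R.trans
    (R.+-cong (R.*-congʳ eq) (R.*-congʳ (complement x d eq))) (R.sym (expand d′)))
    where
    expand : ∀ d → x ⊗ (d ⊗ u ⊕ (1ᴿ ⊕ ⊖ d) ⊗ v) ≃ (x ⊗ d) ⊗ u ⊕ (x ⊗ (1ᴿ ⊕ ⊖ d)) ⊗ v
    expand d = R.trans (R.distribˡ x _ _)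
      (R.+-cong (R.sym (R.*-assoc x d u)) (R.sym (R.*-assoc x _ v)))

  module _ (P : ParkingProcedure) (L : Local P) where
    open Local L

    -- A predicate on the word alone, since the case of `W ∷ʳ a` uses that of W for other sets and
    -- labellings. The parameter β makes the two sides interchangeable.
    Factors : Word → Set
    Factors W = ∀ σ β S → Separated σ S →
      ℙ P W S ≃ ℙ P (side σ β W) (sideˢ σ β S) ⊗ ℙ P (side σ (not β) W) (sideˢ σ (not β) S)

    p≄0⇒vertex : ∀ W S → ¬ (ℙ P W S ≃ 0ᴿ) → IsVertex W S
    p≄0⇒vertex W S p≄0 = decidable-stable (isVertex? W S) (p≄0 ∘ ℙ-nonvertex P W S)

    factor≄0 : ∀ W → Factors W → ∀ σ β S → Separated σ S → ¬ (ℙ P W S ≃ 0ᴿ) →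
               ¬ (ℙ P (side σ β W) (sideˢ σ β S) ≃ 0ᴿ)
    factor≄0 W fac σ β S sep p≄0 q≃0 =
      p≄0 (R.trans (fac σ β S sep) (R.trans (R.*-congʳ q≃0) (R.zeroˡ _)))

    -- The product formula is applied to the indicator of the block. A factor of a nonzero product
    -- is nonzero, hence belongs to a vertex. This is the hypothesis that `locallyDecided` asks for.
    block-vertex : ∀ W → Factors W → ∀ S {a s t} → ¬ (ℙ P W S ≃ 0ᴿ) → IsBlockOf S a s t →
                   IsVertex (restrict W (interval s t)) (interval s t)
    block-vertex W fac S {a} {s} {t} p≄0 bl = subst₂ IsVertex W≡ S≡
      (p≄0⇒vertex (side σ true W) (sideˢ σ true S) (factor≄0 W fac σ true S sep p≄0))
      where
      open IsBlockOf bl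
      I = interval s t
      σ : ℤ → Bool
      σ x = does (x ∈? elements I)

      σ⇒∈ : ∀ x → σ x ≡ true → x ∈ I
      σ⇒∈ x σx with x ∈? elements I
      ... | yes x∈ = x∈

      -- An adjacent pair that straddles an end of the block would contain `pred s` or `sucℤ t`, and
      -- neither lies in S.
      sep : Separated σ S
      sep x x∈S x+1∈S with x ∈? elements I | sucℤ x ∈? elements I
      ... | yes _  | yes _   = refl
      ... | no _   | no _    = refl
      ... | yes x∈ | no x+1∉ with ∈-interval⁻ s t x∈
      ...   | s≤x , x≤t with x ℤ.≟ t
      ...     | yes refl = ⊥-elim (suc-t∉ x+1∈S)
      ...     | no x≢t   = ⊥-elim (x+1∉ (∈-interval⁺ s t (ℤₚ.≤-trans s≤x (ℤₚ.i≤suc[i] x))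
                             (ℤₚ.i<j⇒suc[i]≤j (ℤₚ.≤∧≢⇒< x≤t x≢t))))
      sep x x∈S x+1∈S | no x∉ | yes x+1∈ with ∈-interval⁻ s t x+1∈
      ...   | s≤x+1 , x+1≤t with s ℤ.≟ sucℤ x
      ...     | yes refl = ⊥-elim (pred-s∉ (subst (_∈ S) (sym (ℤₚ.pred-suc x)) x∈S))
      ...     | no s≢    = ⊥-elim (x∉ (∈-interval⁺ s t (<sucℤ⇒≤ (ℤₚ.≤∧≢⇒< s≤x+1 s≢))
                             (ℤₚ.≤-trans (ℤₚ.i≤suc[i] x) x+1≤t)))

      W≡ : side σ true W ≡ restrict W I
      W≡ = Listₚ.filter-≐ _ (_∈? elements I)
        ((λ {x} → σ⇒∈ x) , (λ {x} → dec-true (x ∈? elements I))) W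

      S≡ : sideˢ σ true S ≡ I
      S≡ = FinSet-ext (λ x x∈ → σ⇒∈ x (proj₂ (∈-sideˢ⁻ σ S x∈)))
        (λ x x∈ → let s≤x , x≤t = ∈-interval⁻ s t x∈ in
                  ∈-sideˢ⁺ σ S (within x s≤x x≤t) (dec-true (x ∈? elements I) x∈))

    -- From a nonzero probability, `ℙ-nonNegative` yields a positive one only up to double negation,
    -- which is enough for a stable equation.
    dir-block : ∀ W S {a s t} → ¬ (ℙ P W S ≃ 0ᴿ) → IsBlockOf S a s t →
                IsVertex (restrict W (interval s t)) (interval s t) →
                dir P W S a ≃ dir P (restrict W (interval s t)) (interval s t) a
    dir-block W S {a} {s} {t} p≄0 bl q = ≃-stable λ ≄ → ℙ-nonNegative P W S λ where
        (inj₁ p≃0) → p≄0 p≃0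
        (inj₂ p>0) → ≄ (local p>0)
      where
      open IsBlockOf bl
      a∈I = ∈-interval⁺ s t lower upper
      valid = p≄0⇒vertex W S p≄0
      v = vertex W S valid
      w = vertex (restrict W (interval s t)) (interval s t) q
      local : 0ᴿ <ᴿ ℙ P W S → dir P W S a ≃ dir P (restrict W (interval s t)) (interval s t) a
      local p>0 = R.trans (R.reflexive (sym (Dir≃dir P v a member)))
        (R.trans (mk≃ {Dir P v a member} {Dir P w a a∈I}
                   (locallyDecided v a s t bl (>0-resp-≃ (R.sym (𝒫≃ℙ P W S)) p>0) q a∈I))
                 (R.reflexive (Dir≃dir P w a a∈I)))

    -- Locality is used twice, for (W, S) and for its part on the side of a, and both directions
    -- become the one decided in the block of a alone. The part has nonzero probability because it
    -- is a factor of that of (W, S).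
    dir-side : ∀ W → Factors W → ∀ σ {β} S {a} → Separated σ S → σ a ≡ β → a ∈ S →
      ℙ P W S ⊗ dir P W S a ≃ ℙ P W S ⊗ dir P (side σ β W) (sideˢ σ β S) a
    dir-side W fac σ {β} S {a} sep σa≡ a∈ = ≃-stable λ ≄ →
      let p≄0 : ¬ (ℙ P W S ≃ 0ᴿ)
          p≄0 = λ p≃0 → ≄ (R.trans (vanish p≃0) (R.sym (vanish p≃0)))
      in ≄ (R.*-congˡ (dirs p≄0))
      where
      vanish : ∀ {x} → ℙ P W S ≃ 0ᴿ → ℙ P W S ⊗ x ≃ 0ᴿ
      vanish p≃0 = R.trans (R.*-congʳ p≃0) (R.zeroˡ _)

      dirs : ¬ (ℙ P W S ≃ 0ᴿ) → dir P W S a ≃ dir P (side σ β W) (sideˢ σ β S) a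
      dirs p≄0 with blockOf S a a∈
      ... | s , t , bl with block-side sep σa≡ bl
      ...   | bl′ , σ≡ = R.trans (dir-block W S p≄0 bl q)
        (R.trans (R.reflexive (cong (λ V → dir P V (interval s t) a) (sym W≡)))
          (R.sym (dir-block (side σ β W) (sideˢ σ β S) (factor≄0 W fac σ β S sep p≄0) bl′
                   (subst (λ V → IsVertex V (interval s t)) (sym W≡) q))))
        where
        q = block-vertex W fac S p≄0 bl
        W≡ : restrict (side σ β W) (interval s t) ≡ restrict W (interval s t)
        W≡ = restrict-side σ W (interval s t) σ≡

    step-side : ∀ W → Factors W → ∀ σ {β} S {a} b → Separated σ S → σ a ≡ β →
      ℙ P W S ⊗ step P W S a b ≃ ℙ P W S ⊗ step P (side σ β W) (sideˢ σ β S) a b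
    step-side W fac σ {β} S {a} b sep σa≡ = go (a ∈? elements S)
      where
      go : Dec (a ∈ S) → ℙ P W S ⊗ step P W S a b ≃ ℙ P W S ⊗ step P (side σ β W) (sideˢ σ β S) a b
      go (no a∉) = R.*-congˡ (R.reflexive (trans (step-free P W S b a∉)
        (sym (step-free P (side σ β W) (sideˢ σ β S) b (a∉ ∘ proj₁ ∘ ∈-sideˢ⁻ σ S)))))
      go (yes a∈) with blockOf S a a∈
      ... | s , t , bl = R.trans (R.*-congˡ (R.reflexive (step-block P W S b bl)))
        (R.trans (weighted _ _ _ _ (dir-side W fac σ S sep σa≡ a∈))
          (R.*-congˡ (R.reflexive (sym
            (step-block P (side σ β W) (sideˢ σ β S) b (proj₁ (block-side sep σa≡ bl)))))))

    -- A car parks at a itself or next to the block of a. That block and b both lie in S, so an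
    -- adjacent b carries the same label as a.
    step-cross : ∀ W σ S {a b} → Separated σ S → b ∈ S → σ a ≢ σ b → step P W (remove b S) a b ≃ 0ᴿ
    step-cross W σ S {a} {b} sep b∈ σa≢σb = go (a ∈? elements (remove b S))
      where
      go : Dec (a ∈ remove b S) → step P W (remove b S) a b ≃ 0ᴿ
      go (no a∉) = R.trans (R.reflexive (step-free P W (remove b S) b a∉))
        ([]-no (b ℤ.≟ a) (λ { refl → σa≢σb refl }))
      go (yes a∈) with blockOf (remove b S) a a∈
      ... | s , t , bl = R.trans (R.reflexive (step-block P W (remove b S) b bl)) (R.trans
        (R.+-cong (R.trans (R.*-congˡ ([]-no (b ℤ.≟ sucℤ t) b≢t+1)) (R.zeroʳ _))
                  (R.trans (R.*-congˡ ([]-no (b ℤ.≟ pred s) b≢s-1)) (R.zeroʳ _)))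
        (R.+-identityˡ 0ᴿ))
        where
        open IsBlockOf bl
        sub : ∀ {x} → x ∈ remove b S → x ∈ S
        sub x∈ = proj₁ (∈-remove⁻ S x∈)
        σ-const : ∀ {x} → s ≤ x → x ≤ t → σ x ≡ σ s
        σ-const = separated-within σ (remove b S) (separated-remove σ S b sep) within
        b≢t+1 : b ≢ sucℤ t
        b≢t+1 refl = σa≢σb (trans (σ-const lower upper) (trans (sym (σ-const nonempty ℤₚ.≤-refl))
          (sep t (sub (within t nonempty ℤₚ.≤-refl)) b∈)))
        b≢s-1 : b ≢ pred s
        b≢s-1 refl = σa≢σb (trans (σ-const lower upper) (sym (trans
          (sep (pred s) b∈ (subst (_∈ S) (sym (ℤₚ.suc-pred s)) (sub (within s ℤₚ.≤-refl nonempty))))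
          (cong σ (ℤₚ.suc-pred s)))))

    factors-[] : Factors []
    factors-[] σ β S sep = go S
      where
      p∅ : ∀ S → elements S ≡ [] → ℙ P [] S ≃ 1ᴿ
      p∅ S e = []-yes (∅ ≟ˢ S) (elements-injective (sym e))
      p≢∅ : ∀ {x} S → x ∈ S → ℙ P [] S ≃ 0ᴿ
      p≢∅ S x∈ = []-no (∅ ≟ˢ S) λ { refl → case x∈ of λ () }
      go : ∀ S → ℙ P [] S ≃ ℙ P [] (sideˢ σ β S) ⊗ ℙ P [] (sideˢ σ (not β) S)
      go S@(finSet [] _) = R.trans (p∅ S refl) (R.sym (R.trans
        (R.*-cong (p∅ (sideˢ σ β S) refl) (p∅ (sideˢ σ (not β) S) refl)) (R.*-identityˡ 1ᴿ)))
      go S@(finSet (x ∷ xs) _) = split (σ x Boolₚ.≟ β)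
        where
        split : Dec (σ x ≡ β) → ℙ P [] S ≃ ℙ P [] (sideˢ σ β S) ⊗ ℙ P [] (sideˢ σ (not β) S)
        split (yes σx≡) = R.trans (p≢∅ S (here refl))
          (R.sym (R.trans (R.*-congʳ (p≢∅ (sideˢ σ β S) (∈-sideˢ⁺ σ S (here refl) σx≡))) (R.zeroˡ _)))
        split (no σx≢)  = R.trans (p≢∅ S (here refl))
          (R.sym (R.trans
            (R.*-congˡ (p≢∅ (sideˢ σ (not β) S) (∈-sideˢ⁺ σ S (here refl) (¬-not σx≢)))) (R.zeroʳ _)))

    ∑-side-β : ∀ σ β (xs : List ℤ) f → ∑ xs f ≃ ∑ (side σ β xs) f ⊕ ∑ (side σ (not β) xs) f
    ∑-side-β σ true  xs f = ∑-side σ xs f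
    ∑-side-β σ false xs f = R.trans (∑-side σ xs f) (R.+-comm _ _)

    -- Only the spots b on the side of a contribute to the recursion on the last car. Removing such
    -- a b leaves the other side untouched, so the probability of that side is a common factor, and
    -- the rest is the recursion for the side of a.
    factors-∷ʳ : ∀ W → Factors W → ∀ a → Factors (W ∷ʳ a)
    factors-∷ʳ W fac a σ β S sep = split (σ a Boolₚ.≟ β)
      where
      Goal : Bool → Set
      Goal β = ℙ P (W ∷ʳ a) S ≃
        ℙ P (side σ β (W ∷ʳ a)) (sideˢ σ β S) ⊗ ℙ P (side σ (not β) (W ∷ʳ a)) (sideˢ σ (not β) S)

      same : ∀ β → σ a ≡ β → Goal β
      same β σa≡ = begin
        ℙ P (W ∷ʳ a) S
          ≈⟨ ℙ-∷ʳ P W a S ⟩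
        ∑ (elements S) term
          ≈⟨ ∑-side-β σ β (elements S) term ⟩
        ∑ (elements Sβ) term ⊕ ∑ (elements Sγ) term
          ≈⟨ R.+-cong (∑-cong (elements Sβ) near) (∑-zero (elements Sγ) cross) ⟩
        ∑ (elements Sβ) (λ b → ℙ P Wβ (remove b Sβ) ⊗ step P Wβ (remove b Sβ) a b ⊗ ℙ P Wγ Sγ) ⊕ 0ᴿ
          ≈⟨ R.trans (R.+-identityʳ _) (R.sym (∑-* (ℙ P Wγ Sγ) (elements Sβ) _)) ⟩
        ∑ (elements Sβ) (λ b → ℙ P Wβ (remove b Sβ) ⊗ step P Wβ (remove b Sβ) a b) ⊗ ℙ P Wγ Sγ
          ≈⟨ R.*-congʳ (ℙ-∷ʳ P Wβ a Sβ) ⟨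
        ℙ P (Wβ ∷ʳ a) Sβ ⊗ ℙ P Wγ Sγ
          ≡⟨ cong₂ (λ U V → ℙ P U Sβ ⊗ ℙ P V Sγ) (side-∷ʳ-≡ σ W a σa≡)
               (side-∷ʳ-≢ σ W a (λ σa≡′ → not-¬ refl (trans (sym σa≡) σa≡′))) ⟨
        ℙ P (side σ β (W ∷ʳ a)) Sβ ⊗ ℙ P (side σ (not β) (W ∷ʳ a)) Sγ ∎
        where
        Wβ = side σ β W
        Wγ = side σ (not β) W
        Sβ = sideˢ σ β S
        Sγ = sideˢ σ (not β) S
        term : ℤ → ℝ
        term b = ℙ P W (remove b S) ⊗ step P W (remove b S) a b

        near : ∀ b → b ∈ Sβ → term b ≃ ℙ P Wβ (remove b Sβ) ⊗ step P Wβ (remove b Sβ) a b ⊗ ℙ P Wγ Sγ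
        near b b∈ = begin
          term b
            ≈⟨ step-side W fac σ (remove b S) b (separated-remove σ S b sep) σa≡ ⟩
          ℙ P W (remove b S) ⊗ step P Wβ (sideˢ σ β (remove b S)) a b
            ≈⟨ R.*-congʳ (fac σ β (remove b S) (separated-remove σ S b sep)) ⟩
          ℙ P Wβ (sideˢ σ β (remove b S)) ⊗ ℙ P Wγ (sideˢ σ (not β) (remove b S))
            ⊗ step P Wβ (sideˢ σ β (remove b S)) a b
            ≡⟨ cong₂ (λ T U → ℙ P Wβ T ⊗ ℙ P Wγ U ⊗ step P Wβ T a b) (sideˢ-remove σ b S)
                 (sideˢ-remove-≢ σ b S (λ σb≡ → not-¬ refl (trans (sym (proj₂ (∈-sideˢ⁻ σ S b∈))) σb≡))) ⟩
          ℙ P Wβ (remove b Sβ) ⊗ ℙ P Wγ Sγ ⊗ step P Wβ (remove b Sβ) a b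
            ≈⟨ xy∙z≈xz∙y _ _ _ ⟩
          ℙ P Wβ (remove b Sβ) ⊗ step P Wβ (remove b Sβ) a b ⊗ ℙ P Wγ Sγ ∎
          where open CommutativeSemigroupProperties R.*-commutativeSemigroup using (xy∙z≈xz∙y)

        cross : ∀ b → b ∈ Sγ → term b ≃ 0ᴿ
        cross b b∈ with ∈-sideˢ⁻ σ S b∈
        ... | b∈S , σb≡ = R.trans (R.*-congˡ (step-cross W σ S sep b∈S
          (λ σa≡σb → not-¬ refl (trans (sym σa≡) (trans σa≡σb σb≡))))) (R.zeroʳ _)

      split : Dec (σ a ≡ β) → Goal β
      split (yes σa≡) = same β σa≡
      -- The two sides exchange their roles, up to `not (not β)`.
      split (no σa≢)  = R.trans (same (not β) (¬-not σa≢))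
        (R.trans (R.*-comm _ _) (R.*-congʳ (R.reflexive
          (cong (λ β′ → ℙ P (side σ β′ (W ∷ʳ a)) (sideˢ σ β′ S)) (not-involutive β)))))

    factors : ∀ W → Factors W
    factors W = go (reverseView W)
      where
      go : ∀ {W} → Reverse W → Factors W
      go []            = factors-[]
      go (W ∶ rev ∶ʳ a) = factors-∷ʳ W (go rev) a

    -- Shift invariance of the probabilities.

    ∈-τ⁺ : ∀ {x} S → x ∈ S → sucℤ x ∈ τˢ S
    ∈-τ⁺ S = Memₚ.∈-map⁺ sucℤ

    ∈-τ⁻ : ∀ {x} S → sucℤ x ∈ τˢ S → x ∈ S
    ∈-τ⁻ S x∈ with Memₚ.∈-map⁻ sucℤ x∈
    ... | y , y∈ , eq = subst (_∈ S) (sym (sucℤ-injective eq)) y∈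

    ∈-τ⁻′ : ∀ {x} S → x ∈ τˢ S → pred x ∈ S
    ∈-τ⁻′ {x} S x∈ = ∈-τ⁻ S (subst (_∈ τˢ S) (sym (ℤₚ.suc-pred x)) x∈)

    remove-τ : ∀ b S → remove (sucℤ b) (τˢ S) ≡ τˢ (remove b S)
    remove-τ b S = FinSet-ext
      (λ x x∈ → let x∈τ , x≢ = ∈-remove⁻ (τˢ S) x∈ in
         subst (_∈ τˢ (remove b S)) (ℤₚ.suc-pred x) (∈-τ⁺ (remove b S) (∈-remove⁺ S (∈-τ⁻′ S x∈τ)
           (λ { refl → x≢ (sym (ℤₚ.suc-pred x)) }))))
      (λ x x∈ → let x-1∈ , x-1≢ = ∈-remove⁻ S (∈-τ⁻′ (remove b S) x∈) in
         ∈-remove⁺ (τˢ S) (subst (_∈ τˢ S) (ℤₚ.suc-pred x) (∈-τ⁺ S x-1∈))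
           (λ { refl → x-1≢ (ℤₚ.pred-suc b) }))

    block-τ : ∀ {S a s t} → IsBlockOf S a s t → IsBlockOf (τˢ S) (sucℤ a) (sucℤ s) (sucℤ t)
    block-τ {S} {a} {s} {t} bl = isBlockOf (ℤₚ.suc-mono lower) (ℤₚ.suc-mono upper)
      (λ x s<x x≤t → subst (_∈ τˢ S) (ℤₚ.suc-pred x) (∈-τ⁺ S (within (pred x)
        (subst (_≤ pred x) (ℤₚ.pred-suc s) (ℤₚ.pred-mono s<x))
        (subst (pred x ≤_) (ℤₚ.pred-suc t) (ℤₚ.pred-mono x≤t)))))
      (λ s∈ → pred-s∉ (∈-τ⁻ S (subst (_∈ τˢ S) (trans (ℤₚ.pred-suc s) (sym (ℤₚ.suc-pred s))) s∈)))
      (λ t+2∈ → suc-t∉ (∈-τ⁻ S t+2∈))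
      where open IsBlockOf bl

    -- The factor `ℙ P W S` disposes of the pairs that are not vertices, where `Dir` is undefined;
    -- at vertices, shift invariance holds without any condition on the probability.
    dir-τ : ∀ W S {a} → a ∈ S →
      ℙ P W S ⊗ dir P (map sucℤ W) (τˢ S) (sucℤ a) ≃ ℙ P W S ⊗ dir P W S a
    dir-τ W S {a} a∈ with isVertex? W S
    ... | no ¬q = R.trans (vanish _) (R.sym (vanish _))
      where
      vanish : ∀ x → ℙ P W S ⊗ x ≃ 0ᴿ
      vanish x = R.trans (R.*-congʳ (ℙ-nonvertex P W S ¬q)) (R.zeroˡ x)
    ... | yes q = R.*-congˡ (R.trans (R.reflexive (sym (Dir≃dir P (τᵛ v) (sucℤ a) (∈-τ⁺ S a∈))))
        (R.trans (mk≃ {Dir P (τᵛ v) (sucℤ a) (∈-τ⁺ S a∈)} {Dir P v a a∈} (shiftInvariant v a a∈))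
                 (R.reflexive (Dir≃dir P v a a∈))))
      where
      v = vertex W S q

    steℙ-τ : ∀ W S a b →
      ℙ P W S ⊗ step P (map sucℤ W) (τˢ S) (sucℤ a) (sucℤ b) ≃ ℙ P W S ⊗ step P W S a b
    steℙ-τ W S a b = go (a ∈? elements S)
      where
      go : Dec (a ∈ S) → ℙ P W S ⊗ step P (map sucℤ W) (τˢ S) (sucℤ a) (sucℤ b) ≃ ℙ P W S ⊗ step P W S a b
      go (no a∉) = R.*-congˡ (R.trans
        (R.reflexive (step-free P (map sucℤ W) (τˢ S) (sucℤ b) (a∉ ∘ ∈-τ⁻ S)))
        (R.trans ([]-⇔ (sucℤ b ℤ.≟ sucℤ a) (b ℤ.≟ a) sucℤ-injective (cong sucℤ))
                 (R.reflexive (sym (step-free P W S b a∉)))))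
      go (yes a∈) with blockOf S a a∈
      ... | s , t , bl = R.trans
        (R.*-congˡ (R.trans (R.reflexive (step-block P (map sucℤ W) (τˢ S) (sucℤ b) (block-τ bl)))
          (R.+-cong (R.*-congˡ ([]-⇔ (sucℤ b ℤ.≟ sucℤ (sucℤ t)) (b ℤ.≟ sucℤ t) sucℤ-injective (cong sucℤ)))
                    (R.*-congˡ ([]-⇔ (sucℤ b ℤ.≟ pred (sucℤ s)) (b ℤ.≟ pred s)
                      (λ e → trans (sym (ℤₚ.pred-suc b)) (cong pred (trans e (ℤₚ.pred-suc s))))
                      (λ e → trans (cong sucℤ e) (trans (ℤₚ.suc-pred s) (sym (ℤₚ.pred-suc s)))))))))
        (R.trans (weighted _ _ _ _ (dir-τ W S a∈))
          (R.*-congˡ (R.reflexive (sym (step-block P W S b bl)))))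

    ℙ-τ : ∀ W S → ℙ P (map sucℤ W) (τˢ S) ≃ ℙ P W S
    ℙ-τ W = go (reverseView W)
      where
      go : ∀ {W} → Reverse W → ∀ S → ℙ P (map sucℤ W) (τˢ S) ≃ ℙ P W S
      go [] S = []-⇔ (∅ ≟ˢ τˢ S) (∅ ≟ˢ S)
        (λ e → elements-injective (empty (elements S) (cong elements e)))
        (λ { refl → refl })
        where
        empty : ∀ xs → [] ≡ map sucℤ xs → [] ≡ xs
        empty [] _ = refl
      go (W ∶ rev ∶ʳ a) S = begin
        ℙ P (map sucℤ (W ∷ʳ a)) (τˢ S)
          ≡⟨ cong (λ V → ℙ P V (τˢ S)) (Listₚ.map-++ sucℤ W (a ∷ [])) ⟩
        ℙ P (map sucℤ W ∷ʳ sucℤ a) (τˢ S)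
          ≈⟨ ℙ-∷ʳ P (map sucℤ W) (sucℤ a) (τˢ S) ⟩
        ∑ (elements (τˢ S)) term
          ≡⟨ ∑-map sucℤ (elements S) term ⟩
        ∑ (elements S) (term ∘ sucℤ)
          ≈⟨ ∑-cong (elements S) (λ b _ → begin
               term (sucℤ b)
                 ≡⟨ cong (λ T → ℙ P (map sucℤ W) T ⊗ step P (map sucℤ W) T (sucℤ a) (sucℤ b)) (remove-τ b S) ⟩
               ℙ P (map sucℤ W) (τˢ (remove b S)) ⊗ step P (map sucℤ W) (τˢ (remove b S)) (sucℤ a) (sucℤ b)
                 ≈⟨ R.*-congʳ (go rev (remove b S)) ⟩
               ℙ P W (remove b S) ⊗ step P (map sucℤ W) (τˢ (remove b S)) (sucℤ a) (sucℤ b)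
                 ≈⟨ steℙ-τ W (remove b S) a b ⟩
               ℙ P W (remove b S) ⊗ step P W (remove b S) a b ∎) ⟩
        ∑ (elements S) (λ b → ℙ P W (remove b S) ⊗ step P W (remove b S) a b)
          ≈⟨ ℙ-∷ʳ P W a S ⟨
        ℙ P (W ∷ʳ a) S ∎
        where
        term : ℤ → ℝ
        term b = ℙ P (map sucℤ W) (remove b (τˢ S)) ⊗ step P (map sucℤ W) (remove b (τˢ S)) (sucℤ a) b

-- The recurrence for the sums over all words, and its solution.

module Counting where
  open import Data.Integer using (pred; _≤_; _<_)
  open Sums
  open Abel
  open Reals
  open Sets
  open Parking
  open Factorization
  open Summation R.commutativeSemiring
  open SetoidReasoning R.setoid
  module ℕ-Summation = Summation ℕₚ.+-*-commutativeSemiring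

  fromℕ-1 : fromℕ 1 ≃ 1ᴿ
  fromℕ-1 = ≡⇒≃ (λ _ → refl)

  fromℕ-conv : ∀ n f g → fromℕ (ℕ-Summation.conv n f g) ≃ conv n (fromℕ ∘ f) (fromℕ ∘ g)
  fromℕ-conv zero    f g = fromℕ-* (f 0) (g 0)
  fromℕ-conv (suc n) f g = R.trans (fromℕ-+ (ℕ-Summation.conv n (f ∘ suc) g) _)
    (R.+-cong (fromℕ-conv n (f ∘ suc) g) (fromℕ-conv n f (g ∘ suc)))

  range : ℤ → ℕ → FinSet
  range c m = finSet (consecutive c m) (consecutive-increasing c m)

  consecutive-sucℤ : ∀ c m → consecutive (sucℤ c) m ≡ map sucℤ (consecutive c m)
  consecutive-sucℤ c zero    = refl
  consecutive-sucℤ c (suc m) = cong (sucℤ c ∷_) (consecutive-sucℤ (sucℤ c) m)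

  length-consecutive : ∀ c m → length (consecutive c m) ≡ m
  length-consecutive c zero    = refl
  length-consecutive c (suc m) = cong suc (length-consecutive (sucℤ c) m)

  consecutive≡map-upTo : ∀ c m → consecutive c m ≡ map (λ k → c ℤ.+ + k) (upTo m)
  consecutive≡map-upTo c m = trans (go c m _ (λ _ → refl)) (sym (Listₚ.map-upTo _ m))
    where
    go : ∀ c m f → (∀ k → f k ≡ c ℤ.+ + k) → consecutive c m ≡ applyUpTo f m
    go c zero    f f≡ = refl
    go c (suc m) f f≡ = cong₂ _∷_ (trans (sym (ℤₚ.+-identityʳ c)) (sym (f≡ 0)))
      (go (sucℤ c) m (f ∘ suc) (λ k → trans (f≡ (suc k)) (sym (sucℤ-+ c k))))

  ∑-consecutive : ∀ c m (f : ℤ → ℝ) → ∑ (consecutive c m) f ≡ ∑ (upTo m) (λ k → f (c ℤ.+ + k))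
  ∑-consecutive c m f = trans (cong (λ xs → ∑ xs f) (consecutive≡map-upTo c m)) (∑-map _ (upTo m) f)

  range-block : ∀ s m {a} → a ∈ range s m → IsBlockOf (range s m) a s (pred (s ℤ.+ + m))
  range-block s m {a} a∈ = isBlockOf s≤a (ℤₚ.i<j⇒i≤pred[j] a<)
    (λ x s≤x x≤ → ∈-consecutive⁺ s m s≤x (ℤₚ.i≤pred[j]⇒i<j x≤))
    (λ ∈ → ℤₚ.<-irrefl refl (ℤₚ.<-≤-trans (pred< s) (proj₁ (∈-consecutive⁻ s m ∈))))
    (λ ∈ → ℤₚ.<-irrefl (ℤₚ.suc-pred (s ℤ.+ + m)) (proj₂ (∈-consecutive⁻ s m ∈)))
    where
    s≤a = proj₁ (∈-consecutive⁻ s m a∈)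
    a<  = proj₂ (∈-consecutive⁻ s m a∈)

  -- The duplicate-free support that `HasSum` requires. Letters are appended at the end, as in `∑ʷ`.
  vectors : List ℤ → ∀ n → List (Vec ℤ n)
  vectors xs zero    = []ᵥ ∷ []
  vectors xs (suc n) = cartesianProductWith (λ a v → v ∷ʳᵥ a) xs (vectors xs n)

  vectors-unique : ∀ {xs} → Unique xs → ∀ n → Unique (vectors xs n)
  vectors-unique u zero    = [] ∷ []
  vectors-unique u (suc n) = Uniqueₚ.cartesianProductWith⁺ (λ a v → v ∷ʳᵥ a)
    (λ {_} {_} {v} {w} eq → swap (Vecₚ.∷ʳ-injective v w eq)) u (vectors-unique u n)

  ∈-vectors : ∀ {xs n} (v : Vec ℤ n) → (∀ x → x Mem.∈ toList v → x Mem.∈ xs) → v Mem.∈ vectors xs n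
  ∈-vectors {n = zero}  []ᵥ _   = here refl
  ∈-vectors {n = suc n} v   sub with initLast v
  ... | w , a , refl = Memₚ.∈-cartesianProductWith⁺ (λ a v → v ∷ʳᵥ a)
    (sub a (inList (Memₚ.∈-++⁺ʳ (toList w) (here refl))))
    (∈-vectors w (λ x x∈ → sub x (inList (Memₚ.∈-++⁺ˡ x∈))))
    where
    inList : ∀ {x} → x Mem.∈ (toList w ∷ʳ a) → x Mem.∈ toList (w ∷ʳᵥ a)
    inList = subst (_ Mem.∈_) (sym (Vecₚ.toList-∷ʳ a w))

  ∑-vectors : ∀ xs n f → ∑ (vectors xs n) (f ∘ toList) ≃ ∑ʷ xs n f
  ∑-vectors xs zero    f = R.+-identityʳ _
  ∑-vectors xs (suc n) f = R.trans (product xs) (∑-cong xs (λ a _ → R.trans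
    (∑-cong (vectors xs n) (λ v _ → R.reflexive (cong f (Vecₚ.toList-∷ʳ a v))))
    (∑-vectors xs n (λ W → f (W ∷ʳ a)))))
    where
    product : ∀ ys → ∑ (cartesianProductWith (λ a v → v ∷ʳᵥ a) ys (vectors xs n)) (f ∘ toList) ≃
              ∑ ys (λ a → ∑ (vectors xs n) (λ v → f (toList (v ∷ʳᵥ a))))
    product []       = R.refl
    product (a ∷ ys) = R.trans (∑-++ (map (_∷ʳᵥ a) (vectors xs n)) _ (f ∘ toList))
      (R.+-cong (R.reflexive (∑-map (_∷ʳᵥ a) (vectors xs n) (f ∘ toList))) (product ys))

  interval≡range : ∀ r → interval (+ 1) (+ r) ≡ range (+ 1) r
  interval≡range r = elements-injective refl

  module _ (P : ParkingProcedure) (L : Local P) where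

    -- The sums over all words parking on {c, …, c+m-1}: of the probability that they do so, and of
    -- the expected number of letters a of the interval for which one more car goes right,
    -- respectively left.
    parked rightward leftward : ℤ → ℕ → ℝ
    parked    c m = ∑ʷ (consecutive c m) m (λ W → ℙ P W (range c m))
    rightward c m = ∑ʷ (consecutive c m) m (λ W →
      ∑ (consecutive c m) (λ a → ℙ P W (range c m) ⊗ dir P W (range c m) a))
    leftward  c m = ∑ʷ (consecutive c m) m (λ W →
      ∑ (consecutive c m) (λ a → ℙ P W (range c m) ⊗ (1ᴿ ⊕ ⊖ dir P W (range c m) a)))

    range-τ : ∀ c m → range (sucℤ c) m ≡ τˢ (range c m)
    range-τ c m = elements-injective (consecutive-sucℤ c m)

    parked-shift : ∀ c m → parked (sucℤ c) m ≃ parked c m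
    parked-shift c m = begin
      ∑ʷ (consecutive (sucℤ c) m) m (λ W → ℙ P W (range (sucℤ c) m))
        ≡⟨ cong₂ (λ xs S → ∑ʷ xs m (λ W → ℙ P W S)) (consecutive-sucℤ c m) (range-τ c m) ⟩
      ∑ʷ (map sucℤ (consecutive c m)) m (λ W → ℙ P W (τˢ (range c m)))
        ≈⟨ ∑ʷ-map sucℤ (consecutive c m) m _ ⟩
      ∑ʷ (consecutive c m) m (λ W → ℙ P (map sucℤ W) (τˢ (range c m)))
        ≈⟨ ∑ʷ-cong (consecutive c m) m (λ W _ _ → ℙ-τ P L W (range c m)) ⟩
      parked c m ∎

    leftward-shift : ∀ c m → leftward (sucℤ c) m ≃ leftward c m
    leftward-shift c m = begin
      leftward (sucℤ c) m
        ≡⟨ cong₂ (λ xs S → ∑ʷ xs m (λ W → ∑ xs (λ a → ℙ P W S ⊗ (1ᴿ ⊕ ⊖ dir P W S a))))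
             (consecutive-sucℤ c m) (range-τ c m) ⟩
      ∑ʷ (map sucℤ xs) m (λ W → ∑ (map sucℤ xs) (λ a → ℙ P W T ⊗ (1ᴿ ⊕ ⊖ dir P W T a)))
        ≈⟨ ∑ʷ-map sucℤ xs m _ ⟩
      ∑ʷ xs m (λ W → ∑ (map sucℤ xs) (λ a → ℙ P (map sucℤ W) T ⊗ (1ᴿ ⊕ ⊖ dir P (map sucℤ W) T a)))
        ≈⟨ ∑ʷ-cong xs m (λ W _ _ → R.trans
             (R.reflexive (∑-map sucℤ xs (λ a → ℙ P (map sucℤ W) T ⊗ (1ᴿ ⊕ ⊖ dir P (map sucℤ W) T a))))
             (∑-cong xs (λ a a∈ → R.trans (R.*-congʳ (ℙ-τ P L W (range c m)))
               (complement (ℙ P W (range c m)) _ (dir-τ P L W (range c m) a∈))))) ⟩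
      leftward c m ∎
      where
      xs = consecutive c m
      T = τˢ (range c m)

    iterate-shift : ∀ (f : ℤ → ℝ) → (∀ c → f (sucℤ c) ≃ f c) → ∀ c k → f (c ℤ.+ + k) ≃ f c
    iterate-shift f shift c zero    = R.reflexive (cong f (ℤₚ.+-identityʳ c))
    iterate-shift f shift c (suc k) = R.trans (R.reflexive (cong f (sym (sucℤ-+ c k))))
      (R.trans (iterate-shift f shift (sucℤ c) k) (shift c))

    ∑-const : ∀ {A : Set} (xs : List A) x → ∑ xs (λ _ → x) ≃ fromℕ (length xs) ⊗ x
    ∑-const []       x = R.sym (R.trans (R.*-congʳ (≡⇒≃ (λ _ → refl))) (R.zeroˡ x))
    ∑-const (_ ∷ xs) x = R.sym (R.trans (R.*-congʳ (R.trans (fromℕ-+ 1 (length xs)) (R.+-congʳ fromℕ-1)))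
      (R.trans (R.distribʳ x 1ᴿ _) (R.+-cong (R.*-identityˡ x) (R.sym (∑-const xs x)))))

    -- For each of the m letters of the interval the two directions add up to the probability of the
    -- word, whatever `dir` is; the free spot itself accounts for one more preference.
    right+parked+left : ∀ c m → rightward c m ⊕ (parked c m ⊕ leftward c m) ≃ fromℕ (suc m) ⊗ parked c m
    right+parked+left c m = begin
      rightward c m ⊕ (parked c m ⊕ leftward c m)
        ≈⟨ x∙yz≈y∙xz _ _ _ ⟩
      parked c m ⊕ (rightward c m ⊕ leftward c m)
        ≈⟨ R.+-congˡ (R.sym (∑ʷ-+ xs m _ _)) ⟩
      parked c m ⊕ ∑ʷ xs m (λ W →
        ∑ xs (λ a → ℙ P W T ⊗ dir P W T a) ⊕ ∑ xs (λ a → ℙ P W T ⊗ (1ᴿ ⊕ ⊖ dir P W T a)))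
        ≈⟨ R.+-congˡ (∑ʷ-cong xs m (λ W _ _ → R.trans (R.sym (∑-+ xs _ _))
             (R.trans (∑-cong xs (λ a _ → total (ℙ P W T) (dir P W T a))) (∑-const xs (ℙ P W T))))) ⟩
      parked c m ⊕ ∑ʷ xs m (λ W → fromℕ (length xs) ⊗ ℙ P W T)
        ≈⟨ R.+-congˡ (R.trans (∑ʷ-* xs m _ _) (R.*-congʳ (R.reflexive (cong fromℕ (length-consecutive c m))))) ⟩
      parked c m ⊕ fromℕ m ⊗ parked c m
        ≈⟨ R.+-congʳ (R.*-identityˡ _) ⟨
      1ᴿ ⊗ parked c m ⊕ fromℕ m ⊗ parked c m
        ≈⟨ R.distribʳ _ 1ᴿ (fromℕ m) ⟨
      (1ᴿ ⊕ fromℕ m) ⊗ parked c m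
        ≈⟨ R.*-congʳ (R.trans (fromℕ-+ 1 m) (R.+-congʳ fromℕ-1)) ⟨
      fromℕ (suc m) ⊗ parked c m ∎
      where
      open CommutativeSemigroupProperties R.+-commutativeSemigroup using (x∙yz≈y∙xz)
      xs = consecutive c m
      T = range c m
      total : ∀ x d → x ⊗ d ⊕ x ⊗ (1ᴿ ⊕ ⊖ d) ≃ x
      total x d = R.trans (R.sym (R.distribˡ x d _)) (R.trans (R.*-congˡ
        (R.trans (x∙yz≈y∙xz d 1ᴿ _) (R.trans (R.+-congˡ (R.-‿inverseʳ d)) (R.+-identityʳ 1ᴿ)))) (R.*-identityʳ x))

    -- One more car after n cars have parked on {c, …, c+n} ∖ {b}, where b = c+k.
    module LastCar (c : ℤ) (n k : ℕ) (k≤n : k ℕ.≤ n) where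
      b : ℤ
      b = c ℤ.+ + k
      j = n ℕ.∸ k
      xs = consecutive c (suc n)
      S = remove b (range c (suc n))
      I₁ = range c k
      I₂ = range (sucℤ b) j

      -- The spot b counts as upper. It is absent from S, so this does not affect the separation,
      -- but the alphabet of the upper subword is `b ∷ consecutive (sucℤ b) j`.
      σ : ℤ → Bool
      σ x = does (x ℤₚ.<? b)

      σ-true : ∀ {x} → x < b → σ x ≡ true
      σ-true {x} = dec-true (x ℤₚ.<? b)

      σ-false : ∀ {x} → b ≤ x → σ x ≡ false
      σ-false {x} b≤x = dec-false (x ℤₚ.<? b) (λ x<b → ℤₚ.<-irrefl refl (ℤₚ.<-≤-trans x<b b≤x))

      σ-true⁻ : ∀ {x} → σ x ≡ true → x < b
      σ-true⁻ {x} σx with x ℤₚ.<? b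
      ... | yes x<b = x<b

      σ-false⁻ : ∀ {x} → σ x ≡ false → b ≤ x
      σ-false⁻ {x} σx with x ℤₚ.<? b
      ... | no x≮b = ℤₚ.≮⇒≥ x≮b

      b+sj≡ : b ℤ.+ + suc j ≡ c ℤ.+ + suc n
      b+sj≡ = trans (ℤₚ.+-assoc c (+ k) (+ suc j)) (cong (λ i → c ℤ.+ + i)
        (trans (ℕₚ.+-suc k j) (cong suc (ℕₚ.m+[n∸m]≡n k≤n))))

      c≤b : c ≤ b
      c≤b = ℤₚ.i≤i+j c (+ k)

      b<end : b < c ℤ.+ + suc n
      b<end = subst (b <_) b+sj≡ (ℤₚ.<-≤-trans (i<suc b)
        (subst (sucℤ b ≤_) (sucℤ-+ b j) (ℤₚ.i≤i+j (sucℤ b) (+ j))))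

      low : sideˢ σ true (range c (suc n)) ≡ I₁
      low = FinSet-ext
        (λ x x∈ → let x∈′ , σx = ∈-sideˢ⁻ σ (range c (suc n)) x∈ in
          ∈-consecutive⁺ c k (proj₁ (∈-consecutive⁻ c (suc n) x∈′)) (σ-true⁻ σx))
        (λ x x∈ → let c≤x , x<b = ∈-consecutive⁻ c k x∈ in
          ∈-sideˢ⁺ σ (range c (suc n)) (∈-consecutive⁺ c (suc n) c≤x (ℤₚ.<-trans x<b b<end)) (σ-true x<b))

      high : sideˢ σ false (range c (suc n)) ≡ range b (suc j)
      high = FinSet-ext
        (λ x x∈ → let x∈′ , σx = ∈-sideˢ⁻ σ (range c (suc n)) x∈ in
          ∈-consecutive⁺ b (suc j) (σ-false⁻ σx)
            (subst (x <_) (sym b+sj≡) (proj₂ (∈-consecutive⁻ c (suc n) x∈′))))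
        (λ x x∈ → let b≤x , x< = ∈-consecutive⁻ b (suc j) x∈ in
          ∈-sideˢ⁺ σ (range c (suc n)) (∈-consecutive⁺ c (suc n) (ℤₚ.≤-trans c≤b b≤x)
            (subst (x <_) b+sj≡ x<)) (σ-false b≤x))

      b∉I₂ : b ∉ I₂
      b∉I₂ b∈ = ℤₚ.<-irrefl refl (ℤₚ.<-≤-trans (i<suc b) (proj₁ (∈-consecutive⁻ (sucℤ b) j b∈)))

      S-low : sideˢ σ true S ≡ I₁
      S-low = trans (sideˢ-remove-≢ σ b (range c (suc n))
        (λ σb → ℤₚ.<-irrefl refl (σ-true⁻ σb))) low

      S-high : sideˢ σ false S ≡ I₂
      S-high = trans (sideˢ-remove σ b (range c (suc n))) (trans (cong (remove b) high) (FinSet-ext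
        (λ x x∈ → case ∈-remove⁻ (range b (suc j)) x∈ of λ where
          (here refl , x≢b) → ⊥-elim (x≢b refl)
          (there x∈′ , _)   → x∈′)
        (λ x x∈ → ∈-remove⁺ (range b (suc j)) (there x∈) (λ { refl → b∉I₂ x∈ }))))

      separated : Separated σ S
      -- The labels of x and x + 1 could differ only for x + 1 = b, which is not in S.
      separated x x∈ x+1∈ = case x ℤₚ.<? b of λ where
          (yes x<b) → trans (σ-true x<b) (sym (σ-true (ℤₚ.≤∧≢⇒< (ℤₚ.i<j⇒suc[i]≤j x<b)
                        (λ e → ∉-remove b (range c (suc n)) (subst (_∈ S) e x+1∈)))))
          (no x≮b)  → trans (σ-false (ℤₚ.≮⇒≥ x≮b)) (sym (σ-false (ℤₚ.i≤j⇒i≤1+j (ℤₚ.≮⇒≥ x≮b))))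

      ∑-xs : ∀ f → ∑ xs f ≃ ∑ (consecutive c k) f ⊕ (f b ⊕ ∑ (consecutive (sucℤ b) j) f)
      ∑-xs f = R.trans (∑-side σ xs f)
        (R.reflexive (cong₂ (λ ys zs → ∑ ys f ⊕ ∑ zs f) (cong elements low) (cong elements high)))

      p₁ p₂ goRight goLeft : Word → ℝ
      p₁ U = ℙ P U I₁
      p₂ V = ℙ P V I₂
      goRight U = ∑ (consecutive c k) (λ a → ℙ P U I₁ ⊗ dir P U I₁ a)
      goLeft  V = ∑ (consecutive (sucℤ b) j) (λ a → ℙ P V I₂ ⊗ (1ᴿ ⊕ ⊖ dir P V I₂ a))

      ℙ-split : ∀ W → ℙ P W S ≃ p₁ (side σ true W) ⊗ p₂ (side σ false W)
      ℙ-split W = R.trans (factors P L W σ true S separated)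
        (R.reflexive (cong₂ (λ T T′ → ℙ P (side σ true W) T ⊗ ℙ P (side σ false W) T′) S-low S-high))

      step-right : ∀ U {a} → a ∈ I₁ → step P U I₁ a b ≃ dir P U I₁ a
      step-right U {a} a∈ = R.trans (R.reflexive (step-block P U I₁ b (range-block c k a∈)))
        (R.trans (R.+-cong
          (R.trans (R.*-congˡ ([]-yes (b ℤ.≟ sucℤ (pred b)) (sym (ℤₚ.suc-pred b)))) (R.*-identityʳ _))
          (R.trans (R.*-congˡ ([]-no (b ℤ.≟ pred c)
            (λ e → ℤₚ.<-irrefl (sym e) (ℤₚ.<-≤-trans (pred< c) c≤b)))) (R.zeroʳ _)))
          (R.+-identityʳ _))

      step-left : ∀ V {a} → a ∈ I₂ → step P V I₂ a b ≃ 1ᴿ ⊕ ⊖ dir P V I₂ a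
      step-left V {a} a∈ = R.trans (R.reflexive (step-block P V I₂ b (range-block (sucℤ b) j a∈)))
        (R.trans (R.+-cong
          (R.trans (R.*-congˡ ([]-no (b ℤ.≟ sucℤ (pred (sucℤ b ℤ.+ + j)))
            (λ e → ℤₚ.<-irrefl (trans e (ℤₚ.suc-pred _))
              (ℤₚ.<-≤-trans (i<suc b) (ℤₚ.i≤i+j (sucℤ b) (+ j)))))) (R.zeroʳ _))
          (R.trans (R.*-congˡ ([]-yes (b ℤ.≟ pred (sucℤ b)) (sym (ℤₚ.pred-suc b)))) (R.*-identityʳ _)))
          (R.+-identityˡ _))

      ∑-letter : ∀ W → ∑ xs (λ a → ℙ P W S ⊗ step P W S a b) ≃
        goRight (side σ true W) ⊗ p₂ (side σ false W) ⊕
        (p₁ (side σ true W) ⊗ p₂ (side σ false W) ⊕ p₁ (side σ true W) ⊗ goLeft (side σ false W))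
      ∑-letter W = R.trans (∑-xs _) (R.+-cong rights (R.+-cong middle lefts))
        where
        U = side σ true W
        V = side σ false W
        rights = begin
          ∑ (consecutive c k) (λ a → ℙ P W S ⊗ step P W S a b)
            ≈⟨ ∑-cong (consecutive c k) (λ a a∈ → begin
                 ℙ P W S ⊗ step P W S a b
                   ≈⟨ step-side P L W (factors P L W) σ S b separated (σ-true (proj₂ (∈-consecutive⁻ c k a∈))) ⟩
                 ℙ P W S ⊗ step P U (sideˢ σ true S) a b
                   ≈⟨ R.*-cong (ℙ-split W)
                        (R.trans (R.reflexive (cong (λ T → step P U T a b) S-low)) (step-right U a∈)) ⟩
                 p₁ U ⊗ p₂ V ⊗ dir P U I₁ a
                   ≈⟨ xy∙z≈xz∙y _ _ _ ⟩
                 p₁ U ⊗ dir P U I₁ a ⊗ p₂ V ∎) ⟩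
          ∑ (consecutive c k) (λ a → p₁ U ⊗ dir P U I₁ a ⊗ p₂ V)
            ≈⟨ ∑-* (p₂ V) (consecutive c k) _ ⟨
          goRight U ⊗ p₂ V ∎
          where open CommutativeSemigroupProperties R.*-commutativeSemigroup using (xy∙z≈xz∙y)
        middle = begin
          ℙ P W S ⊗ step P W S b b
            ≈⟨ R.*-cong (ℙ-split W) (R.trans (R.reflexive (step-free P W S b (∉-remove b (range c (suc n)))))
                 ([]-yes (b ℤ.≟ b) refl)) ⟩
          p₁ U ⊗ p₂ V ⊗ 1ᴿ
            ≈⟨ R.*-identityʳ _ ⟩
          p₁ U ⊗ p₂ V ∎
        lefts = begin
          ∑ (consecutive (sucℤ b) j) (λ a → ℙ P W S ⊗ step P W S a b)
            ≈⟨ ∑-cong (consecutive (sucℤ b) j) (λ a a∈ → begin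
                 ℙ P W S ⊗ step P W S a b
                   ≈⟨ step-side P L W (factors P L W) σ S b separated
                        (σ-false (ℤₚ.≤-trans (ℤₚ.i≤suc[i] b) (proj₁ (∈-consecutive⁻ (sucℤ b) j a∈)))) ⟩
                 ℙ P W S ⊗ step P V (sideˢ σ false S) a b
                   ≈⟨ R.*-cong (ℙ-split W)
                        (R.trans (R.reflexive (cong (λ T → step P V T a b) S-high)) (step-left V a∈)) ⟩
                 p₁ U ⊗ p₂ V ⊗ (1ᴿ ⊕ ⊖ dir P V I₂ a)
                   ≈⟨ R.*-assoc _ _ _ ⟩
                 p₁ U ⊗ (p₂ V ⊗ (1ᴿ ⊕ ⊖ dir P V I₂ a)) ∎) ⟩
          ∑ (consecutive (sucℤ b) j) (λ a → p₁ U ⊗ (p₂ V ⊗ (1ᴿ ⊕ ⊖ dir P V I₂ a)))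
            ≈⟨ *-∑ (p₁ U) (consecutive (sucℤ b) j) _ ⟨
          p₁ U ⊗ goLeft V ∎

      -- `∑ʷ-shuffle` yields all lengths i of the lower subword, but F vanishes unless i = k. The
      -- result is kept as a full convolution with an indicator, so that the later sum over k
      -- restores the convolution without any binomial coefficient. The functions f and g are
      -- separate from F and G because the values of G on the upper block are identified with those
      -- at c only by a shift.
      collapse : ∀ F G (f g : ℕ → ℝ) →
        (∀ W → ¬ IsVertex W I₁ → F W ≃ 0ᴿ) → (∀ W → ¬ IsVertex W I₂ → G W ≃ 0ᴿ) →
        ∑ʷ (consecutive c k) k F ≃ f k → ∑ʷ (consecutive (sucℤ b) j) j G ≃ g j →
        ∑ʷ xs n (λ W → F (side σ true W) ⊗ G (side σ false W)) ≃ conv n (λ i → [ i ℕ.≟ k ] ⊗ f i) g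
      collapse F G f g F≃0 G≃0 ∑F ∑G = begin
        ∑ʷ xs n (λ W → F (side σ true W) ⊗ G (side σ false W))
          ≈⟨ ∑ʷ-shuffle σ xs n F G ⟩
        conv n (λ i → ∑ʷ (side σ true xs) i F) (λ i → ∑ʷ (side σ false xs) i G)
          ≡⟨ cong₂ (λ ys zs → conv n (λ i → ∑ʷ ys i F) (λ i → ∑ʷ zs i G))
               (cong elements low) (cong elements high) ⟩
        conv n (λ i → ∑ʷ (consecutive c k) i F) (λ i → ∑ʷ (b ∷ consecutive (sucℤ b) j) i G)
          ≈⟨ conv-cong n (λ i i′ i+i′≡n → term i i′ i+i′≡n (i ℕ.≟ k)) ⟩
        conv n (λ i → [ i ℕ.≟ k ] ⊗ f i) g ∎
        where
        term : ∀ i i′ → i ℕ.+ i′ ≡ n → Dec (i ≡ k) →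
          ∑ʷ (consecutive c k) i F ⊗ ∑ʷ (b ∷ consecutive (sucℤ b) j) i′ G ≃ [ i ℕ.≟ k ] ⊗ f i ⊗ g i′
        -- With i = k, the upper subword has the remaining length i′ = n - k, which is j.
        term i i′ i+i′≡n (yes refl) with trans (sym (ℕₚ.m+n∸m≡n i i′)) (cong (ℕ._∸ i) i+i′≡n)
        ... | refl = R.*-cong
          (R.trans ∑F (R.sym (R.trans (R.*-congʳ ([]-yes (i ℕ.≟ k) refl)) (R.*-identityˡ _))))
          (R.trans (∑ʷ-drop b (consecutive (sucℤ b) j) j
            (λ W b∈ → G≃0 W (λ (_ , all) → b∉I₂ (All.lookup all b∈)))) ∑G)
        term i i′ _ (no i≢k) = R.trans
          (R.trans (R.*-congʳ (∑ʷ-zero (consecutive c k) i (λ W len → F≃0 W (λ (len′ , _) →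
            i≢k (trans (sym len) (trans len′ (length-consecutive c k))))))) (R.zeroˡ _))
          (R.sym (R.trans (R.*-congʳ (R.trans (R.*-congʳ ([]-no (i ℕ.≟ k) i≢k)) (R.zeroˡ _))) (R.zeroˡ _)))

      last-car : ∑ʷ xs n (λ W → ∑ xs (λ a → ℙ P W S ⊗ step P W S a b)) ≃
        conv n (λ i → [ i ℕ.≟ k ] ⊗ rightward c i) (parked c) ⊕
        (conv n (λ i → [ i ℕ.≟ k ] ⊗ parked c i) (parked c) ⊕
         conv n (λ i → [ i ℕ.≟ k ] ⊗ parked c i) (leftward c))
      last-car = R.trans (∑ʷ-cong xs n (λ W _ _ → ∑-letter W))
        (R.trans (∑ʷ-+ xs n _ _) (R.+-cong
          (collapse goRight p₂ (rightward c) (parked c) goRight≃0 p₂≃0 R.refl parked₂)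
          (R.trans (∑ʷ-+ xs n _ _) (R.+-cong
            (collapse p₁ p₂ (parked c) (parked c) p₁≃0 p₂≃0 R.refl parked₂)
            (collapse p₁ goLeft (parked c) (leftward c) p₁≃0 goLeft≃0 R.refl leftward₂)))))
        where
        p₁≃0 = λ W ¬v → ℙ-nonvertex P W I₁ ¬v
        p₂≃0 = λ W ¬v → ℙ-nonvertex P W I₂ ¬v
        goRight≃0 : ∀ W → ¬ IsVertex W I₁ → goRight W ≃ 0ᴿ
        goRight≃0 W ¬v = ∑-zero (consecutive c k) (λ _ _ → R.trans (R.*-congʳ (p₁≃0 W ¬v)) (R.zeroˡ _))
        goLeft≃0 : ∀ W → ¬ IsVertex W I₂ → goLeft W ≃ 0ᴿ
        goLeft≃0 W ¬v = ∑-zero (consecutive (sucℤ b) j) (λ _ _ → R.trans (R.*-congʳ (p₂≃0 W ¬v)) (R.zeroˡ _))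
        parked₂ : parked (sucℤ b) j ≃ parked c j
        parked₂ = R.trans (parked-shift b j) (iterate-shift (λ c → parked c j) (λ c → parked-shift c j) c k)
        leftward₂ : leftward (sucℤ b) j ≃ leftward c j
        leftward₂ = R.trans (leftward-shift b j) (iterate-shift (λ c → leftward c j) (λ c → leftward-shift c j) c k)

    -- Every index i of the convolution satisfies i ≤ n and is therefore hit by exactly one k.
    ∑-conv-indicator : ∀ n (f g : ℕ → ℝ) →
      ∑ (upTo (suc n)) (λ k → conv n (λ i → [ i ℕ.≟ k ] ⊗ f i) g) ≃ conv n f g
    ∑-conv-indicator n f g = R.trans (R.sym (conv-∑ˡ n (upTo (suc n)) _ g)) (conv-congˡ n (λ i i≤n → R.trans
      (∑-single (Uniqueₚ.upTo⁺ (suc n)) i (Memₚ.∈-upTo⁺ (ℕ.s≤s i≤n))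
        (λ k _ k≢i → R.trans (R.*-congʳ ([]-no (i ℕ.≟ k) (k≢i ∘ sym))) (R.zeroˡ _)))
      (R.trans (R.*-congʳ ([]-yes (i ℕ.≟ i) refl)) (R.*-identityˡ _))))

    parked-recurrence : ∀ c n → parked c (suc n) ≃ conv n (λ i → fromℕ (suc i) ⊗ parked c i) (parked c)
    parked-recurrence c n = begin
      ∑ xs (λ a → ∑ʷ xs n (λ W → ℙ P (W ∷ʳ a) T))
        ≈⟨ ∑-cong xs (λ a _ → ∑ʷ-cong xs n (λ W _ _ → ℙ-∷ʳ P W a T)) ⟩
      ∑ xs (λ a → ∑ʷ xs n (λ W → ∑ xs (λ b → term W a b)))
        ≈⟨ ∑ʷ-∑ xs n xs (λ a W → ∑ xs (λ b → term W a b)) ⟨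
      ∑ʷ xs n (λ W → ∑ xs (λ a → ∑ xs (λ b → term W a b)))
        ≈⟨ ∑ʷ-cong xs n (λ W _ _ → ∑-swap xs xs (term W)) ⟩
      ∑ʷ xs n (λ W → ∑ xs (λ b → ∑ xs (λ a → term W a b)))
        ≈⟨ ∑ʷ-∑ xs n xs (λ b W → ∑ xs (λ a → term W a b)) ⟩
      ∑ xs (λ b → ∑ʷ xs n (λ W → ∑ xs (λ a → term W a b)))
        ≡⟨ ∑-consecutive c (suc n) _ ⟩
      ∑ (upTo (suc n)) (λ k → ∑ʷ xs n (λ W → ∑ xs (λ a → term W a (c ℤ.+ + k))))
        ≈⟨ ∑-cong (upTo (suc n)) (λ k k∈ → LastCar.last-car c n k (ℕₚ.≤-pred (Memₚ.∈-upTo⁻ k∈))) ⟩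
      ∑ (upTo (suc n)) (λ k → conv n (λ i → [ i ℕ.≟ k ] ⊗ rightward c i) (parked c) ⊕
        (conv n (λ i → [ i ℕ.≟ k ] ⊗ parked c i) (parked c) ⊕
         conv n (λ i → [ i ℕ.≟ k ] ⊗ parked c i) (leftward c)))
        ≈⟨ R.trans (∑-+ (upTo (suc n)) _ _) (R.+-cong (∑-conv-indicator n _ _)
             (R.trans (∑-+ (upTo (suc n)) _ _) (R.+-cong (∑-conv-indicator n _ _) (∑-conv-indicator n _ _)))) ⟩
      conv n (rightward c) (parked c) ⊕ (conv n (parked c) (parked c) ⊕ conv n (parked c) (leftward c))
        -- `leftward` is moved to the first factor, where it joins `rightward` and `parked` at the
        -- same index.
        ≈⟨ R.+-congˡ (R.+-congˡ (conv-comm n (parked c) (leftward c))) ⟩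
      conv n (rightward c) (parked c) ⊕ (conv n (parked c) (parked c) ⊕ conv n (leftward c) (parked c))
        ≈⟨ R.trans (conv-+ˡ n _ _ (parked c)) (R.+-congˡ (conv-+ˡ n _ _ (parked c))) ⟨
      conv n (λ i → rightward c i ⊕ (parked c i ⊕ leftward c i)) (parked c)
        ≈⟨ conv-congˡ n (λ i _ → right+parked+left c i) ⟩
      conv n (λ i → fromℕ (suc i) ⊗ parked c i) (parked c) ∎
      where
      xs = consecutive c (suc n)
      T = range c (suc n)
      term : Word → ℤ → ℤ → ℝ
      term W a b = ℙ P W (remove b T) ⊗ step P W (remove b T) a b

    -- The recurrence refers to all smaller lengths, so the induction runs on a bound n for m. The
    -- value `α 1 m` is (m + 1)^(m-1), read as 1 for m = 0.
    parked≃α : ∀ c n m → m ℕ.≤ n → parked c m ≃ fromℕ (α 1 m)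
    parked≃α c n zero _ = R.trans ([]-yes (∅ ≟ˢ range c 0) (elements-injective refl)) (R.sym fromℕ-1)
    parked≃α c (suc n) (suc m) (ℕ.s≤s m≤n) = begin
      parked c (suc m)
        ≈⟨ parked-recurrence c m ⟩
      conv m (λ i → fromℕ (suc i) ⊗ parked c i) (parked c)
        ≈⟨ conv-cong m (λ { i i′ refl → R.*-cong
             (R.trans (R.*-congˡ (parked≃α c n i (ℕₚ.≤-trans (ℕₚ.m≤m+n i i′) m≤n)))
                      (R.sym (fromℕ-* (suc i) (α 1 i))))
             (parked≃α c n i′ (ℕₚ.≤-trans (ℕₚ.m≤n+m i′ i) m≤n)) }) ⟩
      conv m (λ i → fromℕ (suc i ℕ.* α 1 i)) (λ i → fromℕ (α 1 i))
        ≈⟨ fromℕ-conv m (λ i → suc i ℕ.* α 1 i) (α 1) ⟨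
      fromℕ (ℕ-Summation.conv m (λ i → suc i ℕ.* α 1 i) (α 1))
        ≡⟨ cong fromℕ (abel′) ⟩
      fromℕ (α 1 (suc m)) ∎
      where
      abel′ : ℕ-Summation.conv m (λ i → suc i ℕ.* α 1 i) (α 1) ≡ α 1 (suc m)
      -- By `α-β` at x = 1, `suc i ℕ.* α 1 i` is `β 1 i`. Abel's identity with x = y = 1 then gives
      -- (m + 2)^m, which is `α 1 (suc m)`.
      abel′ = trans (ℕ-Summation.conv-congˡ m (λ i _ → trans (α-β 1 i) (ℕₚ.*-identityˡ (β 1 i))))
        (trans (ℕ-Summation.conv-comm m (β 1) (α 1))
        (trans (abel m 1 1) (sym (ℕₚ.*-identityˡ ((2 ℕ.+ m) ℕ.^ m)))))

-- The finite support and the total of the parking probabilities.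

open import Data.Nat using (ℕ; _+_; _∸_; _^_; _≤_)
open import Data.Integer using (ℤ)
open import Data.Vec using (Vec; toList)
open Sums
open Abel using (α)
open Sets using (unique)
open Reals
open Parking
open Counting
open Summation R.commutativeSemiring
open SetoidReasoning R.setoid

theorem4p2 : (P : ParkingProcedure) → Local P → (r : ℕ) → 1 ≤ r →
    HasSum {Vec ℤ r} (λ W → Park P (toList W)) (fromℕ ((r + 1) ^ (r ∸ 1)))
theorem4p2 P L r@(suc n) _ = record
  { support = vectors xs r
  ; unique  = vectors-unique (unique (range (+ 1) r)) r
  -- A word outside the support has a letter outside 1, ..., r and so forms no vertex with this set.
  ; outside = λ v v∉ → approx (R.trans (Park≃ℙ v) (ℙ-nonvertex P (toList v) (range (+ 1) r)
      (λ (_ , all) → v∉ (∈-vectors v (λ _ → All.lookup all)))))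
  ; total   = approx (begin
      sumᴿ (map (Park P ∘ toList) (vectors xs r))
        ≈⟨ sumᴿ≃∑ (vectors xs r) (Park P ∘ toList) ⟩
      ∑ (vectors xs r) (Park P ∘ toList)
        ≈⟨ ∑-cong (vectors xs r) (λ v _ → Park≃ℙ v) ⟩
      ∑ (vectors xs r) (λ v → ℙ P (toList v) (range (+ 1) r))
        ≈⟨ ∑-vectors xs r (λ W → ℙ P W (range (+ 1) r)) ⟩
      parked P L (+ 1) r
        ≈⟨ parked≃α P L (+ 1) r r ℕₚ.≤-refl ⟩
      fromℕ (α 1 r)
        ≡⟨ cong fromℕ (trans (ℕₚ.*-identityˡ ((2 + n) ^ n)) (cong (_^ n) (ℕₚ.+-comm 1 r))) ⟩
      fromℕ ((r + 1) ^ n) ∎)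
  }
  where
  xs = consecutive (+ 1) r
  Park≃ℙ : (v : Vec ℤ r) → Park P (toList v) ≃ ℙ P (toList v) (range (+ 1) r)
  Park≃ℙ v = R.trans (𝒫≃ℙ P (toList v) (interval (+ 1) (+ length (toList v))))
    (R.reflexive (cong (ℙ P (toList v)) (trans (cong (λ m → interval (+ 1) (+ m)) (Vecₚ.length-toList v))
      (interval≡range r))))
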